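{- Let $1<m<2000$ be a square free integer with $m\equiv 2,3 \pmod 4$, and if $400<m<2000$ assume in addition that $m$ is odd. Let $\alpha=\sqrt[4]{m}$ and $K=\mathbb{Q}(\alpha)$. Then, up to equivalence, the only generators of power integral bases in $K$ are the elements $\vartheta=x\alpha+y\alpha^2+z\alpha^3$ with $(x,y,z)=(1,0,0)$ for arbitrary such $m$, $(x,y,z)=(1,\pm 1,1)$ for $m=2$, $(x,y,z)=(4,\pm 2,1)$ for $m=15$, $(x,y,z)=(25,\pm 10,4)$ for $m=39$, $(x,y,z)=(9,\pm 3,1)$ for $m=82$, $(x,y,z)=(16,\pm 4,1)$ for $m=255$, $(x,y,z)=(121,\pm 22,4)$ for $m=915$, $(x,y,z)=(36,\pm 6,1)$ for $m=1295$.
   Context: For a number field $K$ of degree $n$ with ring of integers $\mathbb{Z}_K$, an element $\gamma\in\mathbb{Z}_K$ generates a power integral basis if $\{1,\gamma,\ldots,\gamma^{n-1}\}$ is an integral basis of $K$. Two elements $\beta,\gamma\in\mathbb{Z}_K$ are called equivalent if $\beta+\gamma\in\mathbb{Z}$ or $\beta-\gamma\in\mathbb{Z}$; generators are considered only up to this equivalence. For $m$ square free with $m\equiv 2,3\pmod 4$, $\{1,\alpha,\alpha^2,\alpha^3\}$ is an integral basis of $K$. -}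

module Defs where

open import Data.Nat as ℕ using (ℕ; _%_)
open import Data.Nat.Divisibility using (_∣_)
open import Data.Integer using (ℤ; +_; -_; _+_; _*_; 0ℤ; 1ℤ)
open import Data.Fin using (Fin; zero; suc)
open import Data.Product using (Σ; _×_; _,_)
open import Data.Sum using (_⊎_)
open import Data.List using (List; []; _∷_; _++_)
open import Relation.Binary.PropositionalEquality using (_≡_)
open import Relation.Nullary.Decidable using (⌊_⌋)
open import Data.Bool using (if_then_else_)

SquareFree : ℕ → Set
SquareFree m = ∀ (d : ℕ) → (d ℕ.* d) ∣ m → d ≡ 1

-- Elements of Z_K = Z[α], α⁴ = m, written in the integral basis 1, α, α², α³:
-- ⟨ a0 , a1 , a2 , a3 ⟩ stands for a0 + a1 α + a2 α² + a3 α³.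
record Elt : Set where
  constructor ⟨_,_,_,_⟩
  field
    c0 c1 c2 c3 : ℤ
open Elt public

zeroE : Elt
zeroE = ⟨ 0ℤ , 0ℤ , 0ℤ , 0ℤ ⟩

oneE : Elt
oneE = ⟨ 1ℤ , 0ℤ , 0ℤ , 0ℤ ⟩

basis : Fin 4 → Elt
basis zero = ⟨ 1ℤ , 0ℤ , 0ℤ , 0ℤ ⟩
basis (suc zero) = ⟨ 0ℤ , 1ℤ , 0ℤ , 0ℤ ⟩
basis (suc (suc zero)) = ⟨ 0ℤ , 0ℤ , 1ℤ , 0ℤ ⟩
basis (suc (suc (suc zero))) = ⟨ 0ℤ , 0ℤ , 0ℤ , 1ℤ ⟩

addE : Elt → Elt → Elt
addE ⟨ a0 , a1 , a2 , a3 ⟩ ⟨ b0 , b1 , b2 , b3 ⟩ =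
  ⟨ a0 + b0 , a1 + b1 , a2 + b2 , a3 + b3 ⟩

subE : Elt → Elt → Elt
subE ⟨ a0 , a1 , a2 , a3 ⟩ ⟨ b0 , b1 , b2 , b3 ⟩ =
  ⟨ a0 + - b0 , a1 + - b1 , a2 + - b2 , a3 + - b3 ⟩

scaleE : ℤ → Elt → Elt
scaleE k ⟨ a0 , a1 , a2 , a3 ⟩ = ⟨ k * a0 , k * a1 , k * a2 , k * a3 ⟩

-- multiplication in Z[α] with α⁴ = m
mulE : ℕ → Elt → Elt → Elt
mulE m ⟨ a0 , a1 , a2 , a3 ⟩ ⟨ b0 , b1 , b2 , b3 ⟩ =
  ⟨ a0 * b0 + M * (a1 * b3 + a2 * b2 + a3 * b1)
  , a0 * b1 + a1 * b0 + M * (a2 * b3 + a3 * b2)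
  , a0 * b2 + a1 * b1 + a2 * b0 + M * (a3 * b3)
  , a0 * b3 + a1 * b2 + a2 * b1 + a3 * b0 ⟩
  where M = + m

powE : ℕ → Elt → ℕ → Elt
powE m γ ℕ.zero = oneE
powE m γ (ℕ.suc k) = mulE m γ (powE m γ k)

powComb : ℕ → Elt → (Fin 4 → ℤ) → Elt
powComb m γ c =
  addE (scaleE (c zero) (powE m γ 0))
  (addE (scaleE (c (suc zero)) (powE m γ 1))
  (addE (scaleE (c (suc (suc zero))) (powE m γ 2))
        (scaleE (c (suc (suc (suc zero)))) (powE m γ 3))))

PowerIntegralBasisGen : ℕ → Elt → Set
PowerIntegralBasisGen m γ =
  (∀ (i : Fin 4) → Σ (Fin 4 → ℤ) λ c → powComb m γ c ≡ basis i)
  × (∀ (c : Fin 4 → ℤ) → powComb m γ c ≡ zeroE → ∀ j → c j ≡ 0ℤ)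

InZ : Elt → Set
InZ β = (c1 β ≡ 0ℤ) × (c2 β ≡ 0ℤ) × (c3 β ≡ 0ℤ)

Equivalent : Elt → Elt → Set
Equivalent β γ = InZ (addE β γ) ⊎ InZ (subE β γ)

theta : ℤ × ℤ × ℤ → Elt
theta (x , y , z) = ⟨ 0ℤ , x , y , z ⟩

private
  pm : ℕ → ℕ → ℕ → List (ℤ × ℤ × ℤ)
  pm x y z = (+ x , + y , + z) ∷ (+ x , - (+ y) , + z) ∷ []

extra : ℕ → List (ℤ × ℤ × ℤ)
extra m =
  when 2 (pm 1 1 1) ++ when 15 (pm 4 2 1) ++ when 39 (pm 25 10 4)
  ++ when 82 (pm 9 3 1) ++ when 255 (pm 16 4 1) ++ when 915 (pm 121 22 4)
  ++ when 1295 (pm 36 6 1)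
  where
    when : ℕ → List (ℤ × ℤ × ℤ) → List (ℤ × ℤ × ℤ)
    when k l = if ⌊ m ℕ.≟ k ⌋ then l else []

solutions : ℕ → List (ℤ × ℤ × ℤ)
solutions m = (+ 1 , + 0 , + 0) ∷ extra m

{-# OPTIONS --safe #-}
module Submission where

-- For γ = w + xα + yα² + zα³ the index is |δ (δ² + 4m κ²)| with δ = x² - m z² and
-- κ = y² - x z, so γ is a generator iff δ = ±1 and y² = x z.  Then |x| = a² and |z| = b²,
-- and everything rests on the Thue equations a⁴ - m b⁴ = ±1.
--
-- Factoring a⁴ - 1 = (a² - 1)(a² + 1) gives a² + 1 = T u⁴ and a² - 1 = R s⁴ for the
-- finitely many divisors of m; nearly all of these systems have no solution modulo some small
-- prime power, and the remaining ones either descend to a smaller solution or occur for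
-- m = 15, 39, 255, 915, 1295.  The equation a⁴ + 1 = m b⁴ survives only for
-- m = 2, 82, 146, 226, and the last two fall to the negative Pell equation.
--
-- For the other seven m there is a solution (a₀ , b₀).  For any solution (a , b) the quotient
-- of the conjugates a ± bα is, up to sign, a unit c + dα with c, d ∈ ℤ[√m] and
-- c² - √m d² = 1.  All such units are ± powers of the unit θ belonging to (a₀ , b₀), by a descent on c,
-- and c = ±(a² + b²√m)² has norm 1.  As a function of k, the norm of the ℤ[√m]-part of θᵏ is
-- p-adic analytic with simple zeros of (norm - 1) at k = ±1 (Skolem's method), and a sieve modulo
-- p leaves only the residue classes of ±1.

-- `K` has unit rank 2 and `ℚ(√m)` has unit rank 1, so the units of relative norm 1 have rank 1.
-- There is thus one unknown exponent `k` against the one equation norm = 1, and a single prime can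
-- settle it. That `θ` generates these units up to sign is not taken from tables of fundamental
-- units: the descent works for every unit above a size bound, and a finite search covers the units
-- below it.
--
-- The obstacle to a purely local treatment of `a⁴ - m b⁴ = 1` is the solution `(1, 0)`, present for
-- every `m`. It has `a` odd and belongs to the factorisation `a² + 1 = 2 u⁴`, which no congruence
-- can exclude; this is where the descent enters. In Skolem's method the same solution is the
-- exponent `k = 0`, which also has norm 1 but is not in the classes of `±1`. There the sieve uses
-- in addition the congruences of the exceptional factorisation of `a⁴ - 1`, which `(1, 0)` does not
-- satisfy.
--
-- All numerical work is the evaluation of Boolean tests. For each test it is proved, for an
-- arbitrary modulus, that a solution passes it, so a failed test is a contradiction.

open import Defs
open import Data.Nat using (ℕ; _<_; _%_)
open import Data.Integer using (ℤ)
open import Data.Product using (Σ; _×_; _,_)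
open import Data.Sum using (_⊎_)
open import Data.List.Membership.Propositional using (_∈_)
open import Relation.Binary.PropositionalEquality using (_≡_)

-- Coprime factors of `m` times a fourth power.

module FourthPowers where

  open import Data.Nat using (ℕ; zero; suc; _*_; ≢-nonZero)
  open import Data.Nat.Properties
  open import Data.Nat.Divisibility
  open import Data.Nat.GCD using (gcd; gcd[m,n]∣m; gcd[m,n]∣n; gcd-greatest; gcd[m,n]≢0)
  open import Data.Nat.Coprimality using (Coprime; coprime-divisor) renaming (sym to coprime-sym)
  open import Data.Nat.Tactic.RingSolver using (solve-∀)
  open import Data.Product using (∃; ∃₂; _×_; _,_)
  open import Data.Sum using (inj₁)
  open import Data.Empty using (⊥-elim)
  open import Relation.Binary.PropositionalEquality
  open import Relation.Binary.Definitions using (tri<; tri≈; tri>)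

  coprime-∣ˡ : ∀ {x x′ y} → x′ ∣ x → Coprime x y → Coprime x′ y
  coprime-∣ˡ x′∣x c (d∣x′ , d∣y) = c (∣-trans d∣x′ x′∣x , d∣y)

  gcd-cofactors : ∀ x z → x ≢ 0 → ∃ λ g → ∃₂ λ x′ z′ → g ≢ 0 × x ≡ x′ * g × z ≡ z′ * g × Coprime x′ z′
  gcd-cofactors x z x≢0 with gcd[m,n]∣m x z | gcd[m,n]∣n x z
  ... | divides x′ p | divides z′ q = gcd x z , x′ , z′ , g≢0 , p , q , cop
    where
    g≢0 : gcd x z ≢ 0
    g≢0 = gcd[m,n]≢0 x z (inj₁ x≢0)
    cop : Coprime x′ z′
    cop {d} (d∣x′ , d∣z′) = *-cancelʳ-≡ d 1 (gcd x z) {{≢-nonZero g≢0}} (trans (∣-antisym dg∣g (n∣m*n d)) (sym (*-identityˡ _)))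
      where
      dg∣g : d * gcd x z ∣ gcd x z
      dg∣g = gcd-greatest (subst (d * gcd x z ∣_) (sym p) (*-monoˡ-∣ _ d∣x′))
                          (subst (d * gcd x z ∣_) (sym q) (*-monoˡ-∣ _ d∣z′))

  -- Cancelling `g = gcd x z` leaves `x′ y = g z′²` with `x′`, `z′` coprime. Then `x′` divides `g`,
  -- being coprime to `z′`, and `g` divides `x′`, being a divisor of `x` and so coprime to `y`.
  -- Prime factorisations are avoided.
  coprime-square : ∀ x y z → Coprime x y → x * y ≡ z * z → ∃ λ g → x ≡ g * g
  coprime-square zero y z c e = 0 , refl
  coprime-square x@(suc _) y z c e with gcd-cofactors x z (λ ())
  ... | g , x′ , z′ , g≢0 , p , q , c′ = g , trans p (cong (_* g) (∣-antisym x′∣g g∣x′))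
    where
    e′ : x′ * y ≡ g * (z′ * z′)
    e′ = *-cancelʳ-≡ _ _ g {{≢-nonZero g≢0}} (trans (lhs x′ y g) (trans (sym (cong (_* y) p)) (trans e (trans (cong₂ _*_ q q) (rhs z′ g)))))
      where
      lhs : ∀ x y g → x * y * g ≡ x * g * y
      lhs = solve-∀
      rhs : ∀ z g → z * g * (z * g) ≡ g * (z * z) * g
      rhs = solve-∀
    x′∣g : x′ ∣ g
    x′∣g = coprime-divisor c′ (coprime-divisor c′ (subst (x′ ∣_) (trans e′ (assoc g z′)) (m∣m*n y)))
      where
      assoc : ∀ g z → g * (z * z) ≡ z * (z * g)
      assoc = solve-∀
    g∣x′ : g ∣ x′
    g∣x′ = coprime-divisor (coprime-∣ˡ (divides x′ p) c) (subst (g ∣_) (trans (sym e′) (*-comm x′ y)) (m∣m*n (z′ * z′)))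

  infix 30 _⁴
  _⁴ : ℕ → ℕ
  n ⁴ = n * n * (n * n)

  square-injective : ∀ {x y} → x * x ≡ y * y → x ≡ y
  square-injective {x} {y} e with <-cmp x y
  ... | tri< x<y _ _ = ⊥-elim (<⇒≢ (*-mono-< x<y x<y) e)
  ... | tri≈ _ x≡y _ = x≡y
  ... | tri> _ _ y<x = ⊥-elim (<⇒≢ (*-mono-< y<x y<x) (sym e))

  ⁴-injective : ∀ {x y} → x ⁴ ≡ y ⁴ → x ≡ y
  ⁴-injective e = square-injective (square-injective e)

  coprime-fourth : ∀ x y z → Coprime x y → x * y ≡ z ⁴ → ∃₂ λ u s → x ≡ u ⁴ × y ≡ s ⁴ × u * s ≡ z
  coprime-fourth x y z c e with coprime-square x y (z * z) c e | coprime-square y x (z * z) (coprime-sym c) (trans (*-comm y x) e)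
  ... | u₂ , refl | s₂ , refl = split (coprime-square u₂ s₂ z c₂ e₂) (coprime-square s₂ u₂ z (coprime-sym c₂) (trans (*-comm s₂ u₂) e₂))
    where
    interchange : ∀ u s → (u * s) * (u * s) ≡ u * u * (s * s)
    interchange = solve-∀
    c₂ : Coprime u₂ s₂
    c₂ (p , q) = c (∣-trans p (m∣m*n u₂) , ∣-trans q (m∣m*n s₂))
    e₂ : u₂ * s₂ ≡ z * z
    e₂ = square-injective (trans (interchange u₂ s₂) e)
    split : (∃ λ u → u₂ ≡ u * u) → (∃ λ s → s₂ ≡ s * s) → ∃₂ λ u s → u₂ * u₂ ≡ u ⁴ × s₂ * s₂ ≡ s ⁴ × u * s ≡ z
    split (u , refl) (s , refl) = u , s , refl , refl , square-injective (trans (interchange u s) e₂)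

  record Splitting (m x y z : ℕ) : Set where
    constructor splitting
    field
      t r u s : ℕ
      tr≡m : t * r ≡ m
      x≡tu⁴ : x ≡ t * u ⁴
      y≡rs⁴ : y ≡ r * s ⁴
      us≡z : u * s ≡ z

  -- Take `t = gcd m x`. The cofactor of `t` in `m` is coprime to that in `x`, so it divides `y` and
  -- serves as `r`; the two remaining factors are coprime with product `z⁴`.
  coprime-splitting : ∀ m x y z → m ≢ 0 → Coprime x y → x * y ≡ m * z ⁴ → Splitting m x y z
  coprime-splitting m x y z m≢0 c e with gcd-cofactors m x m≢0
  ... | t , m′ , x′ , t≢0 , refl , refl , c′ = finish m′∣y
    where
    e′ : x′ * y ≡ m′ * z ⁴
    e′ = *-cancelʳ-≡ _ _ t {{≢-nonZero t≢0}} (trans (swap x′ y t) (trans e (swap m′ t (z ⁴))))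
      where
      swap : ∀ x y g → x * y * g ≡ x * g * y
      swap = solve-∀
    m′∣y : m′ ∣ y
    m′∣y = coprime-divisor c′ (subst (m′ ∣_) (sym e′) (m∣m*n (z ⁴)))
    finish : m′ ∣ y → Splitting (m′ * t) (x′ * t) y z
    finish (divides y′ refl) with coprime-fourth x′ y′ z (λ (p , q) → c (∣-trans p (m∣m*n t) , ∣-trans q (m∣m*n m′))) e″
      where
      m′≢0 : m′ ≢ 0
      m′≢0 refl = m≢0 refl
      e″ : x′ * y′ ≡ z ⁴
      e″ = *-cancelʳ-≡ _ _ m′ {{≢-nonZero m′≢0}} (trans (*-assoc x′ y′ m′) (trans e′ (*-comm m′ (z ⁴))))
    ... | u , s , refl , refl , us≡z = splitting t m′ u s (*-comm t m′) (*-comm (u ⁴) t) (*-comm (s ⁴) m′) us≡z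

-- Decidable congruence conditions on the factorisations.

module LocalTests where

  open FourthPowers
  open import Data.Nat using (ℕ; zero; suc; _+_; _*_; _%_; _/_; _≡ᵇ_; _<ᵇ_)
  open import Data.Nat.Properties
  open import Data.Bool using (Bool; not; _∧_; _∨_)
  open import Data.List using (List; []; _∷_; map; downFrom; deduplicate)
  open import Data.Bool.ListAction using (any; all)
  open import Data.Product using (_×_; _,_)

  -- Junk values: rem n 0 = n and quot n 0 = 0.
  rem quot : ℕ → ℕ → ℕ
  rem n zero = n
  rem n (suc q) = n % suc q
  quot n zero = 0
  quot n (suc q) = n / suc q

  cong-mod : ℕ → ℕ → ℕ → Bool
  cong-mod q x y = rem x q ≡ᵇ rem y q

  -- A modulus with its squares and its fourth powers, listed once and shared by all tests.
  Table : Set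
  Table = ℕ × List ℕ × List ℕ

  residues : ℕ → (ℕ → ℕ) → List ℕ
  residues q f = deduplicate _≟_ (map (λ x → rem (f x) q) (downFrom q))

  table : ℕ → Table
  table q = q , residues q (λ x → x * x) , residues q _⁴

  -- Necessary conditions modulo q on w = a² for a² + 1 = T′ u⁴ and a² = R s⁴ + 1.
  pellAt : ℕ → ℕ → Table → ℕ → Bool
  pellAt T′ R (q , _ , fs) w =
    any (λ p → cong-mod q (w + 1) (T′ * p)) fs ∧ any (λ s → cong-mod q w (R * s + 1)) fs

  pellTest : ℕ → ℕ → Table → Bool
  pellTest T′ R tab@(_ , sqs , _) = any (pellAt T′ R tab) sqs

  -- With w = u², the additional condition is a² + 1 = 2 u⁴.
  descentTest : ℕ → ℕ → Table → Bool
  descentTest T′ R tab@(q , sqs , _) =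
    any (λ w → pellAt T′ R tab w ∧ any (λ a → cong-mod q (a + 1) (2 * (w * w))) sqs) sqs

  -- For h = t′ x⁴ and h + 1 = r′ y⁴ with h² + (h + 1)² = t u⁴, where a = 2h + 1.
  consecutiveTest : ℕ → ℕ → ℕ → Table → Bool
  consecutiveTest t t′ r′ (q , _ , fs) =
    any (λ x → any (λ y → cong-mod q (t′ * x + 1) (r′ * y)) fs
             ∧ any (λ u → cong-mod q (t′ * x * (t′ * x) + (t′ * x + 1) * (t′ * x + 1)) (t * u)) fs) fs

  -- For a⁴ + 1 = m b⁴.
  minusTest : ℕ → Table → Bool
  minusTest m (q , _ , fs) = any (λ x → any (λ y → cong-mod q (x + 1) (m * y)) fs) fs

  obstructed : List Table → (Table → Bool) → Bool
  obstructed tabs test = any (λ tab → not (test tab)) tabs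

  -- By the junk value `rem m 0 = m`, the candidate `t = 0` passes vacuously when `m` is nonzero.
  forSplittings : ℕ → (ℕ → ℕ → Bool) → Bool
  forSplittings m P = all (λ t → not (rem m t ≡ᵇ 0) ∨ P t (quot m t)) (downFrom (suc m))

  listed : ℕ → ℕ → List (ℕ × ℕ) → Bool
  listed t r = any (λ (t′ , r′) → (t ≡ᵇ t′) ∧ (r ≡ᵇ r′))

  -- These are `(a² + 1, a² - 1)` for `a = 2, 4, 6` and `((a² + 1) / 2, (a² - 1) / 8)` for
  -- `a = 5, 11`: genuine solutions with `u = s = 1`, which no congruence can exclude.
  evenExceptions oddExceptions : List (ℕ × ℕ)
  evenExceptions = (5 , 3) ∷ (17 , 15) ∷ (37 , 35) ∷ []
  oddExceptions = (13 , 3) ∷ (61 , 15) ∷ []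

  minusExceptions : List ℕ
  minusExceptions = 2 ∷ 82 ∷ 146 ∷ 226 ∷ []

  -- The case `t = 1` is exempt. In the odd system and in the descent system it has the integral
  -- solution with all fourth powers equal to 1 except `s = 0`, whatever `r` is. In the even system
  -- it is excluded by size instead.
  evenOK oddOK descentOK : List Table → ℕ → ℕ → Bool
  evenOK tabs t r = (t ≡ᵇ 1) ∨ obstructed tabs (pellTest t r) ∨ listed t r evenExceptions
  oddOK tabs t r = (t ≡ᵇ 1) ∨ obstructed tabs (pellTest (2 * t) (8 * r)) ∨ listed t r oddExceptions
    ∨ forSplittings (2 * r) (λ t′ r′ → obstructed tabs (consecutiveTest t t′ r′))
  descentOK tabs t r = (t ≡ᵇ 1) ∨ obstructed tabs (descentTest (2 * t) (32 * r))

  -- The square divisors tested have roots `2, ..., 44`; `45² = 2025` exceeds the range of `m`.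
  admissible : ℕ → Bool
  admissible m = (1 <ᵇ m) ∧ ((rem m 4 ≡ᵇ 2) ∨ (rem m 4 ≡ᵇ 3)) ∧ (not (400 <ᵇ m) ∨ (rem m 2 ≡ᵇ 1))
    ∧ all (λ d → not (rem m (d * d) ≡ᵇ 0)) (map (2 +_) (downFrom 43))

  -- For even `m` the number `m b⁴ + 1` is odd, so an even `a` cannot occur; hence the disjunct in
  -- front of `evenOK`.
  controlled : List Table → ℕ → Bool
  controlled tabs m =
    forSplittings m (λ t r → ((rem m 2 ≡ᵇ 0) ∨ evenOK tabs t r) ∧ oddOK tabs t r ∧ descentOK tabs t r)
    ∧ (obstructed tabs (minusTest m) ∨ any (m ≡ᵇ_) minusExceptions)

  -- Fourth powers are sparse here: modulo 16 and modulo 5 only 0 and 1 occur, and for a prime that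
  -- is 1 modulo 4 they make up a quarter of the units.
  moduli : List ℕ
  moduli = 16 ∷ 9 ∷ 5 ∷ 13 ∷ 17 ∷ 7 ∷ 25 ∷ 29 ∷ 41 ∷ 11 ∷ 19 ∷ 23 ∷ 37 ∷ []

  allControlled : ℕ → List Table → Bool
  allControlled n tabs = all (λ m → not (admissible m) ∨ controlled tabs m) (downFrom n)

-- Solutions pass the congruence tests.

module LocalObstructions where

  open FourthPowers
  open LocalTests
  open import Data.Nat using (ℕ; zero; suc; _+_; _*_; _<_; s≤s; NonZero; _%_; ≢-nonZero; _≡ᵇ_; _<ᵇ_)
  open import Data.Nat.Properties
  open import Data.Nat.Divisibility using (divides; m%n≡0⇒n∣m; ∣⇒≤)
  open import Data.Nat.DivMod
  open import Data.Bool using (Bool; true; false; T; not; _∧_; _∨_)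
  open import Data.Bool.Properties using (T-∧; T-∨)
  open import Data.List using (List; []; _∷_; map; downFrom)
  open import Data.Bool.ListAction using (any; all)
  open import Data.List.Membership.Propositional using (_∈_; lose; find)
  open import Data.List.Membership.Propositional.Properties using (∈-map⁺; ∈-map⁻; ∈-downFrom⁺; ∈-deduplicate⁺)
  open import Data.List.Relation.Unary.All as All using (All; []; _∷_)
  open import Data.List.Relation.Unary.All.Properties using (all⁺; all⁻)
  open import Data.List.Relation.Unary.Any.Properties using (any⁺; any⁻; map⁻)
  open import Data.Product using (_×_; _,_)
  open import Data.Sum using (_⊎_; inj₁; inj₂)
  open import Data.Unit using (tt)
  open import Data.Empty using (⊥; ⊥-elim)
  open import Function.Bundles using (Equivalence)
  open import Relation.Binary.PropositionalEquality
  open import Relation.Nullary using (¬_; yes; no)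

  T-and : ∀ {x y} → T x → T y → T (x ∧ y)
  T-and p q = Equivalence.from T-∧ (p , q)

  T-split : ∀ {x y} → T (x ∧ y) → T x × T y
  T-split = Equivalence.to T-∧

  T-cases : ∀ {x y} → T (x ∨ y) → T x ⊎ T y
  T-cases = Equivalence.to T-∨

  T-contra : ∀ {x} → T x → T (not x) → ⊥
  T-contra {true} _ ()

  T-any : ∀ {A : Set} (p : A → Bool) {x xs} → x ∈ xs → T (p x) → T (any p xs)
  T-any p x∈xs px = any⁺ p (lose x∈xs px)

  T-all : ∀ {A : Set} (p : A → Bool) {x xs} → x ∈ xs → T (all p xs) → T (p x)
  T-all p {xs = xs} x∈xs h = All.lookup (all⁺ p xs h) x∈xs

  rem-rem : ∀ x q → rem (rem x q) q ≡ rem x q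
  rem-rem x zero = refl
  rem-rem x (suc q) = m%n%n≡m%n x (suc q)

  rem-+ : ∀ q {x x′ y y′} → rem x q ≡ rem x′ q → rem y q ≡ rem y′ q → rem (x + y) q ≡ rem (x′ + y′) q
  rem-+ zero refl refl = refl
  rem-+ (suc q) {x} {x′} {y} {y′} e f = trans (%-distribˡ-+ x y (suc q))
    (trans (cong₂ (λ u v → (u + v) % suc q) e f) (sym (%-distribˡ-+ x′ y′ (suc q))))

  rem-* : ∀ q {x x′ y y′} → rem x q ≡ rem x′ q → rem y q ≡ rem y′ q → rem (x * y) q ≡ rem (x′ * y′) q
  rem-* zero refl refl = refl
  rem-* (suc q) {x} {x′} {y} {y′} e f = trans (%-distribˡ-* x y (suc q))
    (trans (cong₂ (λ u v → (u * v) % suc q) e f) (sym (%-distribˡ-* x′ y′ (suc q))))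

  T-cong-mod : ∀ q {x x′ y y′} → rem x q ≡ rem x′ q → rem y q ≡ rem y′ q → x′ ≡ y′ → T (cong-mod q x y)
  T-cong-mod q e f refl = ≡⇒≡ᵇ _ _ (trans e (sym f))

  ∈-residues : ∀ q .{{_ : NonZero q}} (f : ℕ → ℕ) → (∀ x → rem (f (rem x q)) q ≡ rem (f x) q)
    → ∀ x → rem (f x) q ∈ residues q f
  ∈-residues q@(suc _) f f-resp x = ∈-deduplicate⁺ _≟_
    (subst (_∈ map (λ y → rem (f y) q) (downFrom q)) (f-resp x) (∈-map⁺ _ (∈-downFrom⁺ (m%n<n x q))))

  module _ (q : ℕ) .{{_ : NonZero q}} where

    private
      ^2-resp : ∀ x → rem (rem x q * rem x q) q ≡ rem (x * x) q
      ^2-resp x = rem-* q (rem-rem x q) (rem-rem x q)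

    square∈ : ∀ x → rem (x * x) q ∈ residues q (λ x → x * x)
    square∈ = ∈-residues q (λ x → x * x) ^2-resp

    fourth∈ : ∀ x → rem (x ⁴) q ∈ residues q _⁴
    fourth∈ = ∈-residues q _⁴ (λ x → rem-* q (^2-resp x) (^2-resp x))

    private
      ⟦_⟧ : ∀ x → rem (rem x q) q ≡ rem x q
      ⟦ x ⟧ = rem-rem x q

      const : ∀ x → rem x q ≡ rem x q
      const x = refl

    pellAt-complete : ∀ T′ R a u s → a * a + 1 ≡ T′ * u ⁴ → a * a ≡ R * s ⁴ + 1
      → T (pellAt T′ R (table q) (rem (a * a) q))
    pellAt-complete T′ R a u s e f = T-and
      (T-any _ (fourth∈ u) (T-cong-mod q (rem-+ q ⟦ a * a ⟧ (const 1)) (rem-* q (const T′) ⟦ u ⁴ ⟧) e))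
      (T-any _ (fourth∈ s) (T-cong-mod q ⟦ a * a ⟧ (rem-+ q (rem-* q (const R) ⟦ s ⁴ ⟧) (const 1)) f))

    pellTest-complete : ∀ T′ R a u s → a * a + 1 ≡ T′ * u ⁴ → a * a ≡ R * s ⁴ + 1
      → T (pellTest T′ R (table q))
    pellTest-complete T′ R a u s e f = T-any _ (square∈ a) (pellAt-complete T′ R a u s e f)

    descentTest-complete : ∀ T′ R w u s a → w * w + 1 ≡ T′ * u ⁴ → w * w ≡ R * s ⁴ + 1 → a * a + 1 ≡ 2 * w ⁴
      → T (descentTest T′ R (table q))
    descentTest-complete T′ R w u s a e f g = T-any _ (square∈ w) (T-and (pellAt-complete T′ R w u s e f)
      (T-any _ (square∈ a) (T-cong-mod q (rem-+ q ⟦ a * a ⟧ (const 1)) (rem-* q (const 2) (rem-* q ⟦ w * w ⟧ ⟦ w * w ⟧)) g)))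

    consecutiveTest-complete : ∀ t t′ r′ x y u → t′ * x ⁴ + 1 ≡ r′ * y ⁴
      → t′ * x ⁴ * (t′ * x ⁴) + (t′ * x ⁴ + 1) * (t′ * x ⁴ + 1) ≡ t * u ⁴
      → T (consecutiveTest t t′ r′ (table q))
    consecutiveTest-complete t t′ r′ x y u e f = T-any _ (fourth∈ x) (T-and
      (T-any _ (fourth∈ y) (T-cong-mod q tx+1 (rem-* q (const r′) ⟦ y ⁴ ⟧) e))
      (T-any _ (fourth∈ u) (T-cong-mod q (rem-+ q (rem-* q tx tx) (rem-* q tx+1 tx+1)) (rem-* q (const t) ⟦ u ⁴ ⟧) f)))
      where
      tx : rem (t′ * rem (x ⁴) q) q ≡ rem (t′ * x ⁴) q
      tx = rem-* q (const t′) ⟦ x ⁴ ⟧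
      tx+1 : rem (t′ * rem (x ⁴) q + 1) q ≡ rem (t′ * x ⁴ + 1) q
      tx+1 = rem-+ q tx (const 1)

    minusTest-complete : ∀ m a b → a ⁴ + 1 ≡ m * b ⁴ → T (minusTest m (table q))
    minusTest-complete m a b e = T-any _ (fourth∈ a) (T-any _ (fourth∈ b)
      (T-cong-mod q (rem-+ q ⟦ a ⁴ ⟧ (const 1)) (rem-* q (const m) ⟦ b ⁴ ⟧) e))

  abstract
    tables : List Table
    tables = map table moduli

    obstructed-sound : ∀ (test : Table → Bool) → (∀ q → .{{_ : NonZero q}} → T (test (table q))) → T (obstructed tables test) → ⊥
    obstructed-sound test solvable h with find (map⁻ {f = table} {xs = moduli} (any⁻ (λ tab → not (test tab)) tables h))
    ... | q , q∈ , bad = T-contra (solvable q {{All.lookup nonZero q∈}}) bad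
      where
      nonZero : All NonZero moduli
      nonZero = _ ∷ _ ∷ _ ∷ _ ∷ _ ∷ _ ∷ _ ∷ _ ∷ _ ∷ _ ∷ _ ∷ _ ∷ _ ∷ []

    -- The whole finite check, over all `m` below 2000 and all factorisations of `m`, is this one
    -- evaluation.
    allControlled-tables : T (allControlled 2000 tables)
    allControlled-tables = tt

  forSplittings-sound : ∀ {m} P → m ≢ 0 → T (forSplittings m P) → ∀ t r → t * r ≡ m → T (P t r)
  forSplittings-sound P m≢0 h zero r refl = ⊥-elim (m≢0 refl)
  forSplittings-sound {m} P m≢0 h t@(suc _) r refl with T-cases (T-all _ {t} (∈-downFrom⁺ (s≤s (∣⇒≤ {{≢-nonZero m≢0}} (divides r (*-comm t r))))) h)
  ... | inj₁ h′ = ⊥-elim (T-contra (≡⇒≡ᵇ (rem m t) 0 (trans (cong (λ n → n % t) (*-comm t r)) (m*n%n≡0 r t))) h′)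
  ... | inj₂ h′ = subst (λ n → T (P t n)) (trans (cong (_/ t) (*-comm t r)) (m*n/n≡m r t)) h′

  listed-sound : ∀ {t r} xs → T (listed t r xs) → (t , r) ∈ xs
  listed-sound {t} {r} xs h with find (any⁻ _ xs h)
  ... | (t′ , r′) , x∈ , p with T-split p
  ... | p₁ , p₂ with ≡ᵇ⇒≡ t t′ p₁ | ≡ᵇ⇒≡ r r′ p₂
  ... | refl | refl = x∈

  T-not : ∀ {x} → ¬ T x → T (not x)
  T-not {false} _ = tt
  T-not {true} ¬x = ¬x tt

  admissible-complete : ∀ {m} → 1 < m → SquareFree m → (m % 4 ≡ 2 ⊎ m % 4 ≡ 3) → (400 < m → m % 2 ≡ 1) → T (admissible m)
  admissible-complete {m} 1<m sqf m%4 odd =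
    T-and (<⇒<ᵇ 1<m) (T-and (mod4 m%4) (T-and mod2 (all⁻ _ (All.tabulate noSquare))))
    where
    mod4 : m % 4 ≡ 2 ⊎ m % 4 ≡ 3 → T ((rem m 4 ≡ᵇ 2) ∨ (rem m 4 ≡ᵇ 3))
    mod4 (inj₁ e) = Equivalence.from T-∨ (inj₁ (≡⇒≡ᵇ _ _ e))
    mod4 (inj₂ e) = Equivalence.from T-∨ (inj₂ (≡⇒≡ᵇ _ _ e))
    mod2 : T (not (400 <ᵇ m) ∨ (rem m 2 ≡ᵇ 1))
    mod2 with 400 <? m
    ... | yes 400<m = Equivalence.from T-∨ (inj₂ (≡⇒≡ᵇ _ _ (odd 400<m)))
    ... | no 400≮m = Equivalence.from T-∨ (inj₁ (T-not (λ h → 400≮m (<ᵇ⇒< 400 m h))))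
    noSquare : ∀ {d} → d ∈ map (2 +_) (downFrom 43) → T (not (rem m (d * d) ≡ᵇ 0))
    noSquare d∈ with ∈-map⁻ (2 +_) d∈
    ... | d , _ , refl = T-not λ h → 1+n≢0 (suc-injective (sqf (2 + d) (m%n≡0⇒n∣m m _ (≡ᵇ⇒≡ _ 0 h))))

  controlled-below : ∀ n tabs {m} → T (allControlled n tabs) → m < n → T (admissible m) → T (controlled tabs m)
  controlled-below n tabs {m} h m<n adm = decide (T-cases {not (admissible m)} (T-all _ (∈-downFrom⁺ m<n) h))
    where
    decide : T (not (admissible m)) ⊎ T (controlled tabs m) → T (controlled tabs m)
    decide (inj₁ bad) = ⊥-elim (T-contra adm bad)
    decide (inj₂ good) = good

-- Factorisations of `a⁴ - 1` according to the parity of `a`.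

module Splittings where

  open FourthPowers
  open import Data.Nat using (ℕ; zero; suc; _+_; _*_; _<_; z≤n; s≤s; NonZero)
  open import Data.Nat.Properties
  open import Data.Nat.Divisibility
  open import Data.Nat.Coprimality using (Coprime) renaming (sym to coprime-sym)
  open import Data.Nat.Tactic.RingSolver using (solve-∀)
  open import Data.Product using (∃; ∃₂; _×_; _,_)
  open import Data.Sum using (_⊎_; inj₁; inj₂)
  open import Data.Empty using (⊥-elim)
  open import Relation.Binary.PropositionalEquality
  open import Relation.Nullary using (¬_; yes; no)

  parity : ∀ n → (∃ λ h → n ≡ 2 * h) ⊎ (∃ λ h → n ≡ 2 * h + 1)
  parity zero = inj₁ (0 , refl)
  parity (suc n) with parity n
  ... | inj₁ (h , refl) = inj₂ (h , +-comm 1 (2 * h))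
  ... | inj₂ (h , refl) = inj₁ (suc h , double h)
    where
    double : ∀ h → suc (2 * h + 1) ≡ 2 * suc h
    double = solve-∀

  even≢odd′ : ∀ m n → 2 * m ≢ 2 * n + 1
  even≢odd′ m n e = even≢odd m n (trans e (+-comm (2 * n) 1))

  pronic-even : ∀ h → ∃ λ g → h * (h + 1) ≡ 2 * g
  pronic-even h with parity h
  ... | inj₁ (k , refl) = k * (2 * k + 1) , *-assoc 2 k (2 * k + 1)
  ... | inj₂ (k , refl) = (2 * k + 1) * (k + 1) , factor k
    where
    factor : ∀ k → (2 * k + 1) * (2 * k + 1 + 1) ≡ 2 * ((2 * k + 1) * (k + 1))
    factor = solve-∀

  -- The fourth power of an odd number is 1 modulo 4, so for odd `x` the factor 4 would have to
  -- divide `m`.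
  4∣m*x⁴⇒even : ∀ {m} x → ¬ 4 ∣ m → 4 ∣ m * x ⁴ → ∃ λ h → x ≡ 2 * h
  4∣m*x⁴⇒even {m} x 4∤m d with parity x
  ... | inj₁ even = even
  ... | inj₂ (h , refl) = ⊥-elim (4∤m (∣m+n∣m⇒∣n (subst (4 ∣_) (expand m h) d) (m∣m*n {4} (m * quarter h))))
    where
    quarter : ℕ → ℕ
    quarter h = 2 * (2 * h * h * h * h + 4 * h * h * h + 3 * h * h + h)
    expand : ∀ m h → m * ((2 * h + 1) * (2 * h + 1) * ((2 * h + 1) * (2 * h + 1)))
      ≡ 4 * (m * (2 * (2 * h * h * h * h + 4 * h * h * h + 3 * h * h + h))) + m
    expand = solve-∀

  between-squares : ∀ {k n} → k * k < n → n < suc k * suc k → ∀ u → u * u ≢ n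
  between-squares {k} lo hi u refl with u ≤? k
  ... | yes u≤k = <⇒≱ lo (*-mono-≤ u≤k u≤k)
  ... | no u≰k = <⇒≱ hi (*-mono-≤ (≰⇒> u≰k) (≰⇒> u≰k))

  coprime-multiple+1 : ∀ c g → Coprime (c * g + 1) g
  coprime-multiple+1 c g (d∣cg+1 , d∣g) = ∣1⇒≡1 (∣m+n∣m⇒∣n d∣cg+1 (∣n⇒∣m*n c d∣g))

  -- With `t r = m`, even `a` leads to `(T′, R) = (t, r)` and odd `a` to `(2t, 8r)`.
  record PellPair (T′ R a : ℕ) : Set where
    constructor pellPair
    field
      u s : ℕ
      a²+1≡Tu⁴ : a * a + 1 ≡ T′ * u ⁴
      a²≡Rs⁴+1 : a * a ≡ R * s ⁴ + 1

  cancel : ∀ k x y .{{_ : NonZero k}} → k * x ≡ k * y → x ≡ y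
  cancel k x y = *-cancelˡ-≡ x y k

  -- The factors `a² + 1` and `a² - 1` differ by 2 and are odd, so they are coprime. If `t` were 1,
  -- then `a² + 1` would be the square of `u²`, lying strictly between `a²` and `(a + 1)²`.
  even-splitting : ∀ m a j b → m ≢ 0 → a * a ≡ 2 * j + 1 + 1 → a ⁴ ≡ m * b ⁴ + 1
    → ∃₂ λ t r → t * r ≡ m × t ≢ 1 × PellPair t r a
  even-splitting m a j b m≢0 a²≡ e = conclude (coprime-splitting m (k + 2) k b m≢0 cop prod)
    where
    k : ℕ
    k = 2 * j + 1
    square : ∀ k → (k + 2) * k + 1 ≡ (k + 1) * (k + 1)
    square = solve-∀
    prod : (k + 2) * k ≡ m * b ⁴
    prod = +-cancelʳ-≡ 1 _ _ (trans (square k) (trans (sym (cong₂ _*_ a²≡ a²≡)) e))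
    cop : Coprime (k + 2) k
    cop (p , q) = ∣1⇒≡1 (∣m+n∣m⇒∣n q (∣m⇒∣m*n j (∣m+n∣m⇒∣n p q)))
    conclude : Splitting m (k + 2) k b → ∃₂ λ t r → t * r ≡ m × t ≢ 1 × PellPair t r a
    conclude (splitting t r u s tr≡m x y us) = t , r , tr≡m , t≢1 , pellPair u s a²+1 (trans a²≡ (cong (_+ 1) y))
      where
      a²+1 : a * a + 1 ≡ t * u ⁴
      a²+1 = trans (trans (cong (_+ 1) a²≡) (+-assoc k 1 1)) x
      gap : ∀ n → n * n ≢ 0 → n * n + 1 < suc n * suc n
      gap zero n≢0 = ⊥-elim (n≢0 refl)
      gap (suc n) _ = subst (suc n * suc n + 1 <_) (eq n) (m<m+n _ (s≤s z≤n))
        where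
        eq : ∀ n → suc n * suc n + 1 + suc (suc (2 * n)) ≡ suc (suc n) * suc (suc n)
        eq = solve-∀
      t≢1 : t ≢ 1
      t≢1 refl = between-squares {a} (m<m+n _ (s≤s z≤n)) (gap a λ a²≡0 → 1+n≢0 (trans (+-comm 1 k) (trans (sym a²≡) a²≡0)))
                   (u * u) (sym (trans a²+1 (*-identityˡ (u ⁴))))

  -- Here `g` is the triangular number `h (h + 1) / 2`; the product `h (h + 1)` is kept because it
  -- is factored again later.
  odd-square : ∀ h → ∃ λ g → (2 * h + 1) * (2 * h + 1) ≡ 8 * g + 1 × h * (h + 1) ≡ 2 * g
  odd-square h with pronic-even h
  ... | g , e = g , trans (expand h) (trans (cong (λ n → 4 * n + 1) e) (collect g)) , e
    where
    expand : ∀ h → (2 * h + 1) * (2 * h + 1) ≡ 4 * (h * (h + 1)) + 1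
    expand = solve-∀
    collect : ∀ g → 4 * (2 * g) + 1 ≡ 8 * g + 1
    collect = solve-∀

  8g+1-squared : ∀ g → (8 * g + 1) * (8 * g + 1) ≡ 16 * ((4 * g + 1) * g) + 1
  8g+1-squared = solve-∀

  double⁴ : ∀ m c → m * (2 * c * (2 * c) * (2 * c * (2 * c))) ≡ 16 * (m * (c * c * (c * c)))
  double⁴ = solve-∀

  -- With `a = 2h + 1`, the quotient `(a² - 1) / 4` is `h (h + 1)`, a product of coprime numbers,
  -- and `(a² + 1) / 2` is `h² + (h + 1)²`. The last two fields record this for the finer congruence
  -- test.
  record OddSplitting (m a b : ℕ) : Set where
    constructor oddSplitting
    field
      h t r u s : ℕ
      tr≡m : t * r ≡ m
      b≡2us : b ≡ 2 * (u * s)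
      a²+1 : a * a + 1 ≡ 2 * t * u ⁴
      a² : a * a ≡ 8 * r * s ⁴ + 1
      pronic : h * (h + 1) ≡ 2 * r * s ⁴
      sum² : h * h + (h + 1) * (h + 1) ≡ t * u ⁴

  -- For `a² = 8g + 1` the equation reads `16 (4g + 1) g = m b⁴`. Since 4 does not divide `m`,
  -- `b = 2c`; what remains is `(4g + 1) g = m c⁴` with coprime factors.
  odd-splitting : ∀ m h b → m ≢ 0 → ¬ 4 ∣ m → (2 * h + 1) ⁴ ≡ m * b ⁴ + 1 → OddSplitting m (2 * h + 1) b
  odd-splitting m h b m≢0 4∤m e with odd-square h
  ... | g , sq , pr = halve (4∣m*x⁴⇒even b 4∤m (subst (4 ∣_) 16g (∣m⇒∣m*n ((4 * g + 1) * g) (divides {4} {16} 4 refl))))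
    where
    16g : 16 * ((4 * g + 1) * g) ≡ m * b ⁴
    16g = +-cancelʳ-≡ 1 (16 * ((4 * g + 1) * g)) (m * b ⁴) (trans (sym (8g+1-squared g)) (trans (sym (cong₂ _*_ sq sq)) e))
    conclude : ∀ c → b ≡ 2 * c → Splitting m (4 * g + 1) g c → OddSplitting m (2 * h + 1) b
    conclude c b≡2c (splitting t r u s tr≡m x y us≡c) = oddSplitting h t r u s tr≡m (trans b≡2c (cong (2 *_) (sym us≡c)))
      (trans (cong (_+ 1) sq) (trans (eq₁ g) (trans (cong (2 *_) x) (sym (*-assoc 2 t (u ⁴))))))
      (trans sq (cong (_+ 1) (trans (cong (8 *_) y) (sym (*-assoc 8 r (s ⁴))))))
      (trans pr (trans (cong (2 *_) y) (sym (*-assoc 2 r (s ⁴)))))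
      (trans (eq₂ h) (trans (cong (λ n → 2 * n + 1) pr) (trans (eq₃ g) x)))
      where
      eq₁ : ∀ g → 8 * g + 1 + 1 ≡ 2 * (4 * g + 1)
      eq₁ = solve-∀
      eq₂ : ∀ h → h * h + (h + 1) * (h + 1) ≡ 2 * (h * (h + 1)) + 1
      eq₂ = solve-∀
      eq₃ : ∀ g → 2 * (2 * g) + 1 ≡ 4 * g + 1
      eq₃ = solve-∀
    halve : (∃ λ c → b ≡ 2 * c) → OddSplitting m (2 * h + 1) b
    halve (c , b≡2c) = conclude c b≡2c (coprime-splitting m (4 * g + 1) g c m≢0 (coprime-multiple+1 4 g)
      (cancel 16 _ _ (trans 16g (trans (cong (λ x → m * x ⁴) b≡2c) (double⁴ m c)))))

-- Descent, and reduction to the exceptional factorisations.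

module Reduction where

  open FourthPowers
  open LocalTests
  open LocalObstructions
  open Splittings
  open import Data.Nat using (ℕ; zero; suc; _+_; _*_; _<_; z≤n; s≤s; _%_; _≡ᵇ_)
  open import Data.Nat.Properties
  open import Data.Nat.Divisibility
  open import Data.Nat.Coprimality using (Coprime; coprime-divisor) renaming (sym to coprime-sym)
  open import Data.Nat.Tactic.RingSolver using (solve-∀)
  open import Data.Bool using (T; _∧_; _∨_)
  open import Data.List.Membership.Propositional using (_∈_; find)
  open import Data.List.Relation.Unary.Any.Properties using (any⁻)
  open import Data.Product using (∃; ∃₂; _×_; _,_; proj₁; proj₂)
  open import Data.Sum using (_⊎_; inj₁; inj₂)
  open import Data.Empty using (⊥; ⊥-elim)
  open import Relation.Binary.PropositionalEquality
  open import Relation.Nullary using (¬_; Dec; yes; no)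

  -- The case t = 1 of an odd splitting: a² + 1 = 2 u⁴ and a² = 8 m s⁴ + 1. If t = 1 here as well,
  -- then (p , 2q) is a smaller solution of the equation satisfied by (a , b).
  record Descent (m u s : ℕ) : Set where
    constructor descent
    field
      t r p q : ℕ
      tr≡m : t * r ≡ m
      s≡2pq : s ≡ 2 * (p * q)
      u²+1 : u * u + 1 ≡ 2 * t * p ⁴
      u² : u * u ≡ 32 * r * q ⁴ + 1
      next : t * p ⁴ ≡ 16 * (r * q ⁴) + 1

  -- `u` is odd, so `u² = 8w + 1` and `4 (4w + 1) w = m s⁴`. Hence `s = 2c` and
  -- `(4w + 1) w = 4 m c⁴`; as `4w + 1` is coprime to 4, `w = 4w′`. This leaves
  -- `(16w′ + 1) w′ = m c⁴`, again with coprime factors.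
  descent-step : ∀ m u s → m ≢ 0 → ¬ 4 ∣ m → u ⁴ ≡ 4 * (m * s ⁴) + 1 → Descent m u s
  descent-step m u s m≢0 4∤m e with parity u
  ... | inj₁ (v , refl) = ⊥-elim (even≢odd′ (v * (2 * v) * (2 * v * (2 * v))) (2 * (m * s ⁴)) (trans (even v) (trans e (cong (_+ 1) (*-assoc 2 2 (m * s ⁴))))))
    where
    even : ∀ v → 2 * (v * (2 * v) * (2 * v * (2 * v))) ≡ 2 * v * (2 * v) * (2 * v * (2 * v))
    even = solve-∀
  ... | inj₂ (v , refl) with odd-square v
  ... | w , sq , _ = halve (4∣m*x⁴⇒even s 4∤m (subst (4 ∣_) 4w (m∣m*n {4} ((4 * w + 1) * w))))
    where
    4w : 4 * ((4 * w + 1) * w) ≡ m * s ⁴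
    4w = cancel 4 (4 * ((4 * w + 1) * w)) (m * s ⁴) (+-cancelʳ-≡ 1 (4 * (4 * ((4 * w + 1) * w))) (4 * (m * s ⁴))
      (trans (cong (_+ 1) (sym (*-assoc 4 4 ((4 * w + 1) * w)))) (trans (sym (8g+1-squared w)) (trans (sym (cong₂ _*_ sq sq)) e))))
    conclude : ∀ w′ c → w ≡ w′ * 4 → s ≡ 2 * c → Splitting m (16 * w′ + 1) w′ c → Descent m (2 * v + 1) s
    conclude w′ c w≡ s≡ (splitting t r p q tr≡m x y pq≡c) = descent t r p q tr≡m (trans s≡ (cong (2 *_) (sym pq≡c)))
      (trans (cong (_+ 1) u²≡) (trans (eq₁ w′) (trans (cong (2 *_) x) (sym (*-assoc 2 t (p ⁴))))))
      (trans u²≡ (cong (_+ 1) (trans (cong (32 *_) y) (sym (*-assoc 32 r (q ⁴))))))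
      (trans (sym x) (cong (λ n → 16 * n + 1) y))
      where
      eq₀ : ∀ w → 8 * (w * 4) + 1 ≡ 32 * w + 1
      eq₀ = solve-∀
      eq₁ : ∀ w → 32 * w + 1 + 1 ≡ 2 * (16 * w + 1)
      eq₁ = solve-∀
      u²≡ : (2 * v + 1) * (2 * v + 1) ≡ 32 * w′ + 1
      u²≡ = trans sq (trans (cong (λ n → 8 * n + 1) w≡) (eq₀ w′))
    halve : (∃ λ c → s ≡ 2 * c) → Descent m (2 * v + 1) s
    halve (c , s≡) = quarter (coprime-divisor (coprime-sym (coprime-multiple+1′ w)) (subst (4 ∣_) (sym 4c) (m∣m*n {4} (m * c ⁴))))
      where
      4c : (4 * w + 1) * w ≡ 4 * (m * c ⁴)
      4c = cancel 4 _ _ (trans 4w (trans (cong (λ x → m * x ⁴) s≡) (trans (double⁴ m c) (*-assoc 4 4 (m * c ⁴)))))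
      coprime-multiple+1′ : ∀ w → Coprime (4 * w + 1) 4
      coprime-multiple+1′ w = subst (λ n → Coprime (n + 1) 4) (*-comm w 4) (coprime-multiple+1 w 4)
      quarter : 4 ∣ w → Descent m (2 * v + 1) s
      quarter (divides w′ w≡) = conclude w′ c w≡ s≡ (coprime-splitting m (16 * w′ + 1) w′ c m≢0 (coprime-multiple+1 16 w′)
        (cancel 4 _ _ (trans (eq w′) (trans (cong (λ n → (4 * n + 1) * n) (sym w≡)) 4c))))
        where
        eq : ∀ w → 4 * ((16 * w + 1) * w) ≡ (4 * (w * 4) + 1) * (w * 4)
        eq = solve-∀

  -- `smaller` remembers `u² + 1 = 2p⁴`: a listed solution found for `(p , 2q)` is refuted by this
  -- relation.
  data Outcome (m a b : ℕ) : Set where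
    trivial : b ≡ 0 → Outcome m a b
    exceptional-even : ∀ t r → (t , r) ∈ evenExceptions → t * r ≡ m → PellPair t r a → Outcome m a b
    exceptional-odd : ∀ t r → (t , r) ∈ oddExceptions → t * r ≡ m → PellPair (2 * t) (8 * r) a → Outcome m a b
    smaller : ∀ p q u → q ≢ 0 → p ⁴ ≡ m * (2 * q) ⁴ + 1 → u * u + 1 ≡ 2 * p ⁴ → 2 * q < b → Outcome m a b

  evenOK-sound : ∀ {t r} a → t ≢ 1 → T (evenOK tables t r) → PellPair t r a → (t , r) ∈ evenExceptions
  evenOK-sound {t} {r} a t≢1 ok (pellPair u s e f) with T-cases {t ≡ᵇ 1} ok
  ... | inj₁ t≡1 = ⊥-elim (t≢1 (≡ᵇ⇒≡ t 1 t≡1))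
  ... | inj₂ ok′ with T-cases {obstructed tables (pellTest t r)} ok′
  ...   | inj₁ bad = ⊥-elim (obstructed-sound (pellTest t r) (λ q → pellTest-complete q t r a u s e f) bad)
  ...   | inj₂ l = listed-sound evenExceptions l

  -- Where the congruences for `a²` leave a pair open, `h (h + 1) = 2 r s⁴` is split once more as
  -- `h = t′ x⁴`, `h + 1 = r′ y⁴` with `t′ r′ = 2r`, and each of these finer systems is obstructed.
  oddOK-sound : ∀ {m} a b (σ : OddSplitting m a b) → let t = OddSplitting.t σ ; r = OddSplitting.r σ in
    r ≢ 0 → T (oddOK tables t r) → t ≡ 1 ⊎ (t , r) ∈ oddExceptions
  oddOK-sound a b (oddSplitting h t r u s tr≡m b≡2us e f g k) r≢0 ok with T-cases {t ≡ᵇ 1} ok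
  ... | inj₁ t≡1 = inj₁ (≡ᵇ⇒≡ t 1 t≡1)
  ... | inj₂ ok′ with T-cases {obstructed tables (pellTest (2 * t) (8 * r))} ok′
  ...   | inj₁ bad = ⊥-elim (obstructed-sound (pellTest (2 * t) (8 * r)) (λ q → pellTest-complete q (2 * t) (8 * r) a u s e f) bad)
  ...   | inj₂ ok″ with T-cases {listed t r oddExceptions} ok″
  ...     | inj₁ l = inj₂ (listed-sound oddExceptions l)
  ...     | inj₂ ok‴ = ⊥-elim (finer (coprime-splitting (2 * r) h (h + 1) s 2r≢0 cop g))
    where
    2r≢0 : 2 * r ≢ 0
    2r≢0 2r≡0 = r≢0 (m+n≡0⇒m≡0 r 2r≡0)
    cop : Coprime h (h + 1)
    cop (p , q) = ∣1⇒≡1 (∣m+n∣m⇒∣n q p)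
    finer : Splitting (2 * r) h (h + 1) s → ⊥
    finer (splitting t′ r′ x y t′r′ refl h+1≡ _) = obstructed-sound (consecutiveTest t t′ r′)
      (λ q → consecutiveTest-complete q t t′ r′ x y u h+1≡ k)
      (forSplittings-sound (λ t′ r′ → obstructed tables (consecutiveTest t t′ r′)) 2r≢0 ok‴ t′ r′ t′r′)

  descentOK-sound : ∀ {m u s} a (δ : Descent m u s) → a * a + 1 ≡ 2 * u ⁴ →
    T (descentOK tables (Descent.t δ) (Descent.r δ)) → Descent.t δ ≡ 1
  descentOK-sound {u = u} a (descent t r p q tr≡m s≡2pq e f _) g ok with T-cases {t ≡ᵇ 1} ok
  ... | inj₁ t≡1 = ≡ᵇ⇒≡ t 1 t≡1
  ... | inj₂ bad = ⊥-elim (obstructed-sound (descentTest (2 * t) (32 * r)) (λ n → descentTest-complete n (2 * t) (32 * r) u p q a e f g) bad)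

  module _ (m : ℕ) (m≢0 : m ≢ 0) (4∤m : ¬ 4 ∣ m) (ctrl : T (controlled tables m)) where

    private
      splittings : ∀ t r → t * r ≡ m → T (((rem m 2 ≡ᵇ 0) ∨ evenOK tables t r) ∧ oddOK tables t r ∧ descentOK tables t r)
      splittings = forSplittings-sound _ m≢0 (proj₁ (T-split ctrl))

    -- With `t = 1` the last equation of the descent step is `p⁴ = m (2q)⁴ + 1`, and
    -- `b = 2us = 2q · 2up` with `b` nonzero gives `2q < b`.
    descend : ∀ a b u s → b ≡ 2 * (u * s) → b ≢ 0 → a * a + 1 ≡ 2 * u ⁴ → Descent m u s → Outcome m a b
    descend a b u s b≡2us b≢0 a²+1 δ@(descent t r p q tr≡m s≡2pq e f g)
      with descentOK-sound a δ a²+1 (proj₂ (T-split {oddOK tables t r} (proj₂ (T-split {(rem m 2 ≡ᵇ 0) ∨ evenOK tables t r} (splittings t r tr≡m)))))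
    ... | refl = smaller p q u q≢0 p⁴ (trans e (cong (_* p ⁴) (*-identityʳ 2))) (2q<b p q u b≡ b≢0)
      where
      r≡m : r ≡ m
      r≡m = trans (sym (*-identityˡ r)) tr≡m
      p⁴ : p ⁴ ≡ m * (2 * q) ⁴ + 1
      p⁴ = trans (sym (*-identityˡ (p ⁴))) (trans g (cong (_+ 1) (trans (cong (λ n → 16 * (n * q ⁴)) r≡m) (sym (double⁴ m q)))))
      b≡ : b ≡ 2 * q * (2 * (u * p))
      b≡ = trans b≡2us (trans (cong (λ n → 2 * (u * n)) s≡2pq) (regroup u p q))
        where
        regroup : ∀ u p q → 2 * (u * (2 * (p * q))) ≡ 2 * q * (2 * (u * p))
        regroup = solve-∀
      q≢0 : q ≢ 0
      q≢0 refl = b≢0 b≡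
      2q<b : ∀ p q u → b ≡ 2 * q * (2 * (u * p)) → b ≢ 0 → 2 * q < b
      2q<b p q u eq b≢0 with u * p
      ... | zero = ⊥-elim (b≢0 (trans eq (*-zeroʳ (2 * q))))
      2q<b p zero u eq b≢0 | suc n = ⊥-elim (b≢0 eq)
      2q<b p q@(suc _) u eq b≢0 | suc n = subst (2 * q <_) (sym eq) (m<m*n (2 * q) (2 * suc n) (*-monoʳ-≤ 2 (s≤s z≤n)))

    reduce-even : ∀ a b g → a ≡ 2 * suc g → a ⁴ ≡ m * b ⁴ + 1 → Outcome m a b
    reduce-even a b g a≡ e = conclude (even-splitting m a (2 * g * g + 4 * g + 1) b m≢0 (trans (cong₂ _*_ a≡ a≡) (k+1 g)) e)
      where
      k+1 : ∀ g → 2 * suc g * (2 * suc g) ≡ 2 * (2 * g * g + 4 * g + 1) + 1 + 1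
      k+1 = solve-∀
      m-odd : ¬ 2 ∣ m
      m-odd 2∣m = 1+n≢0 (suc-injective (∣1⇒≡1 (∣m+n∣m⇒∣n (subst (2 ∣_) e (∣m⇒∣m*n (a * a) (∣m⇒∣m*n a 2∣a))) (∣m⇒∣m*n (b ⁴) 2∣m))))
        where
        2∣a : 2 ∣ a
        2∣a = divides (suc g) (trans a≡ (*-comm 2 (suc g)))
      conclude : (∃₂ λ t r → t * r ≡ m × t ≢ 1 × PellPair t r a) → Outcome m a b
      conclude (t , r , tr≡m , t≢1 , pair) with T-cases {rem m 2 ≡ᵇ 0} (proj₁ (T-split (splittings t r tr≡m)))
      ... | inj₂ ok = exceptional-even t r (evenOK-sound a t≢1 ok pair) tr≡m pair
      ... | inj₁ even = ⊥-elim (m-odd (m%n≡0⇒n∣m m 2 (≡ᵇ⇒≡ (m % 2) 0 even)))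

    reduce-odd : ∀ a b → b ≢ 0 → OddSplitting m a b → Outcome m a b
    reduce-odd a b b≢0 σ@(oddSplitting h t r u s tr≡m b≡2us e f g k)
      with oddOK-sound a b σ (λ { refl → m≢0 (trans (sym tr≡m) (*-zeroʳ t)) })
             (proj₁ (T-split {oddOK tables t r} (proj₂ (T-split {(rem m 2 ≡ᵇ 0) ∨ evenOK tables t r} (splittings t r tr≡m)))))
    ... | inj₂ exc = exceptional-odd t r exc tr≡m (pellPair u s e f)
    ... | inj₁ t≡1 = descend a b u s b≡2us b≢0 a²+1≡2u⁴ (descent-step m u s m≢0 4∤m u⁴)
      where
      r≡m : r ≡ m
      r≡m = trans (sym (*-identityˡ r)) (trans (cong (_* r) (sym t≡1)) tr≡m)
      a²+1≡2u⁴ : a * a + 1 ≡ 2 * u ⁴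
      a²+1≡2u⁴ = trans e (trans (cong (λ n → 2 * n * u ⁴) t≡1) (cong (_* u ⁴) (*-identityʳ 2)))
      double : ∀ m x → 8 * m * x + 1 + 1 ≡ 2 * (4 * (m * x) + 1)
      double = solve-∀
      -- Adding 1 to `a² = 8 m s⁴ + 1` and comparing with `a² + 1 = 2u⁴`.
      u⁴ : u ⁴ ≡ 4 * (m * s ⁴) + 1
      u⁴ = cancel 2 _ _ (trans (sym a²+1≡2u⁴) (trans (cong (_+ 1) f) (trans (cong (λ n → 8 * n * s ⁴ + 1 + 1) r≡m) (double m (s ⁴)))))

    reduce : ∀ a b → a ⁴ ≡ m * b ⁴ + 1 → Outcome m a b
    reduce a b e = cases (b ≟ 0) (parity a)
      where
      cases : Dec (b ≡ 0) → (∃ λ h → a ≡ 2 * h) ⊎ (∃ λ h → a ≡ 2 * h + 1) → Outcome m a b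
      cases (yes b≡0) _ = trivial b≡0
      cases (no b≢0) (inj₁ (suc g , a≡)) = reduce-even a b g a≡ e
      cases (no b≢0) (inj₁ (zero , a≡0)) = ⊥-elim (1+n≢0 (trans (+-comm 1 (m * b ⁴)) (trans (sym e) (cong _⁴ a≡0))))
      cases (no b≢0) (inj₂ (h , a≡)) = subst (λ n → Outcome m n b) (sym a≡)
        (reduce-odd (2 * h + 1) b b≢0 (odd-splitting m h b m≢0 4∤m (subst (λ n → n ⁴ ≡ m * b ⁴ + 1) a≡ e)))

    minus-cases : ∀ a b → a ⁴ + 1 ≡ m * b ⁴ → m ∈ minusExceptions
    minus-cases a b e with T-cases {obstructed tables (minusTest m)} (proj₂ (T-split ctrl))
    ... | inj₁ bad = ⊥-elim (obstructed-sound (minusTest m) (λ q → minusTest-complete q m a b e) bad)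
    ... | inj₂ l with find (any⁻ (m ≡ᵇ_) minusExceptions l)
    ...   | x , x∈ , m≡x with ≡ᵇ⇒≡ m x m≡x
    ...     | refl = x∈

-- The commutative ring `ℤ[α]`.

module QuarticRing where

  open import Algebra.Bundles using (CommutativeRing)
  open import Algebra.Structures using (IsCommutativeRing)
  open import Data.Integer using (ℤ; +_; -_; _+_; _*_; 0ℤ; 1ℤ)
  open import Data.Integer.Properties using (+-comm; +-assoc; +-identityˡ; +-identityʳ; +-inverseˡ; +-inverseʳ)
  open import Data.Integer.Tactic.RingSolver using (solve-∀)
  open import Data.Product using (_,_)
  open import Level using (0ℓ)
  open import Relation.Binary.PropositionalEquality

  ⟨⟩-cong : ∀ {a0 a1 a2 a3 b0 b1 b2 b3} → a0 ≡ b0 → a1 ≡ b1 → a2 ≡ b2 → a3 ≡ b3 → ⟨ a0 , a1 , a2 , a3 ⟩ ≡ ⟨ b0 , b1 , b2 , b3 ⟩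
  ⟨⟩-cong refl refl refl refl = refl

  negE : Elt → Elt
  negE ⟨ a0 , a1 , a2 , a3 ⟩ = ⟨ - a0 , - a1 , - a2 , - a3 ⟩

  module _ (M : ℤ) where

    -- `mulE m` agrees with `mul (+ m)` by unfolding. With an integer variable `M` the ring laws
    -- become polynomial identities in the coordinates.
    mul : Elt → Elt → Elt
    mul ⟨ a0 , a1 , a2 , a3 ⟩ ⟨ b0 , b1 , b2 , b3 ⟩ =
      ⟨ a0 * b0 + M * (a1 * b3 + a2 * b2 + a3 * b1)
      , a0 * b1 + a1 * b0 + M * (a2 * b3 + a3 * b2)
      , a0 * b2 + a1 * b1 + a2 * b0 + M * (a3 * b3)
      , a0 * b3 + a1 * b2 + a2 * b1 + a3 * b0 ⟩

    mul-comm : ∀ x y → mul x y ≡ mul y x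
    mul-comm ⟨ a0 , a1 , a2 , a3 ⟩ ⟨ b0 , b1 , b2 , b3 ⟩ = ⟨⟩-cong 
      (e0 M a0 a1 a2 a3 b0 b1 b2 b3)
      (e1 M a0 a1 a2 a3 b0 b1 b2 b3)
      (e2 M a0 a1 a2 a3 b0 b1 b2 b3)
      (e3 M a0 a1 a2 a3 b0 b1 b2 b3)
      where
      e0 : ∀ M a0 a1 a2 a3 b0 b1 b2 b3
        → a0 * b0 + M * (a1 * b3 + a2 * b2 + a3 * b1)
        ≡ b0 * a0 + M * (b1 * a3 + b2 * a2 + b3 * a1)
      e0 = solve-∀
      e1 : ∀ M a0 a1 a2 a3 b0 b1 b2 b3
        → a0 * b1 + a1 * b0 + M * (a2 * b3 + a3 * b2)
        ≡ b0 * a1 + b1 * a0 + M * (b2 * a3 + b3 * a2)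
      e1 = solve-∀
      e2 : ∀ M a0 a1 a2 a3 b0 b1 b2 b3
        → a0 * b2 + a1 * b1 + a2 * b0 + M * (a3 * b3)
        ≡ b0 * a2 + b1 * a1 + b2 * a0 + M * (b3 * a3)
      e2 = solve-∀
      e3 : ∀ M a0 a1 a2 a3 b0 b1 b2 b3
        → a0 * b3 + a1 * b2 + a2 * b1 + a3 * b0
        ≡ b0 * a3 + b1 * a2 + b2 * a1 + b3 * a0
      e3 = solve-∀

    mul-assoc : ∀ x y z → mul (mul x y) z ≡ mul x (mul y z)
    mul-assoc ⟨ a0 , a1 , a2 , a3 ⟩ ⟨ b0 , b1 , b2 , b3 ⟩ ⟨ c0 , c1 , c2 , c3 ⟩ = ⟨⟩-cong 
      (e0 M a0 a1 a2 a3 b0 b1 b2 b3 c0 c1 c2 c3)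
      (e1 M a0 a1 a2 a3 b0 b1 b2 b3 c0 c1 c2 c3)
      (e2 M a0 a1 a2 a3 b0 b1 b2 b3 c0 c1 c2 c3)
      (e3 M a0 a1 a2 a3 b0 b1 b2 b3 c0 c1 c2 c3)
      where
      e0 : ∀ M a0 a1 a2 a3 b0 b1 b2 b3 c0 c1 c2 c3
        → (a0 * b0 + M * (a1 * b3 + a2 * b2 + a3 * b1)) * c0 + M * ((a0 * b1 + a1 * b0 + M * (a2 * b3 + a3 * b2)) * c3 + (a0 * b2 + a1 * b1 + a2 * b0 + M * (a3 * b3)) * c2 + (a0 * b3 + a1 * b2 + a2 * b1 + a3 * b0) * c1)
        ≡ a0 * (b0 * c0 + M * (b1 * c3 + b2 * c2 + b3 * c1)) + M * (a1 * (b0 * c3 + b1 * c2 + b2 * c1 + b3 * c0) + a2 * (b0 * c2 + b1 * c1 + b2 * c0 + M * (b3 * c3)) + a3 * (b0 * c1 + b1 * c0 + M * (b2 * c3 + b3 * c2)))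
      e0 = solve-∀
      e1 : ∀ M a0 a1 a2 a3 b0 b1 b2 b3 c0 c1 c2 c3
        → (a0 * b0 + M * (a1 * b3 + a2 * b2 + a3 * b1)) * c1 + (a0 * b1 + a1 * b0 + M * (a2 * b3 + a3 * b2)) * c0 + M * ((a0 * b2 + a1 * b1 + a2 * b0 + M * (a3 * b3)) * c3 + (a0 * b3 + a1 * b2 + a2 * b1 + a3 * b0) * c2)
        ≡ a0 * (b0 * c1 + b1 * c0 + M * (b2 * c3 + b3 * c2)) + a1 * (b0 * c0 + M * (b1 * c3 + b2 * c2 + b3 * c1)) + M * (a2 * (b0 * c3 + b1 * c2 + b2 * c1 + b3 * c0) + a3 * (b0 * c2 + b1 * c1 + b2 * c0 + M * (b3 * c3)))
      e1 = solve-∀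
      e2 : ∀ M a0 a1 a2 a3 b0 b1 b2 b3 c0 c1 c2 c3
        → (a0 * b0 + M * (a1 * b3 + a2 * b2 + a3 * b1)) * c2 + (a0 * b1 + a1 * b0 + M * (a2 * b3 + a3 * b2)) * c1 + (a0 * b2 + a1 * b1 + a2 * b0 + M * (a3 * b3)) * c0 + M * ((a0 * b3 + a1 * b2 + a2 * b1 + a3 * b0) * c3)
        ≡ a0 * (b0 * c2 + b1 * c1 + b2 * c0 + M * (b3 * c3)) + a1 * (b0 * c1 + b1 * c0 + M * (b2 * c3 + b3 * c2)) + a2 * (b0 * c0 + M * (b1 * c3 + b2 * c2 + b3 * c1)) + M * (a3 * (b0 * c3 + b1 * c2 + b2 * c1 + b3 * c0))
      e2 = solve-∀
      e3 : ∀ M a0 a1 a2 a3 b0 b1 b2 b3 c0 c1 c2 c3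
        → (a0 * b0 + M * (a1 * b3 + a2 * b2 + a3 * b1)) * c3 + (a0 * b1 + a1 * b0 + M * (a2 * b3 + a3 * b2)) * c2 + (a0 * b2 + a1 * b1 + a2 * b0 + M * (a3 * b3)) * c1 + (a0 * b3 + a1 * b2 + a2 * b1 + a3 * b0) * c0
        ≡ a0 * (b0 * c3 + b1 * c2 + b2 * c1 + b3 * c0) + a1 * (b0 * c2 + b1 * c1 + b2 * c0 + M * (b3 * c3)) + a2 * (b0 * c1 + b1 * c0 + M * (b2 * c3 + b3 * c2)) + a3 * (b0 * c0 + M * (b1 * c3 + b2 * c2 + b3 * c1))
      e3 = solve-∀

    mul-distribˡ : ∀ x y z → mul x (addE y z) ≡ addE (mul x y) (mul x z)
    mul-distribˡ ⟨ a0 , a1 , a2 , a3 ⟩ ⟨ b0 , b1 , b2 , b3 ⟩ ⟨ c0 , c1 , c2 , c3 ⟩ = ⟨⟩-cong 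
      (e0 M a0 a1 a2 a3 b0 b1 b2 b3 c0 c1 c2 c3)
      (e1 M a0 a1 a2 a3 b0 b1 b2 b3 c0 c1 c2 c3)
      (e2 M a0 a1 a2 a3 b0 b1 b2 b3 c0 c1 c2 c3)
      (e3 M a0 a1 a2 a3 b0 b1 b2 b3 c0 c1 c2 c3)
      where
      e0 : ∀ M a0 a1 a2 a3 b0 b1 b2 b3 c0 c1 c2 c3
        → a0 * (b0 + c0) + M * (a1 * (b3 + c3) + a2 * (b2 + c2) + a3 * (b1 + c1))
        ≡ (a0 * b0 + M * (a1 * b3 + a2 * b2 + a3 * b1)) + (a0 * c0 + M * (a1 * c3 + a2 * c2 + a3 * c1))
      e0 = solve-∀
      e1 : ∀ M a0 a1 a2 a3 b0 b1 b2 b3 c0 c1 c2 c3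
        → a0 * (b1 + c1) + a1 * (b0 + c0) + M * (a2 * (b3 + c3) + a3 * (b2 + c2))
        ≡ (a0 * b1 + a1 * b0 + M * (a2 * b3 + a3 * b2)) + (a0 * c1 + a1 * c0 + M * (a2 * c3 + a3 * c2))
      e1 = solve-∀
      e2 : ∀ M a0 a1 a2 a3 b0 b1 b2 b3 c0 c1 c2 c3
        → a0 * (b2 + c2) + a1 * (b1 + c1) + a2 * (b0 + c0) + M * (a3 * (b3 + c3))
        ≡ (a0 * b2 + a1 * b1 + a2 * b0 + M * (a3 * b3)) + (a0 * c2 + a1 * c1 + a2 * c0 + M * (a3 * c3))
      e2 = solve-∀
      e3 : ∀ M a0 a1 a2 a3 b0 b1 b2 b3 c0 c1 c2 c3
        → a0 * (b3 + c3) + a1 * (b2 + c2) + a2 * (b1 + c1) + a3 * (b0 + c0)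
        ≡ (a0 * b3 + a1 * b2 + a2 * b1 + a3 * b0) + (a0 * c3 + a1 * c2 + a2 * c1 + a3 * c0)
      e3 = solve-∀

    mul-identityˡ : ∀ x → mul oneE x ≡ x
    mul-identityˡ ⟨ a0 , a1 , a2 , a3 ⟩ = ⟨⟩-cong 
      (e0 M a0 a1 a2 a3)
      (e1 M a0 a1 a2 a3)
      (e2 M a0 a1 a2 a3)
      (e3 M a0 a1 a2 a3)
      where
      e0 : ∀ M a0 a1 a2 a3
        → 1ℤ * a0 + M * (0ℤ * a3 + 0ℤ * a2 + 0ℤ * a1)
        ≡ a0
      e0 = solve-∀
      e1 : ∀ M a0 a1 a2 a3
        → 1ℤ * a1 + 0ℤ * a0 + M * (0ℤ * a3 + 0ℤ * a2)
        ≡ a1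
      e1 = solve-∀
      e2 : ∀ M a0 a1 a2 a3
        → 1ℤ * a2 + 0ℤ * a1 + 0ℤ * a0 + M * (0ℤ * a3)
        ≡ a2
      e2 = solve-∀
      e3 : ∀ M a0 a1 a2 a3
        → 1ℤ * a3 + 0ℤ * a2 + 0ℤ * a1 + 0ℤ * a0
        ≡ a3
      e3 = solve-∀

    private
      mul-identityʳ : ∀ x → mul x oneE ≡ x
      mul-identityʳ x = trans (mul-comm x oneE) (mul-identityˡ x)

      mul-distribʳ : ∀ x y z → mul (addE y z) x ≡ addE (mul y x) (mul z x)
      mul-distribʳ x y z = trans (mul-comm (addE y z) x)
        (trans (mul-distribˡ x y z) (cong₂ addE (mul-comm x y) (mul-comm x z)))

    isCommutativeRing : IsCommutativeRing _≡_ addE mul negE zeroE oneE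
    isCommutativeRing = record
      { isRing = record
        { +-isAbelianGroup = record
          { isGroup = record
            { isMonoid = record
              { isSemigroup = record
                { isMagma = record { isEquivalence = isEquivalence ; ∙-cong = cong₂ addE }
                ; assoc = λ x y z → ⟨⟩-cong (+-assoc (c0 x) (c0 y) (c0 z)) (+-assoc (c1 x) (c1 y) (c1 z))
                                            (+-assoc (c2 x) (c2 y) (c2 z)) (+-assoc (c3 x) (c3 y) (c3 z)) }
              ; identity = (λ x → ⟨⟩-cong (+-identityˡ _) (+-identityˡ _) (+-identityˡ _) (+-identityˡ _))
                         , (λ x → ⟨⟩-cong (+-identityʳ _) (+-identityʳ _) (+-identityʳ _) (+-identityʳ _)) }
            ; inverse = (λ x → ⟨⟩-cong (+-inverseˡ (c0 x)) (+-inverseˡ (c1 x)) (+-inverseˡ (c2 x)) (+-inverseˡ (c3 x)))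
                      , (λ x → ⟨⟩-cong (+-inverseʳ (c0 x)) (+-inverseʳ (c1 x)) (+-inverseʳ (c2 x)) (+-inverseʳ (c3 x)))
            ; ⁻¹-cong = cong negE }
          ; comm = λ x y → ⟨⟩-cong (+-comm (c0 x) (c0 y)) (+-comm (c1 x) (c1 y)) (+-comm (c2 x) (c2 y)) (+-comm (c3 x) (c3 y)) }
        ; *-cong = cong₂ mul
        ; *-assoc = mul-assoc
        ; *-identity = mul-identityˡ , mul-identityʳ
        ; distrib = mul-distribˡ , mul-distribʳ }
      ; *-comm = mul-comm }

  EltRing : ℤ → CommutativeRing 0ℓ 0ℓ
  EltRing M = record { isCommutativeRing = isCommutativeRing M }

-- Binomial expansions with divisible error terms.

module Binomial where

  open import Data.Nat as ℕ using (ℕ; zero; suc)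
  import Data.Nat.Properties as ℕ
  open import Data.Integer using (+_; _+_; _*_)
  open import Data.Integer.Tactic.RingSolver using (solve)
  open import Data.Product using (∃; _,_; proj₁; proj₂)
  open import Relation.Binary.PropositionalEquality using (_≡_; refl; sym; trans; cong; cong₂)
  open import Algebra.Bundles using (CommutativeSemiring)
  open import Level using (0ℓ)

  -- The binomial coefficient `n (n - 1) / 2`, built up by Pascal's rule.
  triangle : ℕ → ℕ
  triangle zero = 0
  triangle (suc n) = triangle n ℕ.+ n

  module BinomialExpansion (R : CommutativeSemiring 0ℓ 0ℓ) where

    open CommutativeSemiring R using (Carrier; _≈_; 0#; 1#; setoid; semiring; +-cong; *-cong; +-congˡ; +-congʳ; *-congˡ; *-congʳ; *-identityʳ; *-assoc)
      renaming (refl to ≈-refl; sym to ≈-sym; trans to ≈-trans; reflexive to ≈-reflexive; _+_ to _⊞_; _*_ to _⊠_)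
    open import Algebra.Properties.Semiring.Exp semiring using (_^_; ^-congˡ; ^-assocʳ)
    open import Algebra.Properties.Semiring.Mult semiring using (×1-homo-*; ×-homo-+) renaming (_×_ to _·_)
    open import Relation.Binary.Reasoning.Setoid setoid
    open import Algebra.Solver.Ring.NaturalCoefficients.Default R
      using (_:=_; _:+_; _:*_; con) renaming (solve to solveR)

    private
      expand-zero : ∀ y → 1# ⊞ 0# ⊠ y ⊞ 0# ⊠ (y ⊠ y) ⊞ y ⊠ (y ⊠ y) ⊠ 0# ≈ 1#
      expand-zero = solveR 1 (λ y → con 1 :+ con 0 :* y :+ con 0 :* (y :* y) :+ y :* (y :* y) :* con 0 := con 1) ≈-refl

      expand-suc : ∀ y n t w → (1# ⊞ y) ⊠ (1# ⊞ n ⊠ y ⊞ t ⊠ (y ⊠ y) ⊞ y ⊠ (y ⊠ y) ⊠ w)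
        ≈ 1# ⊞ (1# ⊞ n) ⊠ y ⊞ (t ⊞ n) ⊠ (y ⊠ y) ⊞ y ⊠ (y ⊠ y) ⊠ (t ⊞ w ⊞ y ⊠ w)
      expand-suc = solveR 4 (λ y n t w → (con 1 :+ y) :* (con 1 :+ n :* y :+ t :* (y :* y) :+ y :* (y :* y) :* w)
        := con 1 :+ (con 1 :+ n) :* y :+ (t :+ n) :* (y :* y) :+ y :* (y :* y) :* (t :+ w :+ y :* w)) ≈-refl

      first-order-zero : ∀ P c z s t w → let y = P ⊠ c ⊠ z in
        1# ⊞ s ⊠ y ⊞ t ⊠ (y ⊠ y) ⊞ y ⊠ (y ⊠ y) ⊠ w ≈ 1# ⊞ s ⊠ y ⊞ P ⊠ c ⊠ (P ⊠ ((t ⊞ y ⊠ w) ⊠ (c ⊠ z ⊠ z)))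
      first-order-zero = solveR 6 (λ P c z s t w → let y = P :* c :* z in
        con 1 :+ s :* y :+ t :* (y :* y) :+ y :* (y :* y) :* w := con 1 :+ s :* y :+ P :* c :* (P :* ((t :+ y :* w) :* (c :* z :* z)))) ≈-refl

      pth-power : ∀ P c z h w → let y = P ⊠ c ⊠ z in
        1# ⊞ P ⊠ y ⊞ P ⊠ h ⊠ (y ⊠ y) ⊞ y ⊠ (y ⊠ y) ⊠ w
        ≈ 1# ⊞ P ⊠ (P ⊠ c) ⊠ (z ⊞ P ⊠ (h ⊠ (c ⊠ z ⊠ z) ⊞ c ⊠ c ⊠ (z ⊠ z ⊠ z) ⊠ w))
      pth-power = solveR 5 (λ P c z h w → let y = P :* c :* z in
        con 1 :+ P :* y :+ P :* h :* (y :* y) :+ y :* (y :* y) :* w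
        := con 1 :+ P :* (P :* c) :* (z :+ P :* (h :* (c :* z :* z) :+ c :* c :* (z :* z :* z) :* w))) ≈-refl

      first-order-suc : ∀ P c z v w s q →
        1# ⊞ s ⊠ q ⊠ (P ⊠ (P ⊠ c) ⊠ (z ⊞ P ⊠ v)) ⊞ P ⊠ (P ⊠ c) ⊠ (P ⊠ q ⊠ w)
        ≈ 1# ⊞ s ⊠ (P ⊠ q) ⊠ (P ⊠ c ⊠ z) ⊞ P ⊠ c ⊠ (P ⊠ (P ⊠ q) ⊠ (s ⊠ v ⊞ w))
      first-order-suc = solveR 7 (λ P c z v w s q →
        con 1 :+ s :* q :* (P :* (P :* c) :* (z :+ P :* v)) :+ P :* (P :* c) :* (P :* q :* w)
        := con 1 :+ s :* (P :* q) :* (P :* c :* z) :+ P :* c :* (P :* (P :* q) :* (s :* v :+ w))) ≈-refl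

      distribute : ∀ g S P z Q w → g ⊠ (1# ⊞ S ⊠ (P ⊠ 1# ⊠ z) ⊞ P ⊠ 1# ⊠ (Q ⊠ w))
        ≈ g ⊞ S ⊠ P ⊠ (g ⊠ z) ⊞ P ⊠ Q ⊠ (g ⊠ w)
      distribute = solveR 6 (λ g S P z Q w → g :* (con 1 :+ S :* (P :* con 1 :* z) :+ P :* con 1 :* (Q :* w))
        := g :+ S :* P :* (g :* z) :+ P :* Q :* (g :* w)) ≈-refl

      ⌜_⌝ : ℕ → Carrier
      ⌜ n ⌝ = n · 1#

    second-order : ∀ y n → ∃ λ w →
      (1# ⊞ y) ^ n ≈ 1# ⊞ ⌜ n ⌝ ⊠ y ⊞ ⌜ triangle n ⌝ ⊠ (y ⊠ y) ⊞ y ⊠ (y ⊠ y) ⊠ w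
    second-order y zero = 0# , ≈-sym (expand-zero y)
    second-order y (suc n) with second-order y n
    ... | w , e = ⌜ triangle n ⌝ ⊞ w ⊞ y ⊠ w , (begin
      (1# ⊞ y) ⊠ (1# ⊞ y) ^ n
        ≈⟨ *-congˡ e ⟩
      (1# ⊞ y) ⊠ (1# ⊞ ⌜ n ⌝ ⊠ y ⊞ ⌜ triangle n ⌝ ⊠ (y ⊠ y) ⊞ y ⊠ (y ⊠ y) ⊠ w)
        ≈⟨ expand-suc y ⌜ n ⌝ ⌜ triangle n ⌝ w ⟩
      1# ⊞ (1# ⊞ ⌜ n ⌝) ⊠ y ⊞ (⌜ triangle n ⌝ ⊞ ⌜ n ⌝) ⊠ (y ⊠ y) ⊞ y ⊠ (y ⊠ y) ⊠ (⌜ triangle n ⌝ ⊞ w ⊞ y ⊠ w)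
        ≈⟨ +-congʳ (+-congˡ (*-congʳ (≈-sym (×-homo-+ 1# (triangle n) n)))) ⟩
      1# ⊞ ⌜ suc n ⌝ ⊠ y ⊞ ⌜ triangle (suc n) ⌝ ⊠ (y ⊠ y) ⊞ y ⊠ (y ⊠ y) ⊠ (⌜ triangle n ⌝ ⊞ w ⊞ y ⊠ w) ∎)

    -- Each factor `1 + P z` is 1 modulo `P`. The sieve uses this to read residues of powers from
    -- one period.
    zeroth-order : ∀ g P z n → ∃ λ w → g ⊠ (1# ⊞ P ⊠ z) ^ n ≈ g ⊞ P ⊠ w
    zeroth-order g P z zero = 0# , solveR 2 (λ g P → g :* con 1 := g :+ P :* con 0) ≈-refl g P
    zeroth-order g P z (suc n) with zeroth-order (g ⊠ (1# ⊞ P ⊠ z)) P z n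
    ... | w , e = g ⊠ z ⊞ w , (begin
      g ⊠ ((1# ⊞ P ⊠ z) ⊠ (1# ⊞ P ⊠ z) ^ n)
        ≈⟨ *-assoc g (1# ⊞ P ⊠ z) ((1# ⊞ P ⊠ z) ^ n) ⟨
      g ⊠ (1# ⊞ P ⊠ z) ⊠ (1# ⊞ P ⊠ z) ^ n
        ≈⟨ e ⟩
      g ⊠ (1# ⊞ P ⊠ z) ⊞ P ⊠ w
        ≈⟨ solveR 4 (λ g P z w → g :* (con 1 :+ P :* z) :+ P :* w := g :+ P :* (g :* z :+ w)) ≈-refl g P z w ⟩
      g ⊞ P ⊠ (g ⊠ z ⊞ w) ∎)

    module _ (p h : ℕ) (tri≡ : triangle p ≡ p ℕ.* h) where

      private P = ⌜ p ⌝

      -- The expansion modulo P c p^(j+1) when p^j divides the exponent; as p is odd, p ∣ triangle p.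
      first-order : ∀ j s c z → let s′ = s ℕ.* p ℕ.^ j in ∃ λ w →
        (1# ⊞ P ⊠ c ⊠ z) ^ s′ ≈ 1# ⊞ ⌜ s′ ⌝ ⊠ (P ⊠ c ⊠ z) ⊞ P ⊠ c ⊠ (⌜ p ℕ.^ suc j ⌝ ⊠ w)
      first-order zero s c z = (t ⊞ y ⊠ w) ⊠ (c ⊠ z ⊠ z) , (begin
        (1# ⊞ y) ^ (s ℕ.* 1)
          ≡⟨ cong ((1# ⊞ y) ^_) (ℕ.*-identityʳ s) ⟩
        (1# ⊞ y) ^ s
          ≈⟨ proj₂ (second-order y s) ⟩
        1# ⊞ ⌜ s ⌝ ⊠ y ⊞ t ⊠ (y ⊠ y) ⊞ y ⊠ (y ⊠ y) ⊠ w
          ≈⟨ first-order-zero P c z ⌜ s ⌝ t w ⟩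
        1# ⊞ ⌜ s ⌝ ⊠ y ⊞ P ⊠ c ⊠ (P ⊠ ((t ⊞ y ⊠ w) ⊠ (c ⊠ z ⊠ z)))
          ≡⟨ cong₂ (λ a b → 1# ⊞ ⌜ a ⌝ ⊠ y ⊞ P ⊠ c ⊠ (⌜ b ⌝ ⊠ ((t ⊞ y ⊠ w) ⊠ (c ⊠ z ⊠ z)))) (ℕ.*-identityʳ s) (ℕ.*-identityʳ p) ⟨
        1# ⊞ ⌜ s ℕ.* 1 ⌝ ⊠ y ⊞ P ⊠ c ⊠ (⌜ p ℕ.* 1 ⌝ ⊠ ((t ⊞ y ⊠ w) ⊠ (c ⊠ z ⊠ z))) ∎)
        where
        y = P ⊠ c ⊠ z
        t = ⌜ triangle s ⌝
        w = proj₁ (second-order y s)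
      first-order (suc j) s c z = ⌜ s ⌝ ⊠ v ⊞ w′ , (begin
        (1# ⊞ y) ^ (s ℕ.* (p ℕ.* q))
          ≡⟨ cong ((1# ⊞ y) ^_) index ⟩
        (1# ⊞ y) ^ (p ℕ.* s₀)
          ≈⟨ ^-assocʳ (1# ⊞ y) p s₀ ⟨
        ((1# ⊞ y) ^ p) ^ s₀
          ≈⟨ ^-congˡ s₀ base ⟩
        (1# ⊞ P ⊠ (P ⊠ c) ⊠ (z ⊞ P ⊠ v)) ^ s₀
          ≈⟨ proj₂ rec ⟩
        1# ⊞ ⌜ s₀ ⌝ ⊠ (P ⊠ (P ⊠ c) ⊠ (z ⊞ P ⊠ v)) ⊞ P ⊠ (P ⊠ c) ⊠ (⌜ p ℕ.* q ⌝ ⊠ w′)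
          ≈⟨ +-cong (+-congˡ (*-congʳ (×1-homo-* s q))) (*-congˡ (*-congʳ (×1-homo-* p q))) ⟩
        1# ⊞ ⌜ s ⌝ ⊠ ⌜ q ⌝ ⊠ (P ⊠ (P ⊠ c) ⊠ (z ⊞ P ⊠ v)) ⊞ P ⊠ (P ⊠ c) ⊠ (P ⊠ ⌜ q ⌝ ⊠ w′)
          ≈⟨ first-order-suc P c z v w′ ⌜ s ⌝ ⌜ q ⌝ ⟩
        1# ⊞ ⌜ s ⌝ ⊠ (P ⊠ ⌜ q ⌝) ⊠ (P ⊠ c ⊠ z) ⊞ P ⊠ c ⊠ (P ⊠ (P ⊠ ⌜ q ⌝) ⊠ (⌜ s ⌝ ⊠ v ⊞ w′))
          ≈⟨ +-cong (+-congˡ (*-congʳ (≈-trans (×1-homo-* s (p ℕ.* q)) (*-congˡ (×1-homo-* p q)))))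
                    (*-congˡ (*-congʳ (≈-trans (×1-homo-* p (p ℕ.* q)) (*-congˡ (×1-homo-* p q))))) ⟨
        1# ⊞ ⌜ s ℕ.* (p ℕ.* q) ⌝ ⊠ (P ⊠ c ⊠ z) ⊞ P ⊠ c ⊠ (⌜ p ℕ.* (p ℕ.* q) ⌝ ⊠ (⌜ s ⌝ ⊠ v ⊞ w′)) ∎)
        where
        y = P ⊠ c ⊠ z
        q = p ℕ.^ j
        s₀ = s ℕ.* q
        w = proj₁ (second-order y p)
        v = ⌜ h ⌝ ⊠ (c ⊠ z ⊠ z) ⊞ c ⊠ c ⊠ (z ⊠ z ⊠ z) ⊠ w
        rec = first-order j s (P ⊠ c) (z ⊞ P ⊠ v)
        w′ = proj₁ rec
        index : s ℕ.* (p ℕ.* q) ≡ p ℕ.* s₀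
        index = trans (sym (ℕ.*-assoc s p q)) (trans (cong (ℕ._* q) (ℕ.*-comm s p)) (ℕ.*-assoc p s q))
        -- The `p`-th power has the same shape with `c` replaced by `P c`, and `z` changes only by a
        -- multiple of `P`. This is why `c` is carried through the induction.
        base : (1# ⊞ y) ^ p ≈ 1# ⊞ P ⊠ (P ⊠ c) ⊠ (z ⊞ P ⊠ v)
        base = begin
          (1# ⊞ y) ^ p
            ≈⟨ proj₂ (second-order y p) ⟩
          1# ⊞ P ⊠ y ⊞ ⌜ triangle p ⌝ ⊠ (y ⊠ y) ⊞ y ⊠ (y ⊠ y) ⊠ w
            ≈⟨ +-congʳ (+-congˡ (*-congʳ (≈-trans (≈-reflexive (cong ⌜_⌝ tri≡)) (×1-homo-* p h)))) ⟩
          1# ⊞ P ⊠ y ⊞ P ⊠ ⌜ h ⌝ ⊠ (y ⊠ y) ⊞ y ⊠ (y ⊠ y) ⊠ w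
            ≈⟨ pth-power P c z ⌜ h ⌝ w ⟩
          1# ⊞ P ⊠ (P ⊠ c) ⊠ (z ⊞ P ⊠ v) ∎

      perturbation : ∀ g z s j → let s′ = s ℕ.* p ℕ.^ j in ∃ λ w →
        g ⊠ (1# ⊞ P ⊠ z) ^ s′ ≈ g ⊞ ⌜ s′ ℕ.* p ⌝ ⊠ (g ⊠ z) ⊞ ⌜ p ℕ.* p ℕ.^ suc j ⌝ ⊠ (g ⊠ w)
      perturbation g z s j = w , (begin
        g ⊠ (1# ⊞ P ⊠ z) ^ s′
          ≈⟨ *-congˡ (^-congˡ s′ (+-congˡ (*-congʳ (*-identityʳ P)))) ⟨
        g ⊠ (1# ⊞ P ⊠ 1# ⊠ z) ^ s′
          ≈⟨ *-congˡ (proj₂ (first-order j s 1# z)) ⟩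
        g ⊠ (1# ⊞ ⌜ s′ ⌝ ⊠ (P ⊠ 1# ⊠ z) ⊞ P ⊠ 1# ⊠ (⌜ p ℕ.^ suc j ⌝ ⊠ w))
          ≈⟨ distribute g ⌜ s′ ⌝ P z ⌜ p ℕ.^ suc j ⌝ w ⟩
        g ⊞ ⌜ s′ ⌝ ⊠ P ⊠ (g ⊠ z) ⊞ P ⊠ ⌜ p ℕ.^ suc j ⌝ ⊠ (g ⊠ w)
          ≈⟨ +-cong (+-congˡ (*-congʳ (×1-homo-* s′ p))) (*-congʳ (×1-homo-* p (p ℕ.^ suc j))) ⟨
        g ⊞ ⌜ s′ ℕ.* p ⌝ ⊠ (g ⊠ z) ⊞ ⌜ p ℕ.* p ℕ.^ suc j ⌝ ⊠ (g ⊠ w) ∎)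
        where
        s′ = s ℕ.* p ℕ.^ j
        w = proj₁ (first-order j s 1# z)

-- Simple zeros of the norm as a p-adic function of the exponent.

module PAdicUniqueness where

  open QuarticRing
  open Binomial
  open import Algebra.Bundles using (CommutativeRing)
  open import Data.Nat as ℕ using (ℕ; zero; suc)
  import Data.Nat.Properties as ℕ
  import Data.Nat.Divisibility as ℕ
  open import Data.Integer using (ℤ; +_; -_; _+_; _*_; 0ℤ; 1ℤ; ∣_∣)
  import Data.Integer.Properties as ℤ
  import Data.Integer.Divisibility.Signed as Signed
  open import Data.Integer.Tactic.RingSolver using (solve-∀)
  open import Data.Product using (∃; _,_; proj₁; proj₂)
  open import Data.Empty using (⊥-elim)
  open import Relation.Binary.PropositionalEquality using (_≡_; refl; sym; trans; cong; cong₂; subst)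

  scalar : ℤ → Elt
  scalar k = ⟨ k , 0ℤ , 0ℤ , 0ℤ ⟩

  increment≡0 : ∀ a b → a + b ≡ a → b ≡ 0ℤ
  increment≡0 a b e = trans (difference a b) (trans (cong (_+ - a) e) (ℤ.+-inverseʳ a))
    where
    difference : ∀ a b → b ≡ a + b + - a
    difference = solve-∀

  -- For `q = p^j` the three terms share the factor `p q`; after cancelling it, all but `s T` still
  -- contain `p`.
  divide : ∀ p q s T N R .{{_ : ℕ.NonZero p}} .{{_ : ℕ.NonZero q}} →
    + (s ℕ.* q ℕ.* p) * T + + (s ℕ.* q ℕ.* p) * + (s ℕ.* q ℕ.* p) * N + + (p ℕ.* (p ℕ.* q)) * R ≡ 0ℤ →
    + s * T + + p * (+ s * + s * + q * N + R) ≡ 0ℤ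
  divide p@(suc _) q@(suc _) s T N R e = ℤ.*-cancelˡ-≡ (+ (p ℕ.* q)) _ _
    (trans (trans (cong (_* (+ s * T + + p * (+ s * + s * + q * N + R))) (ℤ.pos-* p q))
    (trans (factor (+ p) (+ q) (+ s) T N R)
    (trans (sym (cong₂ (λ k l → k * T + k * k * N + l * R)
      (trans (ℤ.pos-* (s ℕ.* q) p) (cong (_* + p) (ℤ.pos-* s q)))
      (trans (ℤ.pos-* p (p ℕ.* q)) (cong (+ p *_) (ℤ.pos-* p q))))) e))) (sym (ℤ.*-zeroʳ (+ (p ℕ.* q)))))
    where
    factor : ∀ p q s T N R → p * q * (s * T + p * (s * s * q * N + R))
      ≡ s * q * p * T + s * q * p * (s * q * p) * N + p * (p * q) * R
    factor = solve-∀

  -- `I` is an explicit inverse of `T` modulo `p`; multiplying `s T ≡ 0` by it leaves `s ≡ 0`.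
  invertible-slope : ∀ p s T I E X → T * I ≡ 1ℤ + + p * E → + s * T + + p * X ≡ 0ℤ → p ℕ.∣ s
  invertible-slope p s T I E X inv e = Signed.∣⇒∣ᵤ (Signed.divides (- (X * I + + s * E))
    (trans (sym (ℤ.+-identityʳ (+ s))) (trans (cong (λ a → + s + - (a * I)) (sym e))
    (trans (eliminate (+ p) (+ s) T I E X) (trans (cong (λ a → + s + - (+ s * (a + - (+ p * E))) + - (X * I + + s * E) * + p) inv)
    (cancelled (+ p) (+ s) E (- (X * I + + s * E) * + p)))))))
    where
    eliminate : ∀ p s T I E X → s + - ((s * T + p * X) * I) ≡ s + - (s * (T * I + - (p * E))) + - (X * I + s * E) * p
    eliminate = solve-∀
    cancelled : ∀ p s E Y → s + - (s * (1ℤ + p * E + - (p * E))) + Y ≡ Y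
    cancelled = solve-∀

  -- A positive `s` satisfies `s < p^s`, so `j = s` already gives a contradiction.
  divisible-by-powers⇒0 : ∀ p .{{_ : ℕ.NonZero p}} → 1 ℕ.< p → ∀ s → (∀ j → p ℕ.^ j ℕ.∣ s) → s ≡ 0
  divisible-by-powers⇒0 p 1<p zero d = refl
  divisible-by-powers⇒0 p 1<p s@(suc _) d = ⊥-elim (ℕ.<⇒≱ (n<p^n s) (ℕ.∣⇒≤ (d s)))
    where
    n<p^n : ∀ n → n ℕ.< p ℕ.^ n
    n<p^n zero = ℕ.s≤s ℕ.z≤n
    n<p^n (suc n) = ℕ.≤-<-trans (n<p^n n) (subst (p ℕ.^ n ℕ.<_) (ℕ.*-comm (p ℕ.^ n) p) (ℕ.m<m*n (p ℕ.^ n) p {{ℕ.m^n≢0 p n}} 1<p))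

  module _ (M : ℤ) where

    private
      module R = CommutativeRing (EltRing M)
      open import Algebra.Properties.Semiring.Mult R.semiring using (×1-homo-*) renaming (_×_ to _·_)

    ·-scalar : ∀ n → n · oneE ≡ scalar (+ n)
    ·-scalar zero = refl
    ·-scalar (suc n) = cong (addE oneE) (·-scalar n)

    mul-scalar : ∀ k x → mul M (scalar k) x ≡ ⟨ k * c0 x , k * c1 x , k * c2 x , k * c3 x ⟩
    mul-scalar k ⟨ x0 , x1 , x2 , x3 ⟩ = ⟨⟩-cong (e₀ M k x0 x1 x2 x3) (e₁ M k x0 x1 x2 x3) (e₂ M k x0 x1 x2 x3) (e₃ M k x0 x1 x2 x3)
      where
      e₀ : ∀ M k x0 x1 x2 x3 → k * x0 + M * (0ℤ * x3 + 0ℤ * x2 + 0ℤ * x1) ≡ k * x0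
      e₀ = solve-∀
      e₁ : ∀ M k x0 x1 x2 x3 → k * x1 + 0ℤ * x0 + M * (0ℤ * x3 + 0ℤ * x2) ≡ k * x1
      e₁ = solve-∀
      e₂ : ∀ M k x0 x1 x2 x3 → k * x2 + 0ℤ * x1 + 0ℤ * x0 + M * (0ℤ * x3) ≡ k * x2
      e₂ = solve-∀
      e₃ : ∀ M k x0 x1 x2 x3 → k * x3 + 0ℤ * x2 + 0ℤ * x1 + 0ℤ * x0 ≡ k * x3
      e₃ = solve-∀

    -- The norm from `ℤ[√M]` to `ℤ` of `c0 + c2 √M`, the part of `x` even in `α`; this is not the
    -- norm of `x` itself.
    norm : Elt → ℤ
    norm x = c0 x * c0 x + - (M * (c2 x * c2 x))

    -- The derivative of norm at g in the direction u.
    slope : Elt → Elt → ℤ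
    slope g u = + 2 * (c0 g * c0 u + - (M * (c2 g * c2 u)))

    private
      multiple : Elt → ℤ → Elt → ℤ → Elt → Elt
      multiple g k u l v = addE (addE g (mul M (scalar k) u)) (mul M (scalar l) v)

      remainder : Elt → ℤ → Elt → ℤ → Elt → ℤ
      remainder g k u l v =
        + 2 * (c0 g + k * c0 u) * c0 v + l * (c0 v * c0 v)
        + - (M * (+ 2 * (c2 g + k * c2 u) * c2 v + l * (c2 v * c2 v)))

      norm-multiple : ∀ g k u l v → norm (multiple g k u l v)
        ≡ norm g + (k * slope g u + k * k * norm u + l * remainder g k u l v)
      norm-multiple g k u l v = trans
        (cong₂ (λ a b → a * a + - (M * (b * b)))
          (cong₂ (λ a b → c0 g + a + b) (cong c0 (mul-scalar k u)) (cong c0 (mul-scalar l v)))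
          (cong₂ (λ a b → c2 g + a + b) (cong c2 (mul-scalar k u)) (cong c2 (mul-scalar l v))))
        (identity M (c0 g) (c2 g) k (c0 u) (c2 u) l (c0 v) (c2 v))
        where
        identity : ∀ M g₀ g₂ k u₀ u₂ l v₀ v₂ →
          (g₀ + k * u₀ + l * v₀) * (g₀ + k * u₀ + l * v₀) + - (M * ((g₂ + k * u₂ + l * v₂) * (g₂ + k * u₂ + l * v₂)))
          ≡ g₀ * g₀ + - (M * (g₂ * g₂)) + (k * (+ 2 * (g₀ * u₀ + - (M * (g₂ * u₂)))) + k * k * (u₀ * u₀ + - (M * (u₂ * u₂)))
            + l * (+ 2 * (g₀ + k * u₀) * v₀ + l * (v₀ * v₀) + - (M * (+ 2 * (g₂ + k * u₂) * v₂ + l * (v₂ * v₂)))))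
        identity = solve-∀

    private
      open BinomialExpansion R.commutativeSemiring
      open import Algebra.Properties.Semiring.Exp R.semiring using (_^_)

      perturbation-in-coordinates : ∀ p h → triangle p ≡ p ℕ.* h → ∀ g z s j → let s′ = s ℕ.* p ℕ.^ j in ∃ λ w →
        mul M g (addE oneE (mul M (scalar (+ p)) z) ^ s′)
        ≡ multiple g (+ (s′ ℕ.* p)) (mul M g z) (+ (p ℕ.* p ℕ.^ suc j)) (mul M g w)
      perturbation-in-coordinates p h tri g z s j = rescale (perturbation p h tri g z s j)
        where
        s′ = s ℕ.* p ℕ.^ j
        rescale : (∃ λ w → mul M g (addE oneE (mul M (p · oneE) z) ^ s′)
            ≡ addE (addE g (mul M ((s′ ℕ.* p) · oneE) (mul M g z))) (mul M ((p ℕ.* p ℕ.^ suc j) · oneE) (mul M g w)))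
          → ∃ λ w → mul M g (addE oneE (mul M (scalar (+ p)) z) ^ s′)
            ≡ multiple g (+ (s′ ℕ.* p)) (mul M g z) (+ (p ℕ.* p ℕ.^ suc j)) (mul M g w)
        rescale (w , e) = w , trans (cong (λ P → mul M g (addE oneE (mul M P z) ^ s′)) (sym (·-scalar p)))
          (trans e (cong₂ (λ a b → addE (addE g (mul M a (mul M g z))) (mul M b (mul M g w)))
            (·-scalar (s′ ℕ.* p)) (·-scalar (p ℕ.* p ℕ.^ suc j))))

    -- If p^j ∣ s then g (1 + p z)^s = g + s p g z modulo p^(j+2); equality of norms then forces
    -- p^(j+1) ∣ s, because the slope is invertible modulo p.
    p-adic-uniqueness : ∀ p .{{_ : ℕ.NonZero p}} h → triangle p ≡ p ℕ.* h → 1 ℕ.< p → ∀ g z I E → slope g (mul M g z) * I ≡ 1ℤ + + p * E →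
      ∀ s → norm (mul M g (addE oneE (mul M (scalar (+ p)) z) ^ s)) ≡ norm g → s ≡ 0
    p-adic-uniqueness p h tri 1<p g z I E inv s e = divisible-by-powers⇒0 p 1<p s divisible
      where
      u : Elt
      u = mul M g z
      conclude : ∀ j s v x → let k = + (s ℕ.* p ℕ.^ j ℕ.* p) ; l = + (p ℕ.* (p ℕ.* p ℕ.^ j)) in
        x ≡ multiple g k u l v → norm x ≡ norm g → p ℕ.∣ s
      conclude j s v x x≡ e = invertible-slope p s (slope g u) I E (+ s * + s * + (p ℕ.^ j) * norm u + remainder g k u l v) inv
        (divide p (p ℕ.^ j) s (slope g u) (norm u) (remainder g k u l v) sum≡0)
        where
        instance
          p^j≢0 : ℕ.NonZero (p ℕ.^ j)
          p^j≢0 = ℕ.m^n≢0 p j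
        k l : ℤ
        k = + (s ℕ.* p ℕ.^ j ℕ.* p)
        l = + (p ℕ.* (p ℕ.* p ℕ.^ j))
        sum≡0 : k * slope g u + k * k * norm u + l * remainder g k u l v ≡ 0ℤ
        sum≡0 = increment≡0 (norm g) (k * slope g u + k * k * norm u + l * remainder g k u l v)
          (trans (sym (norm-multiple g k u l v)) (trans (cong norm (sym x≡)) e))
      step : ∀ j s → norm (mul M g (addE oneE (mul M (scalar (+ p)) z) ^ (s ℕ.* p ℕ.^ j))) ≡ norm g → p ℕ.∣ s
      step j s = conclude j s (mul M g (proj₁ (perturbation-in-coordinates p h tri g z s j))) _ (proj₂ (perturbation-in-coordinates p h tri g z s j))
      Solution : ℕ → Set
      Solution s = norm (mul M g (addE oneE (mul M (scalar (+ p)) z) ^ s)) ≡ norm g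
      divisible : ∀ j → p ℕ.^ j ℕ.∣ s
      divisible zero = ℕ.1∣ s
      divisible (suc j) = extend (divisible j)
        where
        extend : p ℕ.^ j ℕ.∣ s → p ℕ.^ suc j ℕ.∣ s
        extend (ℕ.divides s₀ s≡) = subst (p ℕ.^ suc j ℕ.∣_) (sym s≡) (ℕ.*-monoˡ-∣ (p ℕ.^ j) (step j s₀ (subst Solution s≡ e)))

-- Conjugation over `ℤ[√m]` and units of relative norm 1.

module Conjugation where

  open QuarticRing
  open import Algebra.Bundles using (CommutativeRing)
  open import Data.Integer using (ℤ; +_; -_; _+_; _*_; 0ℤ; 1ℤ)
  import Data.Integer.Properties as ℤ
  open import Data.Integer.Tactic.RingSolver using (solve-∀)
  open import Data.Product using (_,_)
  open import Relation.Binary.PropositionalEquality using (_≡_; refl; trans; cong; cong₂)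

  -- The automorphism `α ↦ -α`, which fixes `√m = α²`.
  σ : Elt → Elt
  σ ⟨ a , b , c , d ⟩ = ⟨ a , - b , c , - d ⟩

  σ-involutive : ∀ x → σ (σ x) ≡ x
  σ-involutive ⟨ a , b , c , d ⟩ = ⟨⟩-cong refl (ℤ.neg-involutive b) refl (ℤ.neg-involutive d)

  module RelativeUnits (M : ℤ) where

    σ-mul : ∀ x y → σ (mul M x y) ≡ mul M (σ x) (σ y)
    σ-mul ⟨ a0 , a1 , a2 , a3 ⟩ ⟨ b0 , b1 , b2 , b3 ⟩ = ⟨⟩-cong
      (e₀ M a0 a1 a2 a3 b0 b1 b2 b3) (e₁ M a0 a1 a2 a3 b0 b1 b2 b3) (e₂ M a0 a1 a2 a3 b0 b1 b2 b3) (e₃ M a0 a1 a2 a3 b0 b1 b2 b3)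
      where
      e₀ : ∀ M a0 a1 a2 a3 b0 b1 b2 b3 → a0 * b0 + M * (a1 * b3 + a2 * b2 + a3 * b1)
        ≡ a0 * b0 + M * (- a1 * - b3 + a2 * b2 + - a3 * - b1)
      e₀ = solve-∀
      e₁ : ∀ M a0 a1 a2 a3 b0 b1 b2 b3 → - (a0 * b1 + a1 * b0 + M * (a2 * b3 + a3 * b2))
        ≡ a0 * - b1 + - a1 * b0 + M * (a2 * - b3 + - a3 * b2)
      e₁ = solve-∀
      e₂ : ∀ M a0 a1 a2 a3 b0 b1 b2 b3 → a0 * b2 + a1 * b1 + a2 * b0 + M * (a3 * b3)
        ≡ a0 * b2 + - a1 * - b1 + a2 * b0 + M * (- a3 * - b3)
      e₂ = solve-∀
      e₃ : ∀ M a0 a1 a2 a3 b0 b1 b2 b3 → - (a0 * b3 + a1 * b2 + a2 * b1 + a3 * b0)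
        ≡ a0 * - b3 + - a1 * b2 + a2 * - b1 + - a3 * b0
      e₃ = solve-∀

    -- Relative norm 1 over `ℤ[√M]`; in particular `σ x` is the inverse of `x`.
    RelativeUnit : Elt → Set
    RelativeUnit x = mul M x (σ x) ≡ oneE

    open CommutativeRing (EltRing M) using (*-commutativeSemigroup)
    open import Algebra.Properties.CommutativeSemigroup *-commutativeSemigroup using (interchange)

    unit-mul : ∀ {x y} → RelativeUnit x → RelativeUnit y → RelativeUnit (mul M x y)
    unit-mul {x} {y} p q = trans (cong (mul M (mul M x y)) (σ-mul x y)) (trans (interchange x y (σ x) (σ y))
      (trans (cong₂ (mul M) p q) (mul-identityˡ M oneE)))

    unit-σ : ∀ {x} → RelativeUnit x → RelativeUnit (σ x)
    unit-σ {x} p = trans (cong (mul M (σ x)) (σ-involutive x)) (trans (mul-comm M (σ x) x) p)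

    -- Write `x = A + B α` with `A = c0 + c2 √M` and `B = c1 + c3 √M`. The relative norm is
    -- `A² - √M B²`; this is its coordinate at 1, and `irrational-part` is the one at `√M`.
    rational-part : ∀ {x} → RelativeUnit x → c0 x * c0 x + M * (c2 x * c2 x) + - (+ 2 * (M * (c1 x * c3 x))) ≡ 1ℤ
    rational-part {⟨ a , b , c , d ⟩} p = trans (eq M a b c d) (cong c0 p)
      where
      eq : ∀ M a b c d → a * a + M * (c * c) + - (+ 2 * (M * (b * d))) ≡ a * a + M * (b * - d + c * c + d * - b)
      eq = solve-∀

    irrational-part : ∀ {x} → RelativeUnit x → + 2 * (c0 x * c2 x) + - (c1 x * c1 x + M * (c3 x * c3 x)) ≡ 0ℤ
    irrational-part {⟨ a , b , c , d ⟩} p = trans (eq M a b c d) (cong c2 p)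
      where
      eq : ∀ M a b c d → + 2 * (a * c) + - (b * b + M * (d * d)) ≡ a * c + b * - b + c * a + M * (d * - d)
      eq = solve-∀

    -- If A = cosh φ and A₀ = cosh ψ are the α-even parts of x and z, then
    -- cosh (φ - ψ) * cosh (φ + ψ) = A² + A₀² - 1; this is its √m-coordinate.
    cosh-product : ∀ {x z} → RelativeUnit x → RelativeUnit z →
      c0 (mul M x (σ z)) * c2 (mul M x z) + c2 (mul M x (σ z)) * c0 (mul M x z)
      ≡ + 2 * (c0 x * c2 x) + + 2 * (c0 z * c2 z)
    cosh-product {x@(⟨ a , b , c , d ⟩)} {z@(⟨ A , B , C , D ⟩)} p q = trans (identity M a b c d A B C D)
      -- `identity` holds for all `x` and `z`: with relative norms `e` and `f` it reads
      -- `A² f + A₀² e - e f` at `√M`. Putting `e = f = 1` leaves `A² + A₀² - 1`.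
      (trans (cong₂ (λ (e₀ , e₂) (f₀ , f₂) → (a * a + M * (c * c)) * f₂ + + 2 * (a * c) * f₀ + (A * A + M * (C * C)) * e₂ + + 2 * (A * C) * e₀ + - (e₀ * f₂ + e₂ * f₀))
         (cong₂ _,_ (rational-part {x} p) (irrational-part {x} p)) (cong₂ _,_ (rational-part {z} q) (irrational-part {z} q)))
       (simplify (a * a + M * (c * c)) (+ 2 * (a * c)) (A * A + M * (C * C)) (+ 2 * (A * C))))
      where
      simplify : ∀ s t u v → s * 0ℤ + t * 1ℤ + u * 0ℤ + v * 1ℤ + - (1ℤ * 0ℤ + 0ℤ * 1ℤ) ≡ t + v
      simplify = solve-∀
      identity : ∀ M a b c d A B C D →
        (a * A + M * (b * - D + c * C + d * - B)) * (a * C + b * B + c * A + M * (d * D))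
        + (a * C + b * - B + c * A + M * (d * - D)) * (a * A + M * (b * D + c * C + d * B))
        ≡ (a * a + M * (c * c)) * (+ 2 * (A * C) + - (B * B + M * (D * D))) + + 2 * (a * c) * (A * A + M * (C * C) + - (+ 2 * (M * (B * D))))
        + (A * A + M * (C * C)) * (+ 2 * (a * c) + - (b * b + M * (d * d))) + + 2 * (A * C) * (a * a + M * (c * c) + - (+ 2 * (M * (b * d))))
        + - ((a * a + M * (c * c) + - (+ 2 * (M * (b * d)))) * (+ 2 * (A * C) + - (B * B + M * (D * D)))
             + (+ 2 * (a * c) + - (b * b + M * (d * d))) * (A * A + M * (C * C) + - (+ 2 * (M * (B * D)))))
      identity = solve-∀

-- Generation of the relative units by one unit.

module UnitGroup where

  open QuarticRing
  open Conjugation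
  open import Data.Nat as ℕ using (ℕ; zero; suc)
  import Data.Nat.Properties as ℕ
  open import Induction.WellFounded using (Acc; acc)
  open import Data.Integer using (ℤ; +_; -[1+_]; -_; _+_; _*_; 0ℤ; 1ℤ; _≤_; ∣_∣)
  import Data.Integer.Properties as ℤ
  open import Data.Integer.Tactic.RingSolver using (solve-∀)
  import Data.Nat.Tactic.RingSolver as ℕ
  open import Data.Product using (∃; ∃₂; _×_; _,_)
  open import Data.Sum using (_⊎_; inj₁; inj₂)
  open import Data.Empty using (⊥-elim)
  open import Relation.Nullary using (yes; no)
  open import Relation.Binary.PropositionalEquality using (_≡_; _≢_; refl; sym; trans; cong; cong₂; subst)

  square-abs : ∀ i → i * i ≡ + (∣ i ∣ ℕ.* ∣ i ∣)
  square-abs (+ n) = sym (ℤ.pos-* n n)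
  square-abs -[1+ n ] = refl

  half-nonneg : ∀ {s} z → + 2 * z ≡ + s → ∃ λ t → z ≡ + t
  half-nonneg (+ t) _ = t , refl

  SameSign : ℤ → ℤ → Set
  SameSign i j = (∃₂ λ α γ → i ≡ + α × j ≡ + γ) ⊎ (∃₂ λ α γ → i ≡ - + α × j ≡ - + γ)

  same-sign : ∀ i j {t} → i * j ≡ + t → SameSign i j
  same-sign (+ α) (+ γ) _ = inj₁ (α , γ , refl , refl)
  same-sign (+ zero) -[1+ γ ] _ = inj₂ (0 , suc γ , refl , refl)
  same-sign -[1+ α ] (+ zero) _ = inj₂ (suc α , 0 , refl , refl)
  same-sign -[1+ α ] -[1+ γ ] _ = inj₂ (suc α , suc γ , refl , refl)
  same-sign (+ suc α) -[1+ γ ] ()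
  same-sign -[1+ α ] (+ suc γ) ()

  both-nonneg : ∀ {i j} u v {w} → i * + u + j * + v ≡ + suc w → SameSign i j → ∃₂ λ α γ → i ≡ + α × j ≡ + γ
  both-nonneg u v e (inj₁ nonneg) = nonneg
  both-nonneg u v {w} e (inj₂ (α , γ , refl , refl)) = ⊥-elim (absurd (trans (negated (+ α) (+ γ) (+ u) (+ v)) e))
    where
    negated : ∀ a c u v → - (a * u + c * v) ≡ - a * u + - c * v
    negated = solve-∀
    nat : + α * + u + + γ * + v ≡ + (α ℕ.* u ℕ.+ γ ℕ.* v)
    nat = cong₂ _+_ (sym (ℤ.pos-* α u)) (sym (ℤ.pos-* γ v))
    neg≢pos : ∀ n → - + n ≢ + suc w
    neg≢pos zero ()
    neg≢pos (suc n) ()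
    absurd : - (+ α * + u + + γ * + v) ≢ + suc w
    absurd e = neg≢pos (α ℕ.* u ℕ.+ γ ℕ.* v) (trans (cong -_ (sym nat)) e)

  ⟪_,_,_,_⟫ : ℕ → ℕ → ℕ → ℕ → Elt
  ⟪ a , b , c , d ⟫ = ⟨ + a , + b , + c , + d ⟩

  module UnitDescent (m : ℕ) (1<m : 1 ℕ.< m) where

    private M = + m

    open RelativeUnits M

    quadratic-form : ∀ i j → i * i + M * (j * j) ≡ + (∣ i ∣ ℕ.* ∣ i ∣ ℕ.+ m ℕ.* (∣ j ∣ ℕ.* ∣ j ∣))
    quadratic-form i j = cong₂ _+_ (square-abs i) (trans (cong (M *_) (square-abs j)) (sym (ℤ.pos-* m _)))

    -- At `√m` the unit equation is `2 c0 c2 = c1² + m c3²`, which is nonnegative.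
    even-part-same-sign : ∀ {x} → RelativeUnit x → SameSign (c0 x) (c2 x)
    even-part-same-sign {x} p with half-nonneg (c0 x * c2 x) (trans (move (+ 2 * (c0 x * c2 x)) (c1 x * c1 x + M * (c3 x * c3 x))
        (irrational-part {x} p)) (quadratic-form (c1 x) (c3 x)))
      where
      move : ∀ a b → a + - b ≡ 0ℤ → a ≡ b
      move a b e = ℤ.i-j≡0⇒i≡j a b e
    ... | t , e = same-sign _ _ e

    -- If `c1 c3` were negative, the equation `c0² + m c2² - 2 m c1 c3 = 1` would have left side at
    -- least `2m`.
    odd-part-same-sign : ∀ {x} → RelativeUnit x → SameSign (c1 x) (c3 x)
    odd-part-same-sign {x} p = decide (c1 x * c3 x) refl
      where
      n = ∣ c0 x ∣ ℕ.* ∣ c0 x ∣ ℕ.+ m ℕ.* (∣ c2 x ∣ ℕ.* ∣ c2 x ∣)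
      decide : ∀ z → c1 x * c3 x ≡ z → SameSign (c1 x) (c3 x)
      decide (+ t) e = same-sign _ _ e
      decide -[1+ t ] e = ⊥-elim (too-big 1<m (ℤ.+-injective (trans (sym (total m n t))
          (trans (cong₂ (λ a b → a + - (+ 2 * (M * b))) (sym (quadratic-form (c0 x) (c2 x))) (sym e)) (rational-part {x} p)))))
        where
        total : ∀ m n t → + n + - (+ 2 * (+ m * -[1+ t ])) ≡ + (n ℕ.+ 2 ℕ.* (m ℕ.* suc t))
        total m n t = cong (λ a → + n + a) (trans (trans (neg (+ m) (+ suc t)) (cong (λ a → + 2 * a) (sym (ℤ.pos-* m (suc t))))) (sym (ℤ.pos-* 2 (m ℕ.* suc t))))
          where
          neg : ∀ m s → - (+ 2 * (m * - s)) ≡ + 2 * (m * s)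
          neg = solve-∀
        too-big : 1 ℕ.< m → n ℕ.+ 2 ℕ.* (m ℕ.* suc t) ≢ 1
        too-big 1<m e = ℕ.<⇒≢ (ℕ.<-≤-trans 1<m (ℕ.≤-trans (ℕ.m≤m*n m (suc t)) (ℕ.≤-trans (ℕ.m≤n*m (m ℕ.* suc t) 2) (ℕ.m≤n+m _ n)))) (sym e)

    private
      p* : ∀ a b → + a * + b ≡ + (a ℕ.* b)
      p* a b = sym (ℤ.pos-* a b)

    mul-⟪⟫ : ∀ a b c d A B C D → mul M ⟪ a , b , c , d ⟫ ⟪ A , B , C , D ⟫ ≡
      ⟪ a ℕ.* A ℕ.+ m ℕ.* (b ℕ.* D ℕ.+ c ℕ.* C ℕ.+ d ℕ.* B)
      , a ℕ.* B ℕ.+ b ℕ.* A ℕ.+ m ℕ.* (c ℕ.* D ℕ.+ d ℕ.* C)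
      , a ℕ.* C ℕ.+ b ℕ.* B ℕ.+ c ℕ.* A ℕ.+ m ℕ.* (d ℕ.* D)
      , a ℕ.* D ℕ.+ b ℕ.* C ℕ.+ c ℕ.* B ℕ.+ d ℕ.* A ⟫
    mul-⟪⟫ a b c d A B C D = ⟨⟩-cong
      (cong₂ _+_ (p* a A) (trans (cong (M *_) (cong₂ _+_ (cong₂ _+_ (p* b D) (p* c C)) (p* d B))) (p* m _)))
      (cong₂ _+_ (cong₂ _+_ (p* a B) (p* b A)) (trans (cong (M *_) (cong₂ _+_ (p* c D) (p* d C))) (p* m _)))
      (cong₂ _+_ (cong₂ _+_ (cong₂ _+_ (p* a C) (p* b B)) (p* c A)) (trans (cong (M *_) (p* d D)) (p* m _)))
      (cong₂ _+_ (cong₂ _+_ (cong₂ _+_ (p* a D) (p* b C)) (p* c B)) (p* d A))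

    rational-part-ℕ : ∀ a b c d → RelativeUnit ⟪ a , b , c , d ⟫ → a ℕ.* a ℕ.+ m ℕ.* (c ℕ.* c) ≡ 1 ℕ.+ 2 ℕ.* (m ℕ.* (b ℕ.* d))
    rational-part-ℕ a b c d p = ℤ.+-injective (trans (sym (quadratic-form (+ a) (+ c)))
      (trans (restore _ (+ 2 * (M * (+ b * + d))) (rational-part {⟪ a , b , c , d ⟫} p))
        (cong (λ z → 1ℤ + z) (trans (cong (λ z → + 2 * z) (trans (cong (M *_) (p* b d)) (p* m _))) (p* 2 (m ℕ.* (b ℕ.* d)))))))
      where
      restore : ∀ s t → s + - t ≡ 1ℤ → s ≡ 1ℤ + t
      restore s t e = trans (eq s t) (cong (_+ t) e)
        where
        eq : ∀ s t → s ≡ s + - t + t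
        eq = solve-∀

    irrational-part-ℕ : ∀ a b c d → RelativeUnit ⟪ a , b , c , d ⟫ → 2 ℕ.* (a ℕ.* c) ≡ b ℕ.* b ℕ.+ m ℕ.* (d ℕ.* d)
    irrational-part-ℕ a b c d p = ℤ.+-injective (trans (sym (trans (cong (λ z → + 2 * z) (p* a c)) (p* 2 (a ℕ.* c))))
      (trans (ℤ.i-j≡0⇒i≡j (+ 2 * (+ a * + c)) _ (irrational-part {⟪ a , b , c , d ⟫} p)) (quadratic-form (+ b) (+ d))))

    record Fundamental (A B C D : ℕ) : Set where
      field
        unit : RelativeUnit ⟪ A , B , C , D ⟫
        1<A : 1 ℕ.< A
        0<C : 0 ℕ.< C
        small : ∀ a b c d → RelativeUnit ⟪ a , b , c , d ⟫ → m ℕ.* (c ℕ.* c) ℕ.≤ 2 ℕ.* A → c ≡ 0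

    module _ {A B C D : ℕ} (fundamental : Fundamental A B C D) where

      open Fundamental fundamental

      private
        θ : Elt
        θ = ⟪ A , B , C , D ⟫

      -- Since `σ` inverts relative units, the second alternative stands for negative exponents.
      IsPower : Elt → Set
      IsPower x = ∃ λ k → powE m θ k ≡ x ⊎ powE m θ k ≡ σ x

      power-σ : ∀ {x} → IsPower (σ x) → IsPower x
      power-σ (k , inj₁ e) = k , inj₂ e
      power-σ {x} (k , inj₂ e) = k , inj₁ (trans e (σ-involutive x))

      quotient*θ : ∀ x → mul M (mul M x (σ θ)) θ ≡ x
      quotient*θ x = trans (mul-assoc M x (σ θ) θ) (trans (cong (mul M x) (trans (mul-comm M (σ θ) θ) unit))
        (trans (mul-comm M x oneE) (mul-identityˡ M x)))

      power-quotient : ∀ x → IsPower (mul M x (σ θ)) → IsPower x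
      power-quotient x (k , inj₁ e) = suc k , inj₁ (trans (cong (mul M θ) e) (trans (mul-comm M θ _) (quotient*θ x)))
      power-quotient x (zero , inj₂ e) = 1 , inj₁ (trans (cong (mul M θ) y≡1) (trans (mul-comm M θ _) (quotient*θ x)))
        where
        y≡1 : oneE ≡ mul M x (σ θ)
        y≡1 = trans (cong σ e) (σ-involutive _)
      power-quotient x (suc k , inj₂ e) = k , inj₂ (trans (sym (quotient*σθ (powE m θ k)))
        (trans (cong (λ y → mul M y (σ θ)) e) (trans (sym (σ-mul (mul M x (σ θ)) θ)) (cong σ (quotient*θ x)))))
        where
        quotient*σθ : ∀ y → mul M (mul M θ y) (σ θ) ≡ y
        quotient*σθ y = trans (cong (λ z → mul M z (σ θ)) (mul-comm M θ y))
          (trans (mul-assoc M y θ (σ θ)) (trans (cong (mul M y) unit) (trans (mul-comm M y oneE) (mul-identityˡ M y))))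

      -- `v` is the rational coordinate of `x θ`, and `c v ≥ A a c + m c² C`. With `A ≥ 2`,
      -- `m c² > 2A` and `C > 0` this exceeds `2ac + 2AC`, so `γ ≥ c` would make the left side of
      -- the product formula too large.
      descends : ∀ {a b c d α γ} → let v = a ℕ.* A ℕ.+ m ℕ.* (b ℕ.* D ℕ.+ c ℕ.* C ℕ.+ d ℕ.* B) in
        ∀ u → α ℕ.* u ℕ.+ γ ℕ.* v ≡ 2 ℕ.* (a ℕ.* c) ℕ.+ 2 ℕ.* (A ℕ.* C) → 2 ℕ.* A ℕ.< m ℕ.* (c ℕ.* c) → γ ℕ.< c
      descends {a} {b} {c} {d} {α} {γ} u e large with γ ℕ.<? c
      ... | yes γ<c = γ<c
      ... | no γ≮c = ⊥-elim (ℕ.<⇒≢ (ℕ.<-≤-trans (ℕ.+-mono-≤-< first second) (ℕ.≤-trans lower (ℕ.m≤n+m _ (α ℕ.* u)))) (sym e))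
        where
        first : 2 ℕ.* (a ℕ.* c) ℕ.≤ A ℕ.* (a ℕ.* c)
        first = ℕ.*-monoˡ-≤ (a ℕ.* c) 1<A
        second : 2 ℕ.* (A ℕ.* C) ℕ.< m ℕ.* (c ℕ.* c) ℕ.* C
        second = subst (ℕ._< m ℕ.* (c ℕ.* c) ℕ.* C) (ℕ.*-assoc 2 A C) (ℕ.*-monoˡ-< C {{ℕ.>-nonZero 0<C}} large)
        regroup : ∀ a b c d → c ℕ.* (a ℕ.* A ℕ.+ m ℕ.* (b ℕ.* D ℕ.+ c ℕ.* C ℕ.+ d ℕ.* B))
          ≡ A ℕ.* (a ℕ.* c) ℕ.+ m ℕ.* (c ℕ.* c) ℕ.* C ℕ.+ c ℕ.* (m ℕ.* (b ℕ.* D ℕ.+ d ℕ.* B))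
        regroup a b c d = identity a b c d A B C D m
          where
          identity : ∀ a b c d A B C D m → c ℕ.* (a ℕ.* A ℕ.+ m ℕ.* (b ℕ.* D ℕ.+ c ℕ.* C ℕ.+ d ℕ.* B))
            ≡ A ℕ.* (a ℕ.* c) ℕ.+ m ℕ.* (c ℕ.* c) ℕ.* C ℕ.+ c ℕ.* (m ℕ.* (b ℕ.* D ℕ.+ d ℕ.* B))
          identity = ℕ.solve-∀
        lower : A ℕ.* (a ℕ.* c) ℕ.+ m ℕ.* (c ℕ.* c) ℕ.* C ℕ.≤ γ ℕ.* (a ℕ.* A ℕ.+ m ℕ.* (b ℕ.* D ℕ.+ c ℕ.* C ℕ.+ d ℕ.* B))
        lower = ℕ.≤-trans (ℕ.m≤m+n _ _) (ℕ.≤-trans (ℕ.≤-reflexive (sym (regroup a b c d))) (ℕ.*-monoˡ-≤ _ (ℕ.≮⇒≥ γ≮c)))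

      -- For `c = 0` the irrational part gives `b² + m d² = 0`, and then the rational part gives
      -- `a² = 1`.
      trivial-unit : ∀ a b d → RelativeUnit ⟪ a , b , 0 , d ⟫ → oneE ≡ ⟪ a , b , 0 , d ⟫
      trivial-unit a b d p = ⟨⟩-cong (cong +_ (sym a≡1)) (cong +_ (sym b≡0)) refl (cong +_ (sym d≡0))
        where
        squares≡0 : b ℕ.* b ℕ.+ m ℕ.* (d ℕ.* d) ≡ 0
        squares≡0 = trans (sym (irrational-part-ℕ a b 0 d p)) (cong (2 ℕ.*_) (ℕ.*-zeroʳ a))
        b≡0 : b ≡ 0
        b≡0 with ℕ.m*n≡0⇒m≡0∨n≡0 b (ℕ.m+n≡0⇒m≡0 (b ℕ.* b) squares≡0)
        ... | inj₁ e = e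
        ... | inj₂ e = e
        d≡0 : d ≡ 0
        d≡0 with ℕ.m*n≡0⇒m≡0∨n≡0 m (ℕ.m+n≡0⇒n≡0 (b ℕ.* b) squares≡0)
        ... | inj₁ e = ⊥-elim (ℕ.<⇒≢ (ℕ.<-trans (ℕ.s≤s ℕ.z≤n) 1<m) (sym e))
        ... | inj₂ e with ℕ.m*n≡0⇒m≡0∨n≡0 d e
        ...   | inj₁ e = e
        ...   | inj₂ e = e
        a²≡1 : a ℕ.* a ≡ 1
        a²≡1 = trans (sym (trans (cong (a ℕ.* a ℕ.+_) (ℕ.*-zeroʳ m)) (ℕ.+-identityʳ _))) (trans (rational-part-ℕ a b 0 d p)
          (cong (λ n → 1 ℕ.+ 2 ℕ.* n) (trans (cong (λ n → m ℕ.* (n ℕ.* d)) b≡0) (ℕ.*-zeroʳ m))))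
        a≡1 : a ≡ 1
        a≡1 = ℕ.m*n≡1⇒m≡1 a a a²≡1

      -- Divide by `θ`. The even part of the quotient stays nonnegative and has a smaller coordinate
      -- `c`; its odd part may turn negative, and then the induction is applied to the conjugate.
      units-are-powers : ∀ a b c d → Acc ℕ._<_ c → RelativeUnit ⟪ a , b , c , d ⟫ → IsPower ⟪ a , b , c , d ⟫
      units-are-powers a b c d (acc rec) p with 2 ℕ.* A ℕ.<? m ℕ.* (c ℕ.* c)
      ... | no small-c = 0 , inj₁ (trans (trivial-unit a b d (subst (λ c → RelativeUnit ⟪ a , b , c , d ⟫) c≡0 p))
                                    (cong (λ c → ⟪ a , b , c , d ⟫) (sym c≡0)))
        where
        c≡0 : c ≡ 0
        c≡0 = small a b c d p (ℕ.≮⇒≥ small-c)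
      ... | yes large = power-quotient x (conclude (both-nonneg _ _ product (even-part-same-sign {y} y-unit)) (odd-part-same-sign {y} y-unit))
        where
        x y : Elt
        x = ⟪ a , b , c , d ⟫
        y = mul M x (σ θ)
        u v n : ℕ
        u = a ℕ.* C ℕ.+ b ℕ.* B ℕ.+ c ℕ.* A ℕ.+ m ℕ.* (d ℕ.* D)
        v = a ℕ.* A ℕ.+ m ℕ.* (b ℕ.* D ℕ.+ c ℕ.* C ℕ.+ d ℕ.* B)
        n = 2 ℕ.* (a ℕ.* c) ℕ.+ 2 ℕ.* (A ℕ.* C)
        y-unit : RelativeUnit y
        y-unit = unit-mul {x} {σ θ} p (unit-σ {θ} unit)
        n≢0 : n ≢ 0
        n≢0 n≡0 = ℕ.<⇒≢ (ℕ.*-mono-< (ℕ.<-trans (ℕ.s≤s ℕ.z≤n) 1<A) 0<C) (sym (ℕ.m+n≡0⇒m≡0 (A ℕ.* C) (ℕ.m+n≡0⇒n≡0 (2 ℕ.* (a ℕ.* c)) n≡0)))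
        product-n : c0 y * + u + c2 y * + v ≡ + n
        product-n = trans (cong₂ (λ s t → c0 y * s + c2 y * t) (sym (cong c2 (mul-⟪⟫ a b c d A B C D))) (sym (cong c0 (mul-⟪⟫ a b c d A B C D))))
          (trans (cosh-product {x} {θ} p unit)
            (cong₂ _+_ (trans (cong (λ z → + 2 * z) (p* a c)) (p* 2 (a ℕ.* c))) (trans (cong (λ z → + 2 * z) (p* A C)) (p* 2 (A ℕ.* C)))))
        product : c0 y * + u + c2 y * + v ≡ + suc (ℕ.pred n)
        product = trans product-n (cong +_ (sym (ℕ.suc-pred n {{ℕ.≢-nonZero n≢0}})))
        conclude : (∃₂ λ α γ → c0 y ≡ + α × c2 y ≡ + γ) → SameSign (c1 y) (c3 y) → IsPower y
        conclude (α , γ , y₀ , y₂) = λ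
          { (inj₁ (β , δ , y₁ , y₃)) → natural β δ (⟨⟩-cong y₀ y₁ y₂ y₃) y-unit
          ; (inj₂ (β , δ , y₁ , y₃)) → power-σ (natural β δ (⟨⟩-cong y₀ (negate y₁) y₂ (negate y₃)) (unit-σ {y} y-unit)) }
          where
          negate : ∀ {i k} → i ≡ - + k → - i ≡ + k
          negate {k = k} e = trans (cong -_ e) (ℤ.neg-involutive (+ k))
          γ<c : γ ℕ.< c
          γ<c = descends {a} {b} {c} {d} {α} {γ} u (ℤ.+-injective (trans (sym (cong₂ _+_ (p* α u) (p* γ v)))
            (trans (cong₂ (λ s t → s * + u + t * + v) (sym y₀) (sym y₂)) product-n))) large
          natural : ∀ {z} β δ → z ≡ ⟪ α , β , γ , δ ⟫ → RelativeUnit z → IsPower z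
          natural β δ refl q = units-are-powers α β γ δ (rec γ<c) q

-- Exhaustive search for small relative units.

module UnitSearch where

  open FourthPowers
  open LocalTests
  open LocalObstructions
  open Conjugation
  open UnitGroup
  open import Data.Nat as ℕ using (ℕ; zero; suc)
  import Data.Nat.Properties as ℕ
  open import Data.Nat.DivMod using ([m+kn]%n≡m%n)
  open import Data.Integer using (+_; _+_; _*_)
  open import Data.Integer.Tactic.RingSolver using (solve-∀)
  import Data.Nat.Tactic.RingSolver as ℕ
  open import Data.Bool using (Bool; T; not; _∧_)
  open import Data.Bool.ListAction using (any)
  open import Data.List using (downFrom)
  open import Data.List.Membership.Propositional.Properties using (∈-downFrom⁺)
  open import Data.Product using (_,_)
  open import Data.Sum using (inj₁; inj₂)
  open import Data.Empty using (⊥-elim)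
  open import Relation.Nullary using (yes; no)
  open import Relation.Binary.PropositionalEquality using (_≡_; _≢_; refl; sym; trans; cong)

  2xy≤x²+y² : ∀ x y → 2 ℕ.* (x ℕ.* y) ℕ.≤ x ℕ.* x ℕ.+ y ℕ.* y
  2xy≤x²+y² x y with ℕ.≤-total x y
  ... | inj₁ x≤y with ℕ.m≤n⇒∃[o]m+o≡n x≤y
  ...   | k , refl = ℕ.≤-trans (ℕ.m≤m+n _ (k ℕ.* k)) (ℕ.≤-reflexive (eq x k))
    where
    eq : ∀ x k → 2 ℕ.* (x ℕ.* (x ℕ.+ k)) ℕ.+ k ℕ.* k ≡ x ℕ.* x ℕ.+ (x ℕ.+ k) ℕ.* (x ℕ.+ k)
    eq = ℕ.solve-∀
  2xy≤x²+y² x y | inj₂ y≤x with ℕ.m≤n⇒∃[o]m+o≡n y≤x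
  ...   | k , refl = ℕ.≤-trans (ℕ.m≤m+n _ (k ℕ.* k)) (ℕ.≤-reflexive (eq y k))
    where
    eq : ∀ y k → 2 ℕ.* ((y ℕ.+ k) ℕ.* y) ℕ.+ k ℕ.* k ≡ (y ℕ.+ k) ℕ.* (y ℕ.+ k) ℕ.+ y ℕ.* y
    eq = ℕ.solve-∀

  square≤⇒≤ : ∀ x y → x ℕ.* x ℕ.≤ y ℕ.* x → x ℕ.≤ y
  square≤⇒≤ zero y _ = ℕ.z≤n
  square≤⇒≤ x@(suc _) y h = ℕ.*-cancelʳ-≤ x y x h

  square≤square⇒≤ : ∀ {x y} → x ℕ.* x ℕ.≤ y ℕ.* y → x ℕ.≤ y
  square≤square⇒≤ {x} {y} h with x ℕ.≤? y
  ... | yes x≤y = x≤y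
  ... | no x≰y = ⊥-elim (ℕ.<⇒≱ (ℕ.*-mono-< (ℕ.≰⇒> x≰y) (ℕ.≰⇒> x≰y)) h)

  module SmallUnits (m g : ℕ) (1<m : 1 ℕ.< m) (m≤g² : m ℕ.≤ g ℕ.* g) where

    open RelativeUnits (+ m)
    open UnitDescent m 1<m

    private
      g≢0 : g ≢ 0
      g≢0 refl = ℕ.<⇒≱ 1<m (ℕ.≤-trans m≤g² ℕ.z≤n)

    -- The inequality `2√m b d ≤ b² + m d²` multiplied by `√m`, with the integer `g ≥ √m` in place
    -- of `√m` on the right.
    am-gm : ∀ b d → 2 ℕ.* (m ℕ.* (b ℕ.* d)) ℕ.≤ g ℕ.* (b ℕ.* b ℕ.+ m ℕ.* (d ℕ.* d))
    am-gm b d = ℕ.*-cancelˡ-≤ g {{ℕ.≢-nonZero g≢0}} (begin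
      g ℕ.* (2 ℕ.* (m ℕ.* (b ℕ.* d))) ≡⟨ eq₁ g m b d ⟩
      m ℕ.* (2 ℕ.* (b ℕ.* (g ℕ.* d))) ≤⟨ ℕ.*-monoʳ-≤ m (2xy≤x²+y² b (g ℕ.* d)) ⟩
      m ℕ.* (b ℕ.* b ℕ.+ g ℕ.* d ℕ.* (g ℕ.* d)) ≡⟨ eq₂ g m b d ⟩
      m ℕ.* (b ℕ.* b) ℕ.+ g ℕ.* g ℕ.* (m ℕ.* (d ℕ.* d)) ≤⟨ ℕ.+-monoˡ-≤ _ (ℕ.*-monoˡ-≤ (b ℕ.* b) m≤g²) ⟩
      g ℕ.* g ℕ.* (b ℕ.* b) ℕ.+ g ℕ.* g ℕ.* (m ℕ.* (d ℕ.* d)) ≡⟨ eq₃ g m b d ⟩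
      g ℕ.* (g ℕ.* (b ℕ.* b ℕ.+ m ℕ.* (d ℕ.* d))) ∎)
      where
      open ℕ.≤-Reasoning
      eq₁ : ∀ g m b d → g ℕ.* (2 ℕ.* (m ℕ.* (b ℕ.* d))) ≡ m ℕ.* (2 ℕ.* (b ℕ.* (g ℕ.* d)))
      eq₁ = ℕ.solve-∀
      eq₂ : ∀ g m b d → m ℕ.* (b ℕ.* b ℕ.+ g ℕ.* d ℕ.* (g ℕ.* d)) ≡ m ℕ.* (b ℕ.* b) ℕ.+ g ℕ.* g ℕ.* (m ℕ.* (d ℕ.* d))
      eq₂ = ℕ.solve-∀
      eq₃ : ∀ g m b d → g ℕ.* g ℕ.* (b ℕ.* b) ℕ.+ g ℕ.* g ℕ.* (m ℕ.* (d ℕ.* d)) ≡ g ℕ.* (g ℕ.* (b ℕ.* b ℕ.+ m ℕ.* (d ℕ.* d)))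
      eq₃ = ℕ.solve-∀

    isUnitᵇ : ℕ → ℕ → ℕ → ℕ → Bool
    isUnitᵇ a b c d = (b ℕ.* b ℕ.+ m ℕ.* (d ℕ.* d) ℕ.≡ᵇ 2 ℕ.* (a ℕ.* c))
      ∧ (a ℕ.* a ℕ.+ m ℕ.* (c ℕ.* c) ℕ.≡ᵇ 1 ℕ.+ 2 ℕ.* (m ℕ.* (b ℕ.* d)))

    -- The rational part of the unit equation forces this congruence modulo `2m`; it discards values
    -- of `a` before `d` and `b` are searched.
    unitWith : ℕ → ℕ → Bool
    unitWith c a = cong-mod (2 ℕ.* m) (a ℕ.* a ℕ.+ m ℕ.* (c ℕ.* c)) 1
      ∧ any (λ d → (m ℕ.* (d ℕ.* d) ℕ.≤ᵇ 2 ℕ.* (a ℕ.* c)) ∧ any (λ b → isUnitᵇ a b c d) (downFrom (suc (a ℕ.+ c)))) (downFrom (suc (a ℕ.+ c)))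

    smallUnits : ℕ → Bool
    smallUnits K = any (λ c′ → any (unitWith (suc c′)) (downFrom (suc (2 ℕ.* g ℕ.* suc c′)))) (downFrom K)

    -- For `c > 0`, `a² ≤ 2mbd ≤ g (b² + m d²) = 2gac`, hence `a ≤ 2gc`. Both `b²` and `m d²` are at
    -- most `2ac ≤ (a + c)²`, which bounds `b` and `d` by `a + c`.
    smallUnits-complete : ∀ K → T (not (smallUnits K)) → ∀ a b c d → RelativeUnit ⟪ a , b , c , d ⟫ → c ℕ.≤ K → c ≡ 0
    smallUnits-complete K none a b zero d p c≤K = refl
    smallUnits-complete K none a b c@(suc c′) d p c≤K = ⊥-elim (T-contra {smallUnits K}
      (T-any _ {c′} (∈-downFrom⁺ c≤K) (T-any (unitWith c) (∈-downFrom⁺ (ℕ.s≤s a≤))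
        (T-and (≡⇒T cong-1) (T-any _ {d} (∈-downFrom⁺ (ℕ.s≤s d≤)) (T-and (ℕ.≤⇒≤ᵇ md²≤)
          (T-any _ {b} (∈-downFrom⁺ (ℕ.s≤s b≤)) (T-and (≡⇒T (sym irr)) (≡⇒T rat)))))))) none)
      where
      ≡⇒T : ∀ {x y} → x ≡ y → T (x ℕ.≡ᵇ y)
      ≡⇒T = ℕ.≡⇒≡ᵇ _ _
      rat = rational-part-ℕ a b c d p
      irr = irrational-part-ℕ a b c d p
      cong-1 : rem (a ℕ.* a ℕ.+ m ℕ.* (c ℕ.* c)) (2 ℕ.* m) ≡ rem 1 (2 ℕ.* m)
      cong-1 = trans (cong (λ n → rem n (2 ℕ.* m)) (trans rat (cong (1 ℕ.+_) (eq m b d)))) (rem-multiple 1 (b ℕ.* d) (2 ℕ.* m))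
        where
        eq : ∀ m b d → 2 ℕ.* (m ℕ.* (b ℕ.* d)) ≡ b ℕ.* d ℕ.* (2 ℕ.* m)
        eq = ℕ.solve-∀
        rem-multiple : ∀ x k q → rem (x ℕ.+ k ℕ.* q) q ≡ rem x q
        rem-multiple x k zero = trans (cong (x ℕ.+_) (ℕ.*-zeroʳ k)) (ℕ.+-identityʳ x)
        rem-multiple x k q@(suc _) = [m+kn]%n≡m%n x k q
      md²≤ : m ℕ.* (d ℕ.* d) ℕ.≤ 2 ℕ.* (a ℕ.* c)
      md²≤ = ℕ.≤-trans (ℕ.m≤n+m _ (b ℕ.* b)) (ℕ.≤-reflexive (sym irr))
      sum-bound : ∀ {x} → x ℕ.* x ℕ.≤ 2 ℕ.* (a ℕ.* c) → x ℕ.≤ a ℕ.+ c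
      sum-bound h = square≤square⇒≤ (ℕ.≤-trans h (ℕ.≤-trans (ℕ.m≤m+n _ _) (ℕ.≤-reflexive (eq a c))))
        where
        eq : ∀ a c → 2 ℕ.* (a ℕ.* c) ℕ.+ (a ℕ.* a ℕ.+ c ℕ.* c) ≡ (a ℕ.+ c) ℕ.* (a ℕ.+ c)
        eq = ℕ.solve-∀
      b≤ : b ℕ.≤ a ℕ.+ c
      b≤ = sum-bound (ℕ.≤-trans (ℕ.m≤m+n _ _) (ℕ.≤-reflexive (sym irr)))
      d≤ : d ℕ.≤ a ℕ.+ c
      d≤ = sum-bound (ℕ.≤-trans (ℕ.m≤n*m (d ℕ.* d) m {{ℕ.>-nonZero (ℕ.<-trans (ℕ.s≤s ℕ.z≤n) 1<m)}}) md²≤)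
      a≤ : a ℕ.≤ 2 ℕ.* g ℕ.* c
      a≤ = square≤⇒≤ a (2 ℕ.* g ℕ.* c) (begin
        a ℕ.* a ≤⟨ ℕ.+-cancelˡ-≤ 1 _ _ (ℕ.≤-trans (ℕ.≤-reflexive (ℕ.+-comm 1 (a ℕ.* a)))
                     (ℕ.≤-trans (ℕ.+-monoʳ-≤ (a ℕ.* a) (ℕ.*-mono-≤ (ℕ.<⇒≤ 1<m) (ℕ.s≤s {0} ℕ.z≤n))) (ℕ.≤-reflexive rat))) ⟩
        2 ℕ.* (m ℕ.* (b ℕ.* d)) ≤⟨ am-gm b d ⟩
        g ℕ.* (b ℕ.* b ℕ.+ m ℕ.* (d ℕ.* d)) ≡⟨ cong (g ℕ.*_) (sym irr) ⟩
        g ℕ.* (2 ℕ.* (a ℕ.* c)) ≡⟨ eq g a c ⟩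
        2 ℕ.* g ℕ.* c ℕ.* a ∎)
        where
        open ℕ.≤-Reasoning
        eq : ∀ g a c → g ℕ.* (2 ℕ.* (a ℕ.* c)) ≡ 2 ℕ.* g ℕ.* c ℕ.* a
        eq = ℕ.solve-∀

-- Relative units attached to solutions of the Thue equations.

module ThueUnits where

  open FourthPowers
  open LocalTests
  open QuarticRing
  open Binomial
  open PAdicUniqueness
  open Conjugation
  open UnitGroup
  open import Algebra.Bundles using (CommutativeRing)
  open import Data.Nat as ℕ using (ℕ; zero; suc)
  import Data.Nat.Properties as ℕ
  open import Data.Nat.DivMod using ([m+kn]%n≡m%n)
  open import Data.Integer using (ℤ; +_; -[1+_]; -_; _+_; _*_; 0ℤ; 1ℤ)
  import Data.Integer.Properties as ℤ
  open import Data.Integer.Tactic.RingSolver using (solve-∀)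
  open import Data.Product using (∃; ∃₂; _×_; _,_)
  open import Relation.Binary.PropositionalEquality using (_≡_; refl; sym; trans; cong; cong₂; subst)

  -- (a² + b²√m)² + 2 a b (a² + b²√m) α = ± (a + bα) / (a - bα) if a⁴ - m b⁴ = ±1.
  relativeUnit : ℕ → ℕ → ℕ → Elt
  relativeUnit m a b = ⟪ a ⁴ ℕ.+ m ℕ.* b ⁴ , 2 ℕ.* (a ℕ.* a ℕ.* (a ℕ.* b)) , 2 ℕ.* (a ℕ.* a ℕ.* (b ℕ.* b)) , 2 ℕ.* (a ℕ.* b ℕ.* (b ℕ.* b)) ⟫

  -- `e` and `f` carry the sign within ℕ: `(e, f) = (0, 1)` stands for `a⁴ - m b⁴ = 1` and `(1, 0)`
  -- for `-1`.
  unit-difference : ∀ {m e f} → (+ f + - + e) * (+ f + - + e) ≡ 1ℤ → ∀ {a b} → a ⁴ ℕ.+ e ≡ m ℕ.* b ⁴ ℕ.+ f →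
    (+ (a ⁴) + - (+ m * + (b ⁴))) * (+ (a ⁴) + - (+ m * + (b ⁴))) ≡ 1ℤ
  unit-difference {m} {e} {f} δ²≡1 {a} {b} eq = trans (cong (λ z → z * z) (trans (sym (shift (+ (a ⁴)) (+ m * + (b ⁴)) (+ e)))
    (trans (cong (λ z → z + - + e + - (+ m * + (b ⁴))) (trans (cong +_ eq) (cong (_+ + f) (ℤ.pos-* m (b ⁴))))) (collapse (+ m * + (b ⁴)) (+ e) (+ f))))) δ²≡1
    where
    shift : ∀ a b e → a + e + - e + - b ≡ a + - b
    shift = solve-∀
    collapse : ∀ b e f → b + f + - e + - b ≡ f + - e
    collapse = solve-∀

  module _ (m : ℕ) where

    open RelativeUnits (+ m)

    private
      relativeUnitℤ : ℤ → ℤ → Elt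
      relativeUnitℤ a b = ⟨ a * a * (a * a) + + m * (b * b * (b * b)) , + 2 * (a * a * (a * b)) , + 2 * (a * a * (b * b)) , + 2 * (a * b * (b * b)) ⟩

      p* : ∀ a b → + a * + b ≡ + (a ℕ.* b)
      p* a b = sym (ℤ.pos-* a b)

      p** : ∀ a b c d → + a * + b * (+ c * + d) ≡ + (a ℕ.* b ℕ.* (c ℕ.* d))
      p** a b c d = trans (cong₂ _*_ (p* a b) (p* c d)) (p* (a ℕ.* b) (c ℕ.* d))

      cast : ∀ a b → relativeUnitℤ (+ a) (+ b) ≡ relativeUnit m a b
      cast a b = ⟨⟩-cong
        (cong₂ _+_ (p** a a a a) (trans (cong (+ m *_) (p** b b b b)) (p* m (b ⁴))))
        (trans (cong (λ z → + 2 * z) (p** a a a b)) (p* 2 (a ℕ.* a ℕ.* (a ℕ.* b))))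
        (trans (cong (λ z → + 2 * z) (p** a a b b)) (p* 2 (a ℕ.* a ℕ.* (b ℕ.* b))))
        (trans (cong (λ z → + 2 * z) (p** a b b b)) (p* 2 (a ℕ.* b ℕ.* (b ℕ.* b))))

    -- The element is `(a + bα)² (a² + b²√m)`. Its relative norm is
    -- `(a² - b²√m)² (a² + b²√m)² = δ²`, and its even part `(a² + b²√m)²` has norm `δ²` as well.
    relativeUnit-norms : ∀ a b → let δ = + (a ⁴) + - (+ m * + (b ⁴)) in δ * δ ≡ 1ℤ →
      RelativeUnit (relativeUnit m a b) × norm (+ m) (relativeUnit m a b) ≡ 1ℤ
    relativeUnit-norms a b δ²≡1 = subst (λ x → RelativeUnit x × norm (+ m) x ≡ 1ℤ) (cast a b)
      ( ⟨⟩-cong (trans (e₀ (+ m) (+ a) (+ b)) δ²≡1′) (e₁ (+ m) (+ a) (+ b)) (e₂ (+ m) (+ a) (+ b)) (e₃ (+ m) (+ a) (+ b))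
      , trans (e₄ (+ m) (+ a) (+ b)) δ²≡1′)
      where
      δ²≡1′ : let δ = + a * + a * (+ a * + a) + - (+ m * (+ b * + b * (+ b * + b))) in δ * δ ≡ 1ℤ
      δ²≡1′ = trans (cong₂ (λ x y → (x + - (+ m * y)) * (x + - (+ m * y))) (p** a a a a) (p** b b b b)) δ²≡1
      e₀ : ∀ M a b → let A = a * a * (a * a) + M * (b * b * (b * b)) ; B = + 2 * (a * a * (a * b)) ; C = + 2 * (a * a * (b * b)) ; D = + 2 * (a * b * (b * b)) in
        A * A + M * (B * - D + C * C + D * - B) ≡ (a * a * (a * a) + - (M * (b * b * (b * b)))) * (a * a * (a * a) + - (M * (b * b * (b * b))))
      e₀ = solve-∀
      e₁ : ∀ M a b → let A = a * a * (a * a) + M * (b * b * (b * b)) ; B = + 2 * (a * a * (a * b)) ; C = + 2 * (a * a * (b * b)) ; D = + 2 * (a * b * (b * b)) in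
        A * - B + B * A + M * (C * - D + D * C) ≡ 0ℤ
      e₁ = solve-∀
      e₂ : ∀ M a b → let A = a * a * (a * a) + M * (b * b * (b * b)) ; B = + 2 * (a * a * (a * b)) ; C = + 2 * (a * a * (b * b)) ; D = + 2 * (a * b * (b * b)) in
        A * C + B * - B + C * A + M * (D * - D) ≡ 0ℤ
      e₂ = solve-∀
      e₃ : ∀ M a b → let A = a * a * (a * a) + M * (b * b * (b * b)) ; B = + 2 * (a * a * (a * b)) ; C = + 2 * (a * a * (b * b)) ; D = + 2 * (a * b * (b * b)) in
        A * - D + B * C + C * - B + D * A ≡ 0ℤ
      e₃ = solve-∀
      e₄ : ∀ M a b → let A = a * a * (a * a) + M * (b * b * (b * b)) ; C = + 2 * (a * a * (b * b)) in
        A * A + - (M * (C * C)) ≡ (a * a * (a * a) + - (M * (b * b * (b * b)))) * (a * a * (a * a) + - (M * (b * b * (b * b))))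
      e₄ = solve-∀

  rem-shift : ∀ p {x y} t → + x ≡ + y + + p * t → rem x p ≡ rem y p
  rem-shift zero t e = ℤ.+-injective (trans e (ℤ.+-identityʳ _))
  rem-shift p@(suc _) {x} {y} (+ t) e = trans (cong (λ n → rem n p) x≡) ([m+kn]%n≡m%n y t p)
    where
    x≡ : x ≡ y ℕ.+ t ℕ.* p
    x≡ = ℤ.+-injective (trans e (cong (λ z → + y + z) (trans (sym (ℤ.pos-* p t)) (cong +_ (ℕ.*-comm p t)))))
  rem-shift p@(suc _) {x} {y} t@(-[1+ n ]) e = sym (trans (cong (λ n → rem n p) y≡) ([m+kn]%n≡m%n x (suc n) p))
    where
    cancel-shift : ∀ y p t → y ≡ y + p * - t + t * p
    cancel-shift = solve-∀
    y≡ : y ≡ x ℕ.+ suc n ℕ.* p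
    y≡ = ℤ.+-injective (trans (cancel-shift (+ y) (+ p) (+ suc n)) (cong₂ _+_ (sym e) (sym (ℤ.pos-* (suc n) p))))

  module Powers (m : ℕ) where

    private
      M = + m
      module R = CommutativeRing (EltRing M)

    open import Algebra.Properties.Semiring.Exp R.semiring using (_^_; ^-homo-*; ^-assocʳ)

    powE≡^ : ∀ x k → powE m x k ≡ x ^ k
    powE≡^ x zero = refl
    powE≡^ x (suc k) = cong (mul M x) (powE≡^ x k)

    split-power : ∀ x L s j → powE m x (j ℕ.+ s ℕ.* L) ≡ mul M (powE m x j) (powE m x L ^ s)
    split-power x L s j = trans (powE≡^ x (j ℕ.+ s ℕ.* L)) (trans (^-homo-* x j (s ℕ.* L))
      (cong₂ (mul M) (sym (powE≡^ x j)) (trans (cong (x ^_) (ℕ.*-comm s L)) (trans (sym (^-assocʳ x L s)) (cong (_^ s) (sym (powE≡^ x L)))))))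

    open BinomialExpansion R.commutativeSemiring using (zeroth-order)

    residue-of-power : ∀ g p z s → let x = mul M g (addE oneE (mul M (scalar (+ p)) z) ^ s) in
      ∃ λ w → c0 x ≡ c0 g + + p * c0 w × c2 x ≡ c2 g + + p * c2 w
    residue-of-power g p z s with zeroth-order g (scalar (+ p)) z s
    ... | w , e = w , trans (cong c0 e) (cong (λ y → c0 g + c0 y) (mul-scalar M (+ p) w))
                    , trans (cong c2 e) (cong (λ y → c2 g + c2 y) (mul-scalar M (+ p) w))

    -- The sieve compares absolute values of coordinates; for powers of `θ` these are the
    -- coordinates themselves.
    power-nonneg : ∀ {A B C D} → 1 ℕ.< m → ∀ k → ∃₂ λ a b → ∃₂ λ c d → powE m ⟪ A , B , C , D ⟫ k ≡ ⟪ a , b , c , d ⟫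
    power-nonneg 1<m zero = 1 , 0 , 0 , 0 , refl
    power-nonneg {A} {B} {C} {D} 1<m (suc k) with power-nonneg {A} {B} {C} {D} 1<m k
    ... | a , b , c , d , e = _ , _ , _ , _ , trans (cong (mul M ⟪ A , B , C , D ⟫) e) (UnitDescent.mul-⟪⟫ m 1<m A B C D a b c d)

-- Skolem's method: one prime determines the exponent.

module Skolem where

  open FourthPowers
  open LocalTests
  open LocalObstructions
  open QuarticRing
  open Binomial
  open PAdicUniqueness
  open Conjugation
  open UnitGroup
  open UnitSearch
  open ThueUnits
  open import Algebra.Bundles using (CommutativeRing)
  open import Data.Nat as ℕ using (ℕ; suc)
  import Data.Nat.Properties as ℕ
  open import Data.Nat.DivMod using (m≡m%n+[m/n]*n; m%n<n)
  open import Data.Nat.Divisibility using (m%n≡0⇒n∣m)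
  open import Data.Nat.Induction using (<-wellFounded)
  open import Data.Integer using (ℤ; +_; -_; _+_; _*_; 1ℤ; ∣_∣)
  import Data.Integer.Properties as ℤ
  import Data.Nat.Tactic.RingSolver as ℕ
  import Data.Integer.Divisibility.Signed as Signed
  open import Data.Integer.Tactic.RingSolver using (solve-∀)
  open import Data.Bool using (Bool; true; T; not; _∧_; _∨_)
  open import Data.Bool.ListAction using (all)
  open import Data.List using (List; downFrom)
  open import Data.List.Membership.Propositional.Properties using (∈-downFrom⁺)
  open import Data.Product using (∃; _×_; _,_; proj₁; proj₂)
  open import Data.Sum using (_⊎_; inj₁; inj₂)
  open import Data.Empty using (⊥-elim)
  open import Relation.Nullary using (yes; no)
  open import Relation.Binary.PropositionalEquality using (_≡_; _≢_; refl; sym; trans; cong; cong₂; subst)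

  -- The candidate for `(x - 1) / p`. That the truncating divisions are exact is certified by
  -- `period`.
  quotient-by : ℕ → Elt → Elt
  quotient-by p x = ⟪ quot (∣ c0 x ∣ ℕ.∸ 1) p , quot ∣ c1 x ∣ p , quot ∣ c2 x ∣ p , quot ∣ c3 x ∣ p ⟫

  matches : ℕ → Elt → ℕ → ℕ → Bool
  matches p y u v = (cong-mod p ∣ c0 y ∣ u) ∧ (cong-mod p ∣ c2 y ∣ v)

  -- Here x and y run through the residues of a² and b².
  sieve : (m e f p L : ℕ) → (ℕ → Bool) → Elt → Bool
  sieve m e f p L extra θ =
    all (λ x → not (extra x) ∨ all (λ y → not (cong-mod p (x ℕ.* x ℕ.+ e) (m ℕ.* (y ℕ.* y) ℕ.+ f))
      ∨ all (λ k → (k ℕ.≡ᵇ 1) ∨ (suc k ℕ.≡ᵇ L)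
          ∨ not (matches p (powE m θ k) (x ℕ.* x ℕ.+ m ℕ.* (y ℕ.* y)) (2 ℕ.* (x ℕ.* y))))
        (downFrom L)) squares) squares
    where
    squares : List ℕ
    squares = residues p (λ x → x ℕ.* x)

  -- `bound` and `none` supply the field `small` of `Fundamental`. `extra` is a condition on `a²`
  -- modulo `p`; for the sign `+1` it has to exclude `(1, 0)`, whose exponent 0 lies outside the
  -- classes of `±1` and would otherwise survive the sieve.
  record Certificate (m e f a₀ b₀ p : ℕ) (extra : ℕ → Bool) : Set where
    private
      M = + m
      θ = relativeUnit m a₀ b₀
    -- L is the order of θ modulo p.
    field
      h L g K : ℕ
      I : ℤ
      1<m : 1 ℕ.< m
      opposite : (+ f + - + e) * (+ f + - + e) ≡ 1ℤ
      solution : a₀ ⁴ ℕ.+ e ≡ m ℕ.* b₀ ⁴ ℕ.+ f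
      positive : 0 ℕ.< a₀ × 0 ℕ.< b₀
      m≤g² : m ℕ.≤ g ℕ.* g
      bound : 2 ℕ.* (a₀ ⁴ ℕ.+ m ℕ.* b₀ ⁴) ℕ.< m ℕ.* (suc K ℕ.* suc K)
      none : T (not (SmallUnits.smallUnits m g 1<m m≤g² K))
      1<p : 1 ℕ.< p
      1<L : 1 ℕ.< L
      triangle≡ : triangle p ≡ p ℕ.* h
    z : Elt
    z = quotient-by p (powE m θ L)
    field
      period : powE m θ L ≡ addE oneE (mul M (scalar (+ p)) z)
      slope⁺ : rem ∣ slope M θ (mul M θ z) * I + - 1ℤ ∣ p ≡ 0
      -- The norm of the even part of `θᵏ` is an even function of `k`, because `σ` fixes that part.
      -- Its derivatives at `1` and `-1` are opposite, hence the inverse `- I`.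
      slope⁻ : rem ∣ slope M (σ θ) (mul M (σ θ) z) * - I + - 1ℤ ∣ p ≡ 0
      sieved : T (sieve m e f p L extra θ)

  private
    solve-lemma : ∀ {s p} E → s + - 1ℤ ≡ E * p → s ≡ 1ℤ + p * E
    solve-lemma {s} {p} E e = trans (eq s) (trans (cong (λ x → 1ℤ + x) e) (cong (λ x → 1ℤ + x) (ℤ.*-comm E p)))
      where
      eq : ∀ s → s ≡ 1ℤ + (s + - 1ℤ)
      eq = solve-∀

  rem≡0⇒ : ∀ p .{{_ : ℕ.NonZero p}} s → rem ∣ s + - 1ℤ ∣ p ≡ 0 → ∃ λ E → s ≡ 1ℤ + + p * E
  rem≡0⇒ p@(suc _) s e with Signed.∣ᵤ⇒∣ {+ p} {s + - 1ℤ} (m%n≡0⇒n∣m ∣ s + - 1ℤ ∣ p e)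
  ... | Signed.divides E eq = E , solve-lemma E eq

  module _ {m e f a₀ b₀ p : ℕ} {extra : ℕ → Bool} (certificate : Certificate m e f a₀ b₀ p extra) where

    open Certificate certificate
    open RelativeUnits (+ m)
    open UnitDescent m 1<m
    open Powers m
    open import Algebra.Properties.Semiring.Exp (CommutativeRing.semiring (EltRing (+ m))) using (_^_)

    private
      M = + m

      θ : Elt
      θ = relativeUnit m a₀ b₀

      instance
        p≢0 : ℕ.NonZero p
        p≢0 = ℕ.>-nonZero (ℕ.<-trans (ℕ.s≤s ℕ.z≤n) 1<p)

        L≢0 : ℕ.NonZero L
        L≢0 = ℕ.>-nonZero (ℕ.<-trans (ℕ.s≤s ℕ.z≤n) 1<L)

      θ-unit : RelativeUnit θ
      θ-unit = proj₁ (relativeUnit-norms m a₀ b₀ (unit-difference {m} {e} {f} opposite {a₀} {b₀} solution))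

      θ-norm : norm M θ ≡ 1ℤ
      θ-norm = proj₂ (relativeUnit-norms m a₀ b₀ (unit-difference {m} {e} {f} opposite {a₀} {b₀} solution))

      fourth-positive : ∀ {n} → 0 ℕ.< n → 0 ℕ.< n ⁴
      fourth-positive 0<n = ℕ.*-mono-< (ℕ.*-mono-< 0<n 0<n) (ℕ.*-mono-< 0<n 0<n)

      fundamental : Fundamental _ _ _ _
      fundamental = record
        { unit = θ-unit
        ; 1<A = ℕ.<-≤-trans 1<m (ℕ.≤-trans (ℕ.m≤m*n m (b₀ ⁴) {{ℕ.>-nonZero (fourth-positive (proj₂ positive))}}) (ℕ.m≤n+m _ (a₀ ⁴)))
        ; 0<C = ℕ.*-mono-< {0} {2} (ℕ.s≤s ℕ.z≤n) (ℕ.*-mono-< (ℕ.*-mono-< (proj₁ positive) (proj₁ positive)) (ℕ.*-mono-< (proj₂ positive) (proj₂ positive)))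
        ; small = λ a b c d unit mc²≤2A → SmallUnits.smallUnits-complete m g 1<m m≤g² K none a b c d unit (c≤K c mc²≤2A) }
        where
        c≤K : ∀ c → m ℕ.* (c ℕ.* c) ℕ.≤ 2 ℕ.* (a₀ ⁴ ℕ.+ m ℕ.* b₀ ⁴) → c ℕ.≤ K
        c≤K c mc²≤2A with c ℕ.≤? K
        ... | yes c≤K = c≤K
        ... | no c≰K = ⊥-elim (ℕ.<⇒≱ bound (ℕ.≤-trans (ℕ.*-monoʳ-≤ m (ℕ.*-mono-≤ (ℕ.≰⇒> c≰K) (ℕ.≰⇒> c≰K))) mc²≤2A))

      power-period : ∀ s j → powE m θ (j ℕ.+ s ℕ.* L) ≡ mul M (powE m θ j) (addE oneE (mul M (scalar (+ p)) z) ^ s)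
      power-period s j = trans (split-power θ L s j) (cong (λ y → mul M (powE m θ j) (y ^ s)) period)

      congruent : ∀ {x y w} → x ≡ y + + p * w → ∀ {n} → x ≡ + n → (∃ λ n′ → y ≡ + n′) → rem ∣ y ∣ p ≡ rem n p
      congruent {w = w} e refl (n′ , refl) = sym (rem-shift p w e)

      -- `θ^L` is 1 modulo `p`, so the residues of `a²` and `b²` match those of `θʲ`, and the sieve
      -- admits no other `j`.
      exponent-cases : ∀ a b → a ⁴ ℕ.+ e ≡ m ℕ.* b ⁴ ℕ.+ f → T (extra (rem (a ℕ.* a) p)) → ∀ s j → j ℕ.< L →
        let y = powE m θ (j ℕ.+ s ℕ.* L) in c0 y ≡ + (a ⁴ ℕ.+ m ℕ.* b ⁴) → c2 y ≡ + (2 ℕ.* (a ℕ.* a ℕ.* (b ℕ.* b))) →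
        j ≡ 1 ⊎ suc j ≡ L
      exponent-cases a b eqn ex s j j<L e₀ e₂ = decide (T-cases first)
        where
        A² = a ℕ.* a
        B² = b ℕ.* b
        x = rem A² p
        y = rem B² p
        x≡ : rem x p ≡ rem A² p
        x≡ = rem-rem A² p
        y≡ : rem y p ≡ rem B² p
        y≡ = rem-rem B² p
        g₀ = powE m θ j
        decomposition : ∃ λ w → c0 (powE m θ (j ℕ.+ s ℕ.* L)) ≡ c0 g₀ + + p * c0 w × c2 (powE m θ (j ℕ.+ s ℕ.* L)) ≡ c2 g₀ + + p * c2 w
        decomposition = subst (λ t → ∃ λ w → c0 t ≡ c0 g₀ + + p * c0 w × c2 t ≡ c2 g₀ + + p * c2 w) (sym (power-period s j)) (residue-of-power g₀ p z s)
        w = proj₁ decomposition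
        nonneg : (∃ λ n → c0 g₀ ≡ + n) × (∃ λ n → c2 g₀ ≡ + n)
        nonneg with power-nonneg 1<m j
        ... | α , β , γ , δ , e = (α , cong c0 e) , (γ , cong c2 e)
        r₀ : rem ∣ c0 g₀ ∣ p ≡ rem (a ⁴ ℕ.+ m ℕ.* b ⁴) p
        r₀ = congruent {w = c0 w} (proj₁ (proj₂ decomposition)) e₀ (proj₁ nonneg)
        r₂ : rem ∣ c2 g₀ ∣ p ≡ rem (2 ℕ.* (A² ℕ.* B²)) p
        r₂ = congruent {w = c2 w} (proj₂ (proj₂ decomposition)) e₂ (proj₂ nonneg)
        same : ∀ {n n′} → rem n p ≡ rem n′ p → T (cong-mod p n n′)
        same = ℕ.≡⇒≡ᵇ _ _
        same₀ : T (cong-mod p ∣ c0 g₀ ∣ (x ℕ.* x ℕ.+ m ℕ.* (y ℕ.* y)))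
        same₀ = same (trans r₀ (sym (rem-+ p (rem-* p x≡ x≡) (rem-* p (refl {x = rem m p}) (rem-* p y≡ y≡)))))
        same₂ : T (cong-mod p ∣ c2 g₀ ∣ (2 ℕ.* (x ℕ.* y)))
        same₂ = same (trans r₂ (sym (rem-* p (refl {x = rem 2 p}) (rem-* p x≡ y≡))))
        same₁ : T (cong-mod p (x ℕ.* x ℕ.+ e) (m ℕ.* (y ℕ.* y) ℕ.+ f))
        same₁ = same (trans (rem-+ p (rem-* p x≡ x≡) (refl {x = rem e p})) (trans (cong (λ n → rem n p) eqn)
          (sym (rem-+ p (rem-* p (refl {x = rem m p}) (rem-* p y≡ y≡)) (refl {x = rem f p})))))
        impossible : ∀ {t u} → T t → T (not t ∨ u) → T u
        impossible {true} _ q = q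
        row = T-all _ (square∈ p a) sieved
        cell = T-all _ (square∈ p b) (impossible ex row)
        first : T ((j ℕ.≡ᵇ 1) ∨ (suc j ℕ.≡ᵇ L) ∨ not (matches p g₀ (x ℕ.* x ℕ.+ m ℕ.* (y ℕ.* y)) (2 ℕ.* (x ℕ.* y))))
        first = T-all _ (∈-downFrom⁺ j<L) (impossible same₁ cell)
        decide : T (j ℕ.≡ᵇ 1) ⊎ T ((suc j ℕ.≡ᵇ L) ∨ not (matches p g₀ (x ℕ.* x ℕ.+ m ℕ.* (y ℕ.* y)) (2 ℕ.* (x ℕ.* y)))) → j ≡ 1 ⊎ suc j ≡ L
        decide (inj₁ t) = inj₁ (ℕ.≡ᵇ⇒≡ j 1 t)
        decide (inj₂ t) with T-cases t
        ... | inj₁ t = inj₂ (ℕ.≡ᵇ⇒≡ (suc j) L t)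
        ... | inj₂ t = ⊥-elim (T-contra (T-and same₀ same₂) t)

      Close : Elt → ℕ → Set
      Close g s = norm M (mul M g (addE oneE (mul M (scalar (+ p)) z) ^ s)) ≡ norm M g

      near-θ : ∀ s → Close θ s → s ≡ 0
      near-θ = let E , inverse = rem≡0⇒ p (slope M θ (mul M θ z) * I) slope⁺ in
        p-adic-uniqueness M p h triangle≡ 1<p θ z I E inverse

      near-σθ : ∀ s → Close (σ θ) s → s ≡ 0
      near-σθ = let E , inverse = rem≡0⇒ p (slope M (σ θ) (mul M (σ θ) z) * - I) slope⁻ in
        p-adic-uniqueness M p h triangle≡ 1<p (σ θ) z (- I) E inverse

      θ¹ : powE m θ 1 ≡ θ
      θ¹ = trans (mul-comm M θ oneE) (mul-identityˡ M θ)

      from-1 : ∀ s → norm M (powE m θ (1 ℕ.+ s ℕ.* L)) ≡ 1ℤ → powE m θ (1 ℕ.+ s ℕ.* L) ≡ θ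
      from-1 s n≡1 = trans (cong (λ t → powE m θ (1 ℕ.+ t ℕ.* L)) s≡0) θ¹
        where
        s≡0 : s ≡ 0
        s≡0 = near-θ s (trans (cong (norm M) (sym (trans (power-period s 1) (cong (λ t → mul M t (addE oneE (mul M (scalar (+ p)) z) ^ s)) θ¹))))
          (trans n≡1 (sym θ-norm)))

      -- With `j = L - 1` the power is `σ θ` times `(θ^L)^(s + 1)`. Uniqueness at `σ θ` would force
      -- `s + 1 = 0`.
      from-−1 : ∀ s j → suc j ≡ L → norm M (powE m θ (j ℕ.+ s ℕ.* L)) ≢ 1ℤ
      from-−1 s j refl n≡1 = ℕ.1+n≢0 (near-σθ (suc s) (trans (cong (norm M) (sym y≡)) (trans n≡1 (sym θ-norm))))
        where
        X y : Elt
        X = addE oneE (mul M (scalar (+ p)) z) ^ suc s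
        y = powE m θ (j ℕ.+ s ℕ.* L)
        θy≡X : mul M θ y ≡ X
        θy≡X = trans (power-period (suc s) 0) (mul-identityˡ M X)
        y≡ : y ≡ mul M (σ θ) X
        y≡ = trans (sym (mul-identityˡ M y)) (trans (cong (λ t → mul M t y) (sym (trans (mul-comm M (σ θ) θ) θ-unit)))
          (trans (mul-assoc M (σ θ) θ y) (cong (mul M (σ θ)) θy≡X)))

      conclude : ∀ a b → a ⁴ ℕ.+ e ≡ m ℕ.* b ⁴ ℕ.+ f → a ⁴ ℕ.+ m ℕ.* b ⁴ ≡ a₀ ⁴ ℕ.+ m ℕ.* b₀ ⁴ → a ≡ a₀ × b ≡ b₀
      conclude a b eqn total = a≡a₀ , b≡b₀
        where
        double : ∀ x y → 2 ℕ.* x ℕ.+ e ≡ x ℕ.+ y ℕ.+ f → x ℕ.+ e ≡ y ℕ.+ f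
        double x y h = ℕ.+-cancelˡ-≡ x _ _ (trans (eq₁ x e) (trans h (eq₂ x y f)))
          where
          eq₁ : ∀ x e → x ℕ.+ (x ℕ.+ e) ≡ 2 ℕ.* x ℕ.+ e
          eq₁ = ℕ.solve-∀
          eq₂ : ∀ x y f → x ℕ.+ y ℕ.+ f ≡ x ℕ.+ (y ℕ.+ f)
          eq₂ = ℕ.solve-∀
        doubled : ∀ x y → x ℕ.+ e ≡ y ℕ.+ f → 2 ℕ.* x ℕ.+ e ≡ x ℕ.+ y ℕ.+ f
        doubled x y h = trans (eq₁ x e) (trans (cong (x ℕ.+_) h) (eq₂ x y f))
          where
          eq₁ : ∀ x e → 2 ℕ.* x ℕ.+ e ≡ x ℕ.+ (x ℕ.+ e)
          eq₁ = ℕ.solve-∀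
          eq₂ : ∀ x y f → x ℕ.+ (y ℕ.+ f) ≡ x ℕ.+ y ℕ.+ f
          eq₂ = ℕ.solve-∀
        a⁴≡ : a ⁴ ≡ a₀ ⁴
        a⁴≡ = ℕ.*-cancelˡ-≡ (a ⁴) (a₀ ⁴) 2 (ℕ.+-cancelʳ-≡ e _ _ (trans (doubled (a ⁴) (m ℕ.* b ⁴) eqn)
          (trans (cong (ℕ._+ f) total) (sym (doubled (a₀ ⁴) (m ℕ.* b₀ ⁴) solution)))))
        a≡a₀ : a ≡ a₀
        a≡a₀ = ⁴-injective {a} {a₀} a⁴≡
        b≡b₀ : b ≡ b₀
        b≡b₀ = ⁴-injective {b} {b₀} (ℕ.*-cancelˡ-≡ (b ⁴) (b₀ ⁴) m {{ℕ.>-nonZero (ℕ.<-trans (ℕ.s≤s ℕ.z≤n) 1<m)}}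
          (ℕ.+-cancelˡ-≡ (a ⁴) _ _ (trans total (cong (ℕ._+ m ℕ.* b₀ ⁴) (sym a⁴≡)))))

    unique-solution : ∀ a b → a ⁴ ℕ.+ e ≡ m ℕ.* b ⁴ ℕ.+ f → T (extra (rem (a ℕ.* a) p)) → a ≡ a₀ × b ≡ b₀
    unique-solution a b eqn ex = from-power (units-are-powers fundamental _ _ _ _ (<-wellFounded _) (proj₁ x-norms))
      where
      x : Elt
      x = relativeUnit m a b
      x-norms : RelativeUnit x × norm M x ≡ 1ℤ
      x-norms = relativeUnit-norms m a b (unit-difference {m} {e} {f} opposite {a} {b} eqn)
      from-exponent : ∀ s j → j ℕ.< L → c0 (powE m θ (j ℕ.+ s ℕ.* L)) ≡ c0 x → c2 (powE m θ (j ℕ.+ s ℕ.* L)) ≡ c2 x → a ≡ a₀ × b ≡ b₀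
      from-exponent s j j<L e₀ e₂ with exponent-cases a b eqn ex s j j<L e₀ e₂
      ... | inj₁ refl = conclude a b eqn (ℤ.+-injective (trans (sym e₀) (cong c0 (from-1 s n≡1))))
        where
        n≡1 : norm M (powE m θ (1 ℕ.+ s ℕ.* L)) ≡ 1ℤ
        n≡1 = trans (cong₂ (λ u v → u * u + - (M * (v * v))) e₀ e₂) (proj₂ x-norms)
      ... | inj₂ j+1≡L = ⊥-elim (from-−1 s j j+1≡L (trans (cong₂ (λ u v → u * u + - (M * (v * v))) e₀ e₂) (proj₂ x-norms)))
      from-power : IsPower fundamental x → a ≡ a₀ × b ≡ b₀
      from-power (k , θᵏ≡) = from-exponent (k ℕ./ L) (k ℕ.% L) (m%n<n k L) (trans (cong c0 reindex) (proj₁ (parts θᵏ≡))) (trans (cong c2 reindex) (proj₂ (parts θᵏ≡)))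
        where
        reindex : powE m θ (k ℕ.% L ℕ.+ k ℕ./ L ℕ.* L) ≡ powE m θ k
        reindex = cong (powE m θ) (sym (m≡m%n+[m/n]*n k L))
        -- `σ` fixes the coordinates of `1` and `α²`, so both alternatives give the same data.
        parts : powE m θ k ≡ x ⊎ powE m θ k ≡ σ x → c0 (powE m θ k) ≡ c0 x × c2 (powE m θ k) ≡ c2 x
        parts (inj₁ q) = cong c0 q , cong c2 q
        parts (inj₂ q) = cong c0 q , cong c2 q

-- Numerical data for the seven values of `m` with nontrivial solutions.

module Certificates where

  open LocalTests
  open Skolem
  open import Data.Nat as ℕ using (ℕ)
  import Data.Nat.Properties as ℕ
  open import Data.Integer using (+_)
  open import Data.Bool using (true)
  open import Data.Product using (_,_)
  open import Relation.Binary.PropositionalEquality using (refl)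

  -- In all seven certificates `h = (p - 1) / 2`, `g` is `√m` rounded up, `K` is the least number
  -- satisfying `bound`, and `I` inverts the slope at `θ` modulo `p`. For the sign `+1`, `extra` is
  -- the exceptional factorisation of `a⁴ - 1`.
  certificate-2 : Certificate 2 1 0 1 1 3 (λ _ → true)
  certificate-2 = record
    { h = 1 ; L = 8 ; g = 2 ; K = 1 ; I = + 1
    ; 1<m = ℕ.<ᵇ⇒< 1 2 _ ; opposite = refl ; solution = refl ; positive = ℕ.<ᵇ⇒< 0 1 _ , ℕ.<ᵇ⇒< 0 1 _
    ; m≤g² = ℕ.≤ᵇ⇒≤ 2 4 _ ; bound = ℕ.<ᵇ⇒< 6 8 _ ; none = _ ; 1<p = ℕ.<ᵇ⇒< 1 3 _ ; 1<L = ℕ.<ᵇ⇒< 1 8 _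
    ; triangle≡ = refl ; period = refl ; slope⁺ = refl ; slope⁻ = refl ; sieved = _ }

  certificate-15 : Certificate 15 0 1 2 1 17 (pellAt 5 3 (table 17))
  certificate-15 = record
    { h = 8 ; L = 18 ; g = 4 ; K = 2 ; I = + 9
    ; 1<m = ℕ.<ᵇ⇒< 1 15 _ ; opposite = refl ; solution = refl ; positive = ℕ.<ᵇ⇒< 0 2 _ , ℕ.<ᵇ⇒< 0 1 _
    ; m≤g² = ℕ.≤ᵇ⇒≤ 15 16 _ ; bound = ℕ.<ᵇ⇒< 62 135 _ ; none = _ ; 1<p = ℕ.<ᵇ⇒< 1 17 _ ; 1<L = ℕ.<ᵇ⇒< 1 18 _
    ; triangle≡ = refl ; period = refl ; slope⁺ = refl ; slope⁻ = refl ; sieved = _ }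

  certificate-39 : Certificate 39 0 1 5 2 41 (pellAt 26 24 (table 41))
  certificate-39 = record
    { h = 20 ; L = 42 ; g = 7 ; K = 8 ; I = + 30
    ; 1<m = ℕ.<ᵇ⇒< 1 39 _ ; opposite = refl ; solution = refl ; positive = ℕ.<ᵇ⇒< 0 5 _ , ℕ.<ᵇ⇒< 0 2 _
    ; m≤g² = ℕ.≤ᵇ⇒≤ 39 49 _ ; bound = ℕ.<ᵇ⇒< 2498 3159 _ ; none = _ ; 1<p = ℕ.<ᵇ⇒< 1 41 _ ; 1<L = ℕ.<ᵇ⇒< 1 42 _
    ; triangle≡ = refl ; period = refl ; slope⁺ = refl ; slope⁻ = refl ; sieved = _ }

  certificate-82 : Certificate 82 1 0 3 1 13 (λ _ → true)
  certificate-82 = record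
    { h = 6 ; L = 7 ; g = 10 ; K = 1 ; I = + 7
    ; 1<m = ℕ.<ᵇ⇒< 1 82 _ ; opposite = refl ; solution = refl ; positive = ℕ.<ᵇ⇒< 0 3 _ , ℕ.<ᵇ⇒< 0 1 _
    ; m≤g² = ℕ.≤ᵇ⇒≤ 82 100 _ ; bound = ℕ.<ᵇ⇒< 326 328 _ ; none = _ ; 1<p = ℕ.<ᵇ⇒< 1 13 _ ; 1<L = ℕ.<ᵇ⇒< 1 7 _
    ; triangle≡ = refl ; period = refl ; slope⁺ = refl ; slope⁻ = refl ; sieved = _ }

  certificate-255 : Certificate 255 0 1 4 1 7 (pellAt 17 15 (table 7))
  certificate-255 = record
    { h = 3 ; L = 12 ; g = 16 ; K = 2 ; I = + 5
    ; 1<m = ℕ.<ᵇ⇒< 1 255 _ ; opposite = refl ; solution = refl ; positive = ℕ.<ᵇ⇒< 0 4 _ , ℕ.<ᵇ⇒< 0 1 _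
    ; m≤g² = ℕ.≤ᵇ⇒≤ 255 256 _ ; bound = ℕ.<ᵇ⇒< 1022 2295 _ ; none = _ ; 1<p = ℕ.<ᵇ⇒< 1 7 _ ; 1<L = ℕ.<ᵇ⇒< 1 12 _
    ; triangle≡ = refl ; period = refl ; slope⁺ = refl ; slope⁻ = refl ; sieved = _ }

  certificate-915 : Certificate 915 0 1 11 2 7 (pellAt 122 120 (table 7))
  certificate-915 = record
    { h = 3 ; L = 12 ; g = 31 ; K = 8 ; I = + 5
    ; 1<m = ℕ.<ᵇ⇒< 1 915 _ ; opposite = refl ; solution = refl ; positive = ℕ.<ᵇ⇒< 0 11 _ , ℕ.<ᵇ⇒< 0 2 _
    ; m≤g² = ℕ.≤ᵇ⇒≤ 915 961 _ ; bound = ℕ.<ᵇ⇒< 58562 74115 _ ; none = _ ; 1<p = ℕ.<ᵇ⇒< 1 7 _ ; 1<L = ℕ.<ᵇ⇒< 1 12 _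
    ; triangle≡ = refl ; period = refl ; slope⁺ = refl ; slope⁻ = refl ; sieved = _ }

  certificate-1295 : Certificate 1295 0 1 6 1 89 (pellAt 37 35 (table 89))
  certificate-1295 = record
    { h = 44 ; L = 90 ; g = 36 ; K = 2 ; I = + 71
    ; 1<m = ℕ.<ᵇ⇒< 1 1295 _ ; opposite = refl ; solution = refl ; positive = ℕ.<ᵇ⇒< 0 6 _ , ℕ.<ᵇ⇒< 0 1 _
    ; m≤g² = ℕ.≤ᵇ⇒≤ 1295 1296 _ ; bound = ℕ.<ᵇ⇒< 5182 11655 _ ; none = _ ; 1<p = ℕ.<ᵇ⇒< 1 89 _ ; 1<L = ℕ.<ᵇ⇒< 1 90 _
    ; triangle≡ = refl ; period = refl ; slope⁺ = refl ; slope⁻ = refl ; sieved = _ }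

-- The equations `x² + 1 = m y²` for `m = 146` and `m = 226`.

module NegativePellEquations where

  open FourthPowers
  open LocalTests
  open LocalObstructions
  open UnitGroup using (square-abs)
  open ThueUnits using (rem-shift)
  open import Data.Nat as ℕ using (ℕ; zero; suc)
  import Data.Nat.Properties as ℕ
  import Data.Nat.Tactic.RingSolver as ℕ
  open import Data.Nat.Induction using (<-wellFounded)
  open import Induction.WellFounded using (Acc; acc)
  open import Data.Integer using (ℤ; +_; -[1+_]; -_; _+_; _*_; 1ℤ; ∣_∣)
  import Data.Integer.Properties as ℤ
  open import Data.Integer.Tactic.RingSolver using (solve-∀)
  open import Data.Bool using (T; not; _∧_)
  open import Data.Product using (∃; _×_; _,_; proj₁; proj₂)
  open import Data.Sum using (_⊎_; inj₁; inj₂)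
  open import Data.Empty using (⊥; ⊥-elim)
  open import Relation.Nullary using (¬_; yes; no)
  open import Relation.Binary.PropositionalEquality using (_≡_; refl; sym; trans; cong; cong₂; subst)

  NegativePell : ℕ → ℕ → ℕ → Set
  NegativePell m x y = x ℕ.* x ℕ.+ 1 ≡ m ℕ.* (y ℕ.* y)

  -- Here m = r² + e, and (U r + 1) + U√m is a unit of norm 1.
  module PellDescent (r e U : ℕ) (0<U : 0 ℕ.< U) (fundamental : (U ℕ.* r ℕ.+ 1) ℕ.* (U ℕ.* r ℕ.+ 1) ≡ (r ℕ.* r ℕ.+ e) ℕ.* (U ℕ.* U) ℕ.+ 1) where

    private
      m T′ : ℕ
      m = r ℕ.* r ℕ.+ e
      T′ = U ℕ.* r ℕ.+ 1

    -- If `x ≤ r y`, then `m y² = x² + 1 ≤ r² y² + 1`, that is `e y² ≤ 1`. The bound makes the next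
    -- `y′ = T′y - Ux = y - U (x - ry)` smaller than `y`.
    lower : ∀ x y → NegativePell m x y → 1 ℕ.< e ℕ.* (y ℕ.* y) → r ℕ.* y ℕ.< x
    lower x y eqn large with r ℕ.* y ℕ.<? x
    ... | yes ry<x = ry<x
    ... | no ry≮x = ⊥-elim (ℕ.<⇒≱ large (ℕ.+-cancelˡ-≤ (r ℕ.* r ℕ.* (y ℕ.* y)) _ _ (begin
      r ℕ.* r ℕ.* (y ℕ.* y) ℕ.+ e ℕ.* (y ℕ.* y) ≡⟨ ℕ.*-distribʳ-+ (y ℕ.* y) (r ℕ.* r) e ⟨
      m ℕ.* (y ℕ.* y) ≡⟨ eqn ⟨
      x ℕ.* x ℕ.+ 1 ≤⟨ ℕ.+-monoˡ-≤ 1 (ℕ.*-mono-≤ (ℕ.≮⇒≥ ry≮x) (ℕ.≮⇒≥ ry≮x)) ⟩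
      r ℕ.* y ℕ.* (r ℕ.* y) ℕ.+ 1 ≡⟨ cong (ℕ._+ 1) (regroup r y) ⟩
      r ℕ.* r ℕ.* (y ℕ.* y) ℕ.+ 1 ∎)))
      where
      open ℕ.≤-Reasoning
      regroup : ∀ r y → r ℕ.* y ℕ.* (r ℕ.* y) ≡ r ℕ.* r ℕ.* (y ℕ.* y)
      regroup = ℕ.solve-∀

    -- `(Ux)² < U² m y² < (T′y)²` for positive `U` and `y`; it makes `y′ = T′y - Ux` a natural
    -- number.
    upper : ∀ x y → NegativePell m x y → U ℕ.* x ℕ.≤ T′ ℕ.* y
    upper x y eqn with U ℕ.* x ℕ.≤? T′ ℕ.* y
    ... | yes h = h
    ... | no h = ⊥-elim (ℕ.<⇒≱ (ℕ.*-mono-< (ℕ.≰⇒> h) (ℕ.≰⇒> h)) (ℕ.≤-trans (ℕ.m≤m+n _ (U ℕ.* U)) (begin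
      U ℕ.* x ℕ.* (U ℕ.* x) ℕ.+ U ℕ.* U ≡⟨ eq₁ U x ⟩
      U ℕ.* U ℕ.* (x ℕ.* x ℕ.+ 1) ≡⟨ cong (U ℕ.* U ℕ.*_) eqn ⟩
      U ℕ.* U ℕ.* (m ℕ.* (y ℕ.* y)) ≤⟨ ℕ.m≤m+n _ (y ℕ.* y) ⟩
      U ℕ.* U ℕ.* (m ℕ.* (y ℕ.* y)) ℕ.+ y ℕ.* y ≡⟨ eq₂ U m y ⟩
      (m ℕ.* (U ℕ.* U) ℕ.+ 1) ℕ.* (y ℕ.* y) ≡⟨ cong (ℕ._* (y ℕ.* y)) fundamental ⟨
      T′ ℕ.* T′ ℕ.* (y ℕ.* y) ≡⟨ eq₃ T′ y ⟩
      T′ ℕ.* y ℕ.* (T′ ℕ.* y) ∎)))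
      where
      open ℕ.≤-Reasoning
      eq₁ : ∀ U x → U ℕ.* x ℕ.* (U ℕ.* x) ℕ.+ U ℕ.* U ≡ U ℕ.* U ℕ.* (x ℕ.* x ℕ.+ 1)
      eq₁ = ℕ.solve-∀
      eq₂ : ∀ U m y → U ℕ.* U ℕ.* (m ℕ.* (y ℕ.* y)) ℕ.+ y ℕ.* y ≡ (m ℕ.* (U ℕ.* U) ℕ.+ 1) ℕ.* (y ℕ.* y)
      eq₂ = ℕ.solve-∀
      eq₃ : ∀ T y → T ℕ.* T ℕ.* (y ℕ.* y) ≡ T ℕ.* y ℕ.* (T ℕ.* y)
      eq₃ = ℕ.solve-∀

    -- `x′ + y′√m` is `(x + y√m)(T′ - U√m)`. The sign of `x′` is not controlled, so it is an
    -- integer; the last two equations multiply back by the unit.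
    record Predecessor (x y : ℕ) : Set where
      constructor predecessor
      field
        x′ : ℤ
        y′ : ℕ
        y′<y : y′ ℕ.< y
        eqn′ : NegativePell m ∣ x′ ∣ y′
        x≡ : + x ≡ + T′ * x′ + + m * + U * + y′
        y≡ : + y ≡ + U * x′ + + T′ * + y′

    descend : ∀ x y → NegativePell m x y → 1 ℕ.< e ℕ.* (y ℕ.* y) → Predecessor x y
    descend x y eqn large with ℕ.m≤n⇒∃[o]m+o≡n (upper x y eqn)
    ... | d , Ux+d≡Ty = predecessor X′ d d<y (ℤ.+-injective eqn′) (trans (sym (recover₁ (+ T′) (+ m) (+ U) (+ x) (+ y) F)) (cong (λ z → + T′ * X′ + + m * + U * z) (sym d≡)))
        (trans (sym (recover₂ (+ T′) (+ m) (+ U) (+ x) (+ y) F)) (cong (λ z → + U * X′ + + T′ * z) (sym d≡)))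
      where
      X′ : ℤ
      X′ = + T′ * + x + - (+ m * + U * + y)
      F : + T′ * + T′ ≡ + m * (+ U * + U) + 1ℤ
      F = trans (sym (ℤ.pos-* T′ T′)) (trans (cong +_ fundamental) (cong (_+ 1ℤ) (trans (ℤ.pos-* m (U ℕ.* U)) (cong (+ m *_) (ℤ.pos-* U U)))))
      d≡ : + d ≡ + T′ * + y + - (+ U * + x)
      d≡ = trans (sym (isolate (+ U * + x) (+ d))) (cong (λ z → z + - (+ U * + x))
        (trans (cong (_+ + d) (sym (ℤ.pos-* U x))) (trans (cong +_ Ux+d≡Ty) (ℤ.pos-* T′ y))))
        where
        isolate : ∀ u d → u + d + - u ≡ d
        isolate = solve-∀
      recover₁ : ∀ T M U x y → T * T ≡ M * (U * U) + 1ℤ → T * (T * x + - (M * U * y)) + M * U * (T * y + - (U * x)) ≡ x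
      recover₁ T M U x y F = trans (eq T M U x y) (trans (cong (λ t → t * x + - (M * (U * U) * x)) F) (eq′ (M * (U * U)) x))
        where
        eq : ∀ T M U x y → T * (T * x + - (M * U * y)) + M * U * (T * y + - (U * x)) ≡ T * T * x + - (M * (U * U) * x)
        eq = solve-∀
        eq′ : ∀ k x → (k + 1ℤ) * x + - (k * x) ≡ x
        eq′ = solve-∀
      recover₂ : ∀ T M U x y → T * T ≡ M * (U * U) + 1ℤ → U * (T * x + - (M * U * y)) + T * (T * y + - (U * x)) ≡ y
      recover₂ T M U x y F = trans (eq T M U x y) (trans (cong (λ t → t * y + - (M * (U * U) * y)) F) (eq′ (M * (U * U)) y))
        where
        eq : ∀ T M U x y → U * (T * x + - (M * U * y)) + T * (T * y + - (U * x)) ≡ T * T * y + - (M * (U * U) * y)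
        eq = solve-∀
        eq′ : ∀ k x → (k + 1ℤ) * x + - (k * x) ≡ x
        eq′ = solve-∀
      norm′ : ∀ T M U x y → T * T ≡ M * (U * U) + 1ℤ → x * x + 1ℤ ≡ M * (y * y) →
        (T * x + - (M * U * y)) * (T * x + - (M * U * y)) + 1ℤ ≡ M * ((T * y + - (U * x)) * (T * y + - (U * x)))
      norm′ T M U x y F E = trans (eq T M U x y) (trans (cong₂ (λ t s → t * (s + - 1ℤ + - (M * (y * y))) + - (M * (U * U) * (s + - 1ℤ + - (M * (y * y)))) + 1ℤ + M * ((T * y + - (U * x)) * (T * y + - (U * x)))) F E)
          (eq′ (M * (U * U)) (M * (y * y)) (M * ((T * y + - (U * x)) * (T * y + - (U * x))))))
        where
        eq : ∀ T M U x y → (T * x + - (M * U * y)) * (T * x + - (M * U * y)) + 1ℤ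
          ≡ T * T * (x * x + 1ℤ + - 1ℤ + - (M * (y * y))) + - (M * (U * U) * (x * x + 1ℤ + - 1ℤ + - (M * (y * y)))) + 1ℤ + M * ((T * y + - (U * x)) * (T * y + - (U * x)))
        eq = solve-∀
        eq′ : ∀ k s z → (k + 1ℤ) * (s + - 1ℤ + - s) + - (k * (s + - 1ℤ + - s)) + 1ℤ + z ≡ z
        eq′ = solve-∀
      eqn-ℤ : + x * + x + 1ℤ ≡ + m * (+ y * + y)
      eqn-ℤ = trans (cong (_+ 1ℤ) (sym (ℤ.pos-* x x))) (trans (cong +_ eqn) (trans (ℤ.pos-* m (y ℕ.* y)) (cong (+ m *_) (ℤ.pos-* y y))))
      eqn′ : + (∣ X′ ∣ ℕ.* ∣ X′ ∣ ℕ.+ 1) ≡ + (m ℕ.* (d ℕ.* d))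
      eqn′ = trans (cong (_+ 1ℤ) (sym (square-abs X′))) (trans (norm′ (+ T′) (+ m) (+ U) (+ x) (+ y) F eqn-ℤ)
        (trans (cong (λ z → + m * (z * z)) (sym d≡)) (sym (trans (ℤ.pos-* m (d ℕ.* d)) (cong (+ m *_) (ℤ.pos-* d d))))))
      d<y : d ℕ.< y
      d<y = ℕ.+-cancelˡ-< (U ℕ.* x) d y (begin-strict
        U ℕ.* x ℕ.+ d ≡⟨ Ux+d≡Ty ⟩
        T′ ℕ.* y ≡⟨ eq U r y ⟩
        U ℕ.* (r ℕ.* y) ℕ.+ y <⟨ ℕ.+-monoˡ-< y (ℕ.*-monoʳ-< U {{ℕ.>-nonZero 0<U}} (lower x y eqn large)) ⟩
        U ℕ.* x ℕ.+ y ∎)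
        where
        open ℕ.≤-Reasoning
        eq : ∀ U r y → (U ℕ.* r ℕ.+ 1) ℕ.* y ≡ U ℕ.* (r ℕ.* y) ℕ.+ y
        eq = ℕ.solve-∀

  -- `146 = 12² + 2`, with the unit `145 + 12√146`. Since `e = 2`, the descent applies to every
  -- positive `y`, and `y = 0` is no solution.
  no-pell-146 : ∀ x y → Acc ℕ._<_ y → ¬ NegativePell 146 x y
  no-pell-146 x zero _ eqn = ℕ.1+n≢0 (trans (ℕ.+-comm 1 (x ℕ.* x)) eqn)
  no-pell-146 x y@(suc _) (acc rec) eqn = recurse (PellDescent.descend 12 2 12 (ℕ.s≤s ℕ.z≤n) refl x y eqn (ℕ.*-monoʳ-≤ 2 (ℕ.s≤s ℕ.z≤n)))
    where
    open PellDescent 12 2 12 (ℕ.s≤s ℕ.z≤n) refl using (Predecessor; predecessor)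
    recurse : Predecessor x y → ⊥
    recurse (predecessor x′ y′ y′<y eqn′ _ _) = no-pell-146 ∣ x′ ∣ y′ (rec y′<y) eqn′

  Mod41± : ℤ → ℤ → Set
  Mod41± c z = ∃ λ t → z ≡ c + + 41 * t ⊎ z ≡ - c + + 41 * t

  ±-neg : ∀ c z → Mod41± c (- z) → Mod41± c z
  ±-neg c z (t , inj₁ e) = - t , inj₂ (trans (sym (ℤ.neg-involutive z)) (trans (cong -_ e) (eq c t)))
    where
    eq : ∀ c t → - (c + + 41 * t) ≡ - c + + 41 * - t
    eq = solve-∀
  ±-neg c z (t , inj₂ e) = - t , inj₁ (trans (sym (ℤ.neg-involutive z)) (trans (cong -_ e) (eq c t)))
    where
    eq : ∀ c t → - (- c + + 41 * t) ≡ c + + 41 * - t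
    eq = solve-∀

  ±-abs : ∀ c z → Mod41± c (+ ∣ z ∣) → Mod41± c z
  ±-abs c (+ n) h = h
  ±-abs c -[1+ n ] h = ±-neg c -[1+ n ] h

  -- All solutions are x + y√226 = ±(15 ± √226)ε^k with ε = 451 + 30√226, and 41 ∣ 451, 30 * 15 ≡ -1, 226 * 30 ≡ 15 modulo 41.
  pell-226-residues : ∀ x y → Acc ℕ._<_ y → NegativePell 226 x y → Mod41± (+ 15) (+ x) × Mod41± (+ 1) (+ y)
  pell-226-residues x zero _ eqn = ⊥-elim (ℕ.1+n≢0 (trans (ℕ.+-comm 1 (x ℕ.* x)) eqn))
  pell-226-residues x 1 _ eqn = (+ 0 , inj₁ (cong +_ x≡15)) , (+ 0 , inj₁ refl)
    where
    x≡15 : x ≡ 15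
    x≡15 = square-injective {x} {15} (ℕ.+-cancelʳ-≡ 1 (x ℕ.* x) 225 eqn)
  pell-226-residues x y@(suc (suc _)) (acc rec) eqn = recurse (PellDescent.descend 15 1 30 (ℕ.s≤s ℕ.z≤n) refl x y eqn (ℕ.*-monoʳ-≤ 1 (ℕ.s≤s (ℕ.s≤s ℕ.z≤n))))
    where
    open PellDescent 15 1 30 (ℕ.s≤s ℕ.z≤n) refl using (Predecessor; predecessor)
    next-x : ∀ x′ {y′} → Mod41± (+ 1) y′ → Mod41± (+ 15) (+ 451 * x′ + + 226 * + 30 * y′)
    next-x x′ (t , inj₁ refl) = + 11 * x′ + + 165 + + 6780 * t , inj₁ (eq x′ t)
      where
      eq : ∀ x t → + 451 * x + + 6780 * (+ 1 + + 41 * t) ≡ + 15 + + 41 * (+ 11 * x + + 165 + + 6780 * t)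
      eq = solve-∀
    next-x x′ (t , inj₂ refl) = + 11 * x′ + - + 165 + + 6780 * t , inj₂ (eq x′ t)
      where
      eq : ∀ x t → + 451 * x + + 6780 * (- + 1 + + 41 * t) ≡ - + 15 + + 41 * (+ 11 * x + - + 165 + + 6780 * t)
      eq = solve-∀
    next-y : ∀ {x′} y′ → Mod41± (+ 15) x′ → Mod41± (+ 1) (+ 30 * x′ + + 451 * y′)
    next-y y′ (t , inj₁ refl) = + 11 + + 30 * t + + 11 * y′ , inj₂ (eq y′ t)
      where
      eq : ∀ y t → + 30 * (+ 15 + + 41 * t) + + 451 * y ≡ - + 1 + + 41 * (+ 11 + + 30 * t + + 11 * y)
      eq = solve-∀
    next-y y′ (t , inj₂ refl) = - + 11 + + 30 * t + + 11 * y′ , inj₁ (eq y′ t)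
      where
      eq : ∀ y t → + 30 * (- + 15 + + 41 * t) + + 451 * y ≡ + 1 + + 41 * (- + 11 + + 30 * t + + 11 * y)
      eq = solve-∀
    recurse : Predecessor x y → Mod41± (+ 15) (+ x) × Mod41± (+ 1) (+ y)
    recurse (predecessor x′ y′ y′<y eqn′ x≡ y≡) =
      subst (Mod41± (+ 15)) (sym x≡) (next-x x′ (proj₂ previous)) ,
      subst (Mod41± (+ 1)) (sym y≡) (next-y (+ y′) (±-abs (+ 15) x′ (proj₁ previous)))
      where
      previous : Mod41± (+ 15) (+ ∣ x′ ∣) × Mod41± (+ 1) (+ y′)
      previous = pell-226-residues ∣ x′ ∣ y′ (rec y′<y) eqn′

  -- `26` is `-15` modulo 41, so these are the two residues that `x` can have.
  15-26-nonsquares-mod-41 : ∀ a → T (not (rem (a ℕ.* a) 41 ℕ.≡ᵇ 15) ∧ not (rem (a ℕ.* a) 41 ℕ.≡ᵇ 26))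
  15-26-nonsquares-mod-41 a = T-all (λ r → not (r ℕ.≡ᵇ 15) ∧ not (r ℕ.≡ᵇ 26)) (square∈ 41 a) _

  -- Here `15² + 1 = 226` solves the Pell equation, so it must be used that `x` is itself a square:
  -- this contradicts `x ≡ ±15` modulo 41.
  no-square-pell-226 : ∀ a y → ¬ NegativePell 226 (a ℕ.* a) y
  no-square-pell-226 a y eqn with pell-226-residues (a ℕ.* a) y (<-wellFounded y) eqn
  ... | (t , inj₁ e) , _ = T-contra (ℕ.≡⇒≡ᵇ _ 15 (rem-shift 41 t e)) (proj₁ (T-split (15-26-nonsquares-mod-41 a)))
  ... | (t , inj₂ e) , _ = T-contra (ℕ.≡⇒≡ᵇ _ 26 (rem-shift 41 {y = 26} (t + - + 1) (trans e (shift t)))) (proj₂ (T-split {not (rem (a ℕ.* a) 41 ℕ.≡ᵇ 15)} (15-26-nonsquares-mod-41 a)))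
    where
    shift : ∀ t → - + 15 + + 41 * t ≡ + 26 + + 41 * (t + - + 1)
    shift = solve-∀

-- All solutions of `a⁴ - m b⁴ = ±1`.

module ThueEquations where

  open FourthPowers
  open LocalTests
  open LocalObstructions
  open Splittings
  open Reduction
  open Skolem
  open Certificates
  open NegativePellEquations
  open import Data.Nat as ℕ using (ℕ; _+_; _*_; _<_; _%_)
  open import Data.Nat.Properties
  open import Data.Nat.Divisibility using (_∣_; n∣m⇒m%n≡0)
  open import Data.Nat.Induction using (<-wellFounded)
  open import Induction.WellFounded using (Acc; acc)
  open import Data.Bool using (T)
  open import Data.List using (List; []; _∷_)
  open import Data.List.Membership.Propositional using (_∈_)
  open import Data.List.Relation.Unary.Any using (here; there)
  open import Data.Product using (_×_; _,_; proj₁; proj₂)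
  open import Data.Sum using (_⊎_; inj₁; inj₂)
  open import Data.Empty using (⊥; ⊥-elim)
  open import Relation.Nullary using (¬_)
  open import Relation.Binary.PropositionalEquality using (_≡_; _≢_; refl; sym; trans; cong₂)

  plusSolutions minusSolutions : List (ℕ × ℕ × ℕ)
  plusSolutions = (15 , 2 , 1) ∷ (39 , 5 , 2) ∷ (255 , 4 , 1) ∷ (915 , 11 , 2) ∷ (1295 , 6 , 1) ∷ []
  minusSolutions = (2 , 1 , 1) ∷ (82 , 3 , 1) ∷ []

  private
    solved : ∀ {m e f a₀ b₀ p extra} a b → Certificate m e f a₀ b₀ p extra → a ⁴ + e ≡ m * b ⁴ + f → T (extra (rem (a * a) p)) →
      (m , a , b) ≡ (m , a₀ , b₀)
    solved {m} a b certificate eqn ex = cong₂ (λ a b → (m , a , b)) (proj₁ equal) (proj₂ equal)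
      where
      equal = unique-solution certificate a b eqn ex

    plus-form : ∀ m a b → a ⁴ ≡ m * b ⁴ + 1 → a ⁴ + 0 ≡ m * b ⁴ + 1
    plus-form m a b eqn = trans (+-identityʳ (a ⁴)) eqn

  even-exception : ∀ {m t r} a b → (t , r) ∈ evenExceptions → t * r ≡ m → PellPair t r a → a ⁴ ≡ m * b ⁴ + 1 → (m , a , b) ∈ plusSolutions
  even-exception a b (here refl) refl (pellPair u s e f) eqn =
    here (solved a b certificate-15 (plus-form 15 a b eqn) (pellAt-complete 17 5 3 a u s e f))
  even-exception a b (there (here refl)) refl (pellPair u s e f) eqn =
    there (there (here (solved a b certificate-255 (plus-form 255 a b eqn) (pellAt-complete 7 17 15 a u s e f))))
  even-exception a b (there (there (here refl))) refl (pellPair u s e f) eqn =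
    there (there (there (there (here (solved a b certificate-1295 (plus-form 1295 a b eqn) (pellAt-complete 89 37 35 a u s e f))))))

  odd-exception : ∀ {m t r} a b → (t , r) ∈ oddExceptions → t * r ≡ m → PellPair (2 * t) (8 * r) a → a ⁴ ≡ m * b ⁴ + 1 → (m , a , b) ∈ plusSolutions
  odd-exception a b (here refl) refl (pellPair u s e f) eqn =
    there (here (solved a b certificate-39 (plus-form 39 a b eqn) (pellAt-complete 41 26 24 a u s e f)))
  odd-exception a b (there (here refl)) refl (pellPair u s e f) eqn =
    there (there (there (here (solved a b certificate-915 (plus-form 915 a b eqn) (pellAt-complete 7 122 120 a u s e f)))))

  -- A nontrivial solution is not the result of a descent step.
  no-ascent : ∀ {m p q} u → (m , p , q) ∈ plusSolutions → u * u + 1 ≢ 2 * p ⁴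
  no-ascent u (here refl) e = between-squares {5} {31} (<ᵇ⇒< 25 31 _) (<ᵇ⇒< 31 36 _) u (+-cancelʳ-≡ 1 (u * u) 31 e)
  no-ascent u (there (here refl)) e = between-squares {35} {1249} (<ᵇ⇒< 1225 1249 _) (<ᵇ⇒< 1249 1296 _) u (+-cancelʳ-≡ 1 (u * u) 1249 e)
  no-ascent u (there (there (here refl))) e = between-squares {22} {511} (<ᵇ⇒< 484 511 _) (<ᵇ⇒< 511 529 _) u (+-cancelʳ-≡ 1 (u * u) 511 e)
  no-ascent u (there (there (there (here refl)))) e = between-squares {171} {29281} (<ᵇ⇒< 29241 29281 _) (<ᵇ⇒< 29281 29584 _) u (+-cancelʳ-≡ 1 (u * u) 29281 e)
  no-ascent u (there (there (there (there (here refl))))) e = between-squares {50} {2591} (<ᵇ⇒< 2500 2591 _) (<ᵇ⇒< 2591 2601 _) u (+-cancelʳ-≡ 1 (u * u) 2591 e)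

  module _ (m : ℕ) (m≢0 : m ≢ 0) (4∤m : ¬ 4 ∣ m) (ctrl : T (controlled tables m)) where

    -- Induction on `b`. A smaller solution `(p , 2q)` would be trivial, against `q ≢ 0`, or listed,
    -- against `no-ascent`.
    plus-solutions : ∀ a b → Acc _<_ b → a ⁴ ≡ m * b ⁴ + 1 → b ≡ 0 ⊎ (m , a , b) ∈ plusSolutions
    plus-solutions a b (acc rec) eqn = cases (reduce m m≢0 4∤m ctrl a b eqn)
      where
      cases : Outcome m a b → b ≡ 0 ⊎ (m , a , b) ∈ plusSolutions
      cases (trivial b≡0) = inj₁ b≡0
      cases (exceptional-even t r exc tr≡m pair) = inj₂ (even-exception a b exc tr≡m pair eqn)
      cases (exceptional-odd t r exc tr≡m pair) = inj₂ (odd-exception a b exc tr≡m pair eqn)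
      cases (smaller p q u q≢0 eqn′ u²+1 2q<b) = ⊥-elim (absurd (plus-solutions p (2 * q) (rec 2q<b) eqn′))
        where
        absurd : 2 * q ≡ 0 ⊎ (m , p , 2 * q) ∈ plusSolutions → ⊥
        absurd (inj₁ 2q≡0) = q≢0 (m+n≡0⇒m≡0 q 2q≡0)
        absurd (inj₂ sol) = no-ascent u sol u²+1

    minus-solutions : ∀ a b → a ⁴ + 1 ≡ m * b ⁴ → (m , a , b) ∈ minusSolutions
    minus-solutions a b eqn = cases (minus-cases m m≢0 4∤m ctrl a b eqn) eqn
      where
      minus-form : ∀ m → a ⁴ + 1 ≡ m * b ⁴ → a ⁴ + 1 ≡ m * b ⁴ + 0
      minus-form m eqn = trans eqn (sym (+-identityʳ (m * b ⁴)))
      cases : ∀ {m} → m ∈ minusExceptions → a ⁴ + 1 ≡ m * b ⁴ → (m , a , b) ∈ minusSolutions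
      cases (here refl) eqn = here (solved a b certificate-2 (minus-form 2 eqn) _)
      cases (there (here refl)) eqn = there (here (solved a b certificate-82 (minus-form 82 eqn) _))
      cases (there (there (here refl))) eqn = ⊥-elim (no-pell-146 (a * a) (b * b) (<-wellFounded (b * b)) eqn)
      cases (there (there (there (here refl)))) eqn = ⊥-elim (no-square-pell-226 a (b * b) eqn)

  controlled-by-hypotheses : ∀ {m} → 1 < m → m < 2000 → SquareFree m → (m % 4 ≡ 2 ⊎ m % 4 ≡ 3) → (400 < m → m % 2 ≡ 1) → T (controlled tables m)
  controlled-by-hypotheses 1<m m<2000 sqf m%4 odd =
    controlled-below 2000 tables allControlled-tables m<2000 (admissible-complete 1<m sqf m%4 odd)

  4∤ : ∀ {m} → (m % 4 ≡ 2 ⊎ m % 4 ≡ 3) → ¬ 4 ∣ m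
  4∤ {m} (inj₁ e) 4∣m with trans (sym e) (n∣m⇒m%n≡0 m 4 4∣m)
  ... | ()
  4∤ {m} (inj₂ e) 4∣m with trans (sym e) (n∣m⇒m%n≡0 m 4 4∣m)
  ... | ()

-- Determinants as a criterion for integral bases.

module Determinants where

  open QuarticRing
  open import Data.Nat as ℕ using (zero; suc)
  open import Data.Integer using (ℤ; +_; -_; _+_; _*_; 0ℤ; 1ℤ)
  import Data.Integer.Properties as ℤ
  open import Data.Integer.Tactic.RingSolver using (solve-∀)
  open import Data.Fin using (Fin; zero; suc)
  open import Data.Product using (Σ; ∃; _×_; _,_; proj₁; proj₂)
  open import Relation.Binary.PropositionalEquality using (_≡_; refl; sym; trans; cong; cong₂)

  det : ℤ → ℤ → ℤ → ℤ → ℤ → ℤ → ℤ → ℤ → ℤ → ℤ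
  det p₁ p₂ p₃ q₁ q₂ q₃ r₁ r₂ r₃ =
    p₁ * (q₂ * r₃ + - (q₃ * r₂)) + p₂ * (q₃ * r₁ + - (q₁ * r₃)) + p₃ * (q₁ * r₂ + - (q₂ * r₁))

  -- Determinant in the coordinates of α, α², α³; the coordinate of 1 is irrelevant modulo ℤ.
  volume : Elt → Elt → Elt → ℤ
  volume g h k = det (c1 g) (c2 g) (c3 g) (c1 h) (c2 h) (c3 h) (c1 k) (c2 k) (c3 k)

  -- Multiplicativity of the 3 by 3 determinant, expanded so that it is a single polynomial
  -- identity.
  det-* : ∀ a₁ a₂ a₃ b₁ b₂ b₃ d₁ d₂ d₃ p₁ p₂ p₃ q₁ q₂ q₃ r₁ r₂ r₃ →
    (a₁ * p₁ + (a₂ * q₁ + a₃ * r₁)) * ((b₁ * p₂ + (b₂ * q₂ + b₃ * r₂)) * (d₁ * p₃ + (d₂ * q₃ + d₃ * r₃)) + - ((b₁ * p₃ + (b₂ * q₃ + b₃ * r₃)) * (d₁ * p₂ + (d₂ * q₂ + d₃ * r₂))))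
    + (a₁ * p₂ + (a₂ * q₂ + a₃ * r₂)) * ((b₁ * p₃ + (b₂ * q₃ + b₃ * r₃)) * (d₁ * p₁ + (d₂ * q₁ + d₃ * r₁)) + - ((b₁ * p₁ + (b₂ * q₁ + b₃ * r₁)) * (d₁ * p₃ + (d₂ * q₃ + d₃ * r₃))))
    + (a₁ * p₃ + (a₂ * q₃ + a₃ * r₃)) * ((b₁ * p₁ + (b₂ * q₁ + b₃ * r₁)) * (d₁ * p₂ + (d₂ * q₂ + d₃ * r₂)) + - ((b₁ * p₂ + (b₂ * q₂ + b₃ * r₂)) * (d₁ * p₁ + (d₂ * q₁ + d₃ * r₁))))
    ≡ (a₁ * (b₂ * d₃ + - (b₃ * d₂)) + a₂ * (b₃ * d₁ + - (b₁ * d₃)) + a₃ * (b₁ * d₂ + - (b₂ * d₁)))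
      * (p₁ * (q₂ * r₃ + - (q₃ * r₂)) + p₂ * (q₃ * r₁ + - (q₁ * r₃)) + p₃ * (q₁ * r₂ + - (q₂ * r₁)))
  det-* = solve-∀

  -- `q` and `r` are the coordinates of `γ²` and `γ³`. The coordinate `w` cancels, as it must:
  -- translating `γ` by an integer does not change the index.
  index-form : ∀ M w x y z → let
      q₁ = w * x + x * w + M * (y * z + z * y) ; q₂ = w * y + x * x + y * w + M * (z * z) ; q₃ = w * z + x * y + y * x + z * w
      q₀ = w * w + M * (x * z + y * y + z * x)
      r₁ = w * q₁ + x * q₀ + M * (y * q₃ + z * q₂) ; r₂ = w * q₂ + x * q₁ + y * q₀ + M * (z * q₃) ; r₃ = w * q₃ + x * q₂ + y * q₁ + z * q₀
      δ = x * x + - (M * (z * z)) ; κ = y * y + - (x * z)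
    in x * (q₂ * r₃ + - (q₃ * r₂)) + y * (q₃ * r₁ + - (q₁ * r₃)) + z * (q₁ * r₂ + - (q₂ * r₁))
      ≡ δ * (δ * δ + + 4 * (M * (κ * κ)))
  index-form = solve-∀

  -- `powComb m γ` is the case where the four elements are the powers of `γ`; the linear algebra
  -- concerns arbitrary elements.
  combination : (Fin 4 → ℤ) → Elt → Elt → Elt → Elt → Elt
  combination c f g h k = addE (scaleE (c zero) f) (addE (scaleE (c (suc zero)) g)
    (addE (scaleE (c (suc (suc zero))) h) (scaleE (c (suc (suc (suc zero)))) k)))

  module _ (g h k : Elt) where

    private
      p₀ = c0 g ; p₁ = c1 g ; p₂ = c2 g ; p₃ = c3 g
      q₀ = c0 h ; q₁ = c1 h ; q₂ = c2 h ; q₃ = c3 h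
      r₀ = c0 k ; r₁ = c1 k ; r₂ = c2 k ; r₃ = c3 k

      drop₀ : ∀ i s → i * 0ℤ + s ≡ s
      drop₀ = solve-∀

    -- The coefficients expressing `α`, `α²`, `α³` form a left inverse of the matrix of `g`, `h`,
    -- `k` modulo the coordinate of 1, so the two determinants multiply to 1.
    unimodular : (∀ i → Σ (Fin 4 → ℤ) λ c → combination c oneE g h k ≡ basis i) → ∃ λ d → d * volume g h k ≡ 1ℤ
    unimodular gen = det (a one) (a two) (a three) (b one) (b two) (b three) (d one) (d two) (d three) ,
      trans (sym (det-* (a one) (a two) (a three) (b one) (b two) (b three) (d one) (d two) (d three) p₁ p₂ p₃ q₁ q₂ q₃ r₁ r₂ r₃))
        (det-cong (row a (proj₂ (gen one))) (row b (proj₂ (gen two))) (row d (proj₂ (gen three))))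
      where
      one two three : Fin 4
      one = suc zero
      two = suc (suc zero)
      three = suc (suc (suc zero))
      a b d : Fin 4 → ℤ
      a = proj₁ (gen one)
      b = proj₁ (gen two)
      d = proj₁ (gen three)
      row : ∀ (c : Fin 4 → ℤ) {e} → combination c oneE g h k ≡ e →
        (c one * p₁ + (c two * q₁ + c three * r₁) , c one * p₂ + (c two * q₂ + c three * r₂) , c one * p₃ + (c two * q₃ + c three * r₃))
        ≡ (c1 e , c2 e , c3 e)
      row c e = cong₂ _,_ (trans (sym (drop₀ (c zero) _)) (cong c1 e))
        (cong₂ _,_ (trans (sym (drop₀ (c zero) _)) (cong c2 e)) (trans (sym (drop₀ (c zero) _)) (cong c3 e)))
      rows : ℤ × ℤ × ℤ → ℤ × ℤ × ℤ → ℤ × ℤ × ℤ → ℤ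
      rows (u₁ , u₂ , u₃) (v₁ , v₂ , v₃) (w₁ , w₂ , w₃) = det u₁ u₂ u₃ v₁ v₂ v₃ w₁ w₂ w₃
      det-cong : ∀ {u u′ v v′ w w′} → u ≡ u′ → v ≡ v′ → w ≡ w′ → rows u v w ≡ rows u′ v′ w′
      det-cong refl refl refl = refl


  -- One row of adjugate times matrix. The other rows come from permuting the indices 1, 2, 3
  -- cyclically, which does not change the determinant.
  cofactor-diagonal : ∀ p₁ p₂ p₃ q₁ q₂ q₃ r₁ r₂ r₃ →
    (q₂ * r₃ + - (q₃ * r₂)) * p₁ + ((r₂ * p₃ + - (r₃ * p₂)) * q₁ + (p₂ * q₃ + - (p₃ * q₂)) * r₁)
    ≡ p₁ * (q₂ * r₃ + - (q₃ * r₂)) + p₂ * (q₃ * r₁ + - (q₁ * r₃)) + p₃ * (q₁ * r₂ + - (q₂ * r₁))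
  cofactor-diagonal = solve-∀

  cofactor-off₂ : ∀ p₁ p₂ p₃ q₁ q₂ q₃ r₁ r₂ r₃ →
    (q₂ * r₃ + - (q₃ * r₂)) * p₂ + ((r₂ * p₃ + - (r₃ * p₂)) * q₂ + (p₂ * q₃ + - (p₃ * q₂)) * r₂) ≡ 0ℤ
  cofactor-off₂ = solve-∀

  cofactor-off₃ : ∀ p₁ p₂ p₃ q₁ q₂ q₃ r₁ r₂ r₃ →
    (q₂ * r₃ + - (q₃ * r₂)) * p₃ + ((r₂ * p₃ + - (r₃ * p₂)) * q₃ + (p₂ * q₃ + - (p₃ * q₂)) * r₃) ≡ 0ℤ
  cofactor-off₃ = solve-∀

  det-rotate-columns : ∀ p₁ p₂ p₃ q₁ q₂ q₃ r₁ r₂ r₃ →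
    p₂ * (q₃ * r₁ + - (q₁ * r₃)) + p₃ * (q₁ * r₂ + - (q₂ * r₁)) + p₁ * (q₂ * r₃ + - (q₃ * r₂))
    ≡ p₁ * (q₂ * r₃ + - (q₃ * r₂)) + p₂ * (q₃ * r₁ + - (q₁ * r₃)) + p₃ * (q₁ * r₂ + - (q₂ * r₁))
  det-rotate-columns = solve-∀

  det-rotate-rows : ∀ p₁ p₂ p₃ q₁ q₂ q₃ r₁ r₂ r₃ →
    q₁ * (r₂ * p₃ + - (r₃ * p₂)) + q₂ * (r₃ * p₁ + - (r₁ * p₃)) + q₃ * (r₁ * p₂ + - (r₂ * p₁))
    ≡ p₁ * (q₂ * r₃ + - (q₃ * r₂)) + p₂ * (q₃ * r₁ + - (q₁ * r₃)) + p₃ * (q₁ * r₂ + - (q₂ * r₁))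
  det-rotate-rows = solve-∀

  -- Pairing the combination with the cross product of `q` and `r` annihilates both of them and
  -- leaves `a` times the determinant.
  cramer : ∀ a b d p₁ p₂ p₃ q₁ q₂ q₃ r₁ r₂ r₃ →
    a * (p₁ * (q₂ * r₃ + - (q₃ * r₂)) + p₂ * (q₃ * r₁ + - (q₁ * r₃)) + p₃ * (q₁ * r₂ + - (q₂ * r₁)))
    ≡ (a * p₁ + (b * q₁ + d * r₁)) * (q₂ * r₃ + - (q₃ * r₂)) + (a * p₂ + (b * q₂ + d * r₂)) * (q₃ * r₁ + - (q₁ * r₃))
      + (a * p₃ + (b * q₃ + d * r₃)) * (q₁ * r₂ + - (q₂ * r₁))
  cramer = solve-∀

  module _ (g h k : Elt) (D²≡1 : volume g h k * volume g h k ≡ 1ℤ) where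

    private
      p₀ = c0 g ; p₁ = c1 g ; p₂ = c2 g ; p₃ = c3 g
      q₀ = c0 h ; q₁ = c1 h ; q₂ = c2 h ; q₃ = c3 h
      r₀ = c0 k ; r₁ = c1 k ; r₂ = c2 k ; r₃ = c3 k

      D : ℤ
      D = volume g h k

      D*-cancel : ∀ a → a * D ≡ 0ℤ → a ≡ 0ℤ
      D*-cancel a e = trans (sym (ℤ.*-identityʳ a)) (trans (cong (a *_) (sym D²≡1)) (trans (sym (ℤ.*-assoc a D D)) (cong (_* D) e)))

      coefficients : ℤ → ℤ → ℤ → ℤ → Fin 4 → ℤ
      coefficients e u v w zero = e + - (u * p₀ + (v * q₀ + w * r₀))
      coefficients e u v w (suc zero) = u
      coefficients e u v w (suc (suc zero)) = v
      coefficients e u v w (suc (suc (suc zero))) = w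

      coefficients-correct : ∀ e u v w → combination (coefficients e u v w) oneE g h k
        ≡ ⟨ e , u * p₁ + (v * q₁ + w * r₁) , u * p₂ + (v * q₂ + w * r₂) , u * p₃ + (v * q₃ + w * r₃) ⟩
      coefficients-correct e u v w = ⟨⟩-cong (cancel e (u * p₀ + (v * q₀ + w * r₀))) (drop (e + - (u * p₀ + (v * q₀ + w * r₀))) _) (drop (e + - (u * p₀ + (v * q₀ + w * r₀))) _) (drop (e + - (u * p₀ + (v * q₀ + w * r₀))) _)
        where
        cancel : ∀ e s → (e + - s) * 1ℤ + s ≡ e
        cancel = solve-∀
        drop : ∀ i s → i * 0ℤ + s ≡ s
        drop = solve-∀

      scaled : ∀ x y z p q r {s t} → x * p + (y * q + z * r) ≡ s → D * s ≡ t → D * x * p + (D * y * q + D * z * r) ≡ t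
      scaled x y z p q r e f = trans (factor D x y z p q r) (trans (cong (D *_) e) f)
        where
        factor : ∀ D x y z p q r → D * x * p + (D * y * q + D * z * r) ≡ D * (x * p + (y * q + z * r))
        factor = solve-∀

      D*0 : D * 0ℤ ≡ 0ℤ
      D*0 = ℤ.*-zeroʳ D

    -- As `D² = 1`, the inverse matrix is `D` times the adjugate. The coefficient of 1 is then
    -- chosen to correct the remaining coordinate.
    generates : ∀ i → Σ (Fin 4 → ℤ) λ c → combination c oneE g h k ≡ basis i
    generates zero = coefficients 1ℤ 0ℤ 0ℤ 0ℤ , trans (coefficients-correct 1ℤ 0ℤ 0ℤ 0ℤ) (⟨⟩-cong refl refl refl refl)
    generates (suc zero) = coefficients 0ℤ (D * x) (D * y) (D * z) , trans (coefficients-correct 0ℤ (D * x) (D * y) (D * z)) (⟨⟩-cong refl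
        (scaled x y z p₁ q₁ r₁ (cofactor-diagonal p₁ p₂ p₃ q₁ q₂ q₃ r₁ r₂ r₃) D²≡1)
        (scaled x y z p₂ q₂ r₂ (cofactor-off₂ p₁ p₂ p₃ q₁ q₂ q₃ r₁ r₂ r₃) D*0)
        (scaled x y z p₃ q₃ r₃ (cofactor-off₃ p₁ p₂ p₃ q₁ q₂ q₃ r₁ r₂ r₃) D*0))
      where
      x = q₂ * r₃ + - (q₃ * r₂)
      y = r₂ * p₃ + - (r₃ * p₂)
      z = p₂ * q₃ + - (p₃ * q₂)
    generates (suc (suc zero)) = coefficients 0ℤ (D * x) (D * y) (D * z) , trans (coefficients-correct 0ℤ (D * x) (D * y) (D * z)) (⟨⟩-cong refl
        (scaled x y z p₁ q₁ r₁ (cofactor-off₃ p₂ p₃ p₁ q₂ q₃ q₁ r₂ r₃ r₁) D*0)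
        (scaled x y z p₂ q₂ r₂ (trans (cofactor-diagonal p₂ p₃ p₁ q₂ q₃ q₁ r₂ r₃ r₁) (det-rotate-columns p₁ p₂ p₃ q₁ q₂ q₃ r₁ r₂ r₃)) D²≡1)
        (scaled x y z p₃ q₃ r₃ (cofactor-off₂ p₂ p₃ p₁ q₂ q₃ q₁ r₂ r₃ r₁) D*0))
      where
      x = q₃ * r₁ + - (q₁ * r₃)
      y = r₃ * p₁ + - (r₁ * p₃)
      z = p₃ * q₁ + - (p₁ * q₃)
    generates (suc (suc (suc zero))) = coefficients 0ℤ (D * x) (D * y) (D * z) , trans (coefficients-correct 0ℤ (D * x) (D * y) (D * z)) (⟨⟩-cong refl
        (scaled x y z p₁ q₁ r₁ (cofactor-off₂ p₃ p₁ p₂ q₃ q₁ q₂ r₃ r₁ r₂) D*0)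
        (scaled x y z p₂ q₂ r₂ (cofactor-off₃ p₃ p₁ p₂ q₃ q₁ q₂ r₃ r₁ r₂) D*0)
        (scaled x y z p₃ q₃ r₃ (trans (cofactor-diagonal p₃ p₁ p₂ q₃ q₁ q₂ r₃ r₁ r₂) (sym (det-rotate-columns p₃ p₁ p₂ q₃ q₁ q₂ r₃ r₁ r₂))) D²≡1))
      where
      x = q₁ * r₂ + - (q₂ * r₁)
      y = r₁ * p₂ + - (r₂ * p₁)
      z = p₁ * q₂ + - (p₂ * q₁)

    independent : ∀ c → combination c oneE g h k ≡ zeroE → ∀ i → c i ≡ 0ℤ
    independent c e = λ { zero → c₀≡0 ; (suc zero) → a≡0 ; (suc (suc zero)) → b≡0 ; (suc (suc (suc zero))) → d≡0 }
      where
      a = c (suc zero)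
      b = c (suc (suc zero))
      d = c (suc (suc (suc zero)))
      drop : ∀ i s → i * 0ℤ + s ≡ s
      drop = solve-∀
      e₁ : a * p₁ + (b * q₁ + d * r₁) ≡ 0ℤ
      e₁ = trans (sym (drop (c zero) _)) (cong c1 e)
      e₂ : a * p₂ + (b * q₂ + d * r₂) ≡ 0ℤ
      e₂ = trans (sym (drop (c zero) _)) (cong c2 e)
      e₃ : a * p₃ + (b * q₃ + d * r₃) ≡ 0ℤ
      e₃ = trans (sym (drop (c zero) _)) (cong c3 e)
      zero-column : ∀ {s t u} x y z → s ≡ 0ℤ → t ≡ 0ℤ → u ≡ 0ℤ → s * x + t * y + u * z ≡ 0ℤ
      zero-column x y z refl refl refl = refl
      rotate : ∀ a b d {p q r} → a * p + (b * q + d * r) ≡ 0ℤ → b * q + (d * r + a * p) ≡ 0ℤ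
      rotate a b d {p} {q} {r} e = trans (eq (a * p) (b * q) (d * r)) e
        where
        eq : ∀ s t u → t + (u + s) ≡ s + (t + u)
        eq = solve-∀
      a≡0 : a ≡ 0ℤ
      a≡0 = D*-cancel a (trans (cramer a b d p₁ p₂ p₃ q₁ q₂ q₃ r₁ r₂ r₃)
        (zero-column (q₂ * r₃ + - (q₃ * r₂)) (q₃ * r₁ + - (q₁ * r₃)) (q₁ * r₂ + - (q₂ * r₁)) e₁ e₂ e₃))
      b≡0 : b ≡ 0ℤ
      b≡0 = D*-cancel b (trans (cong (b *_) (sym (det-rotate-rows p₁ p₂ p₃ q₁ q₂ q₃ r₁ r₂ r₃)))
        (trans (cramer b d a q₁ q₂ q₃ r₁ r₂ r₃ p₁ p₂ p₃)
          (zero-column (r₂ * p₃ + - (r₃ * p₂)) (r₃ * p₁ + - (r₁ * p₃)) (r₁ * p₂ + - (r₂ * p₁))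
            (rotate a b d {p₁} {q₁} {r₁} e₁) (rotate a b d {p₂} {q₂} {r₂} e₂) (rotate a b d {p₃} {q₃} {r₃} e₃))))
      d≡0 : d ≡ 0ℤ
      d≡0 = D*-cancel d (trans (cong (d *_) (det-rotate-rows r₁ r₂ r₃ p₁ p₂ p₃ q₁ q₂ q₃))
        (trans (cramer d a b r₁ r₂ r₃ p₁ p₂ p₃ q₁ q₂ q₃)
          (zero-column (p₂ * q₃ + - (p₃ * q₂)) (p₃ * q₁ + - (p₁ * q₃)) (p₁ * q₂ + - (p₂ * q₁))
            (rotate b d a {q₁} {r₁} {p₁} (rotate a b d {p₁} {q₁} {r₁} e₁)) (rotate b d a {q₂} {r₂} {p₂} (rotate a b d {p₂} {q₂} {r₂} e₂))
            (rotate b d a {q₃} {r₃} {p₃} (rotate a b d {p₃} {q₃} {r₃} e₃)))))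
      c₀≡0 : c zero ≡ 0ℤ
      c₀≡0 = trans (keep (c zero)) (trans (sym (cong (λ t → c zero * 1ℤ + t) (cong₂ _+_ (cong (_* p₀) a≡0) (cong₂ _+_ (cong (_* q₀) b≡0) (cong (_* r₀) d≡0))))) (cong c0 e))
        where
        keep : ∀ i → i ≡ i * 1ℤ + (0ℤ + (0ℤ + 0ℤ))
        keep = solve-∀

-- The index form equation and the generators.

module IndexForm where

  open FourthPowers
  open QuarticRing
  open UnitGroup using (square-abs; SameSign; same-sign)
  open ThueEquations
  open Determinants
  open import Data.Nat as ℕ using (ℕ; _<_; _%_)
  import Data.Nat.Properties as ℕ
  open import Data.Nat.Divisibility using (∣m+n∣m⇒∣n; ∣m⇒∣m*n; ∣n⇒∣m*n; ∣1⇒≡1)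
  import Data.Nat.Divisibility as ℕ
  open import Data.Nat.Coprimality using (Coprime) renaming (sym to coprime-sym)
  open import Data.Nat.Induction using (<-wellFounded)
  import Data.Nat.Tactic.RingSolver as ℕ
  open import Data.Integer using (ℤ; +_; -[1+_]; -_; _+_; _*_; 0ℤ; 1ℤ; ∣_∣)
  import Data.Integer.Properties as ℤ
  open import Data.Integer.Tactic.RingSolver using (solve-∀)
  open import Data.Bool using (if_then_else_)
  open import Data.List using (List; []; _∷_; _++_)
  open import Data.List.Membership.Propositional using (_∈_)
  open import Data.List.Membership.Propositional.Properties using (∈-++⁻)
  open import Data.List.Relation.Unary.Any using (here; there)
  open import Function using (case_of_)
  open import Data.Product using (Σ; ∃; _×_; _,_; proj₁; proj₂)
  open import Data.Sum using (_⊎_; inj₁; inj₂)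
  open import Data.Empty using (⊥-elim)
  open import Relation.Nullary using (yes; no)
  open import Relation.Nullary.Decidable using (⌊_⌋)
  open import Relation.Binary.PropositionalEquality using (_≡_; _≢_; refl; sym; trans; cong; cong₂; subst; subst₂)

  quadraticFactor coplanarity : ℕ → Elt → ℤ
  quadraticFactor m γ = c1 γ * c1 γ + - (+ m * (c3 γ * c3 γ))
  coplanarity m γ = c2 γ * c2 γ + - (c1 γ * c3 γ)

  IndexOne : ℕ → Elt → Set
  IndexOne m γ = quadraticFactor m γ * quadraticFactor m γ ≡ 1ℤ × c2 γ * c2 γ ≡ c1 γ * c3 γ

  powers-volume : ∀ m γ → let δ = quadraticFactor m γ ; κ = coplanarity m γ in
    volume (powE m γ 1) (powE m γ 2) (powE m γ 3) ≡ δ * (δ * δ + + 4 * (+ m * (κ * κ)))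
  powers-volume m γ@(⟨ w , x , y , z ⟩) = trans
    (cong (λ g → volume g (mulE m γ g) (mulE m γ (mulE m γ g))) (trans (mul-comm (+ m) γ oneE) (mul-identityˡ (+ m) γ)))
    (index-form (+ m) w x y z)

  abs-unit-square : ∀ i → ∣ i ∣ ≡ 1 → i * i ≡ 1ℤ
  abs-unit-square i e = trans (square-abs i) (cong (λ n → + (n ℕ.* n)) e)

  -- Both `δ` and the second factor divide 1. Once `δ² = 1`, the second factor is `1 + 4 m κ²`,
  -- which has absolute value 1 only for `κ = 0` because `m` is positive.
  unit-factors : ∀ m δ κ d → 0 < m → d * (δ * (δ * δ + + 4 * (+ m * (κ * κ)))) ≡ 1ℤ → δ * δ ≡ 1ℤ × κ ≡ 0ℤ
  unit-factors m δ κ d 0<m e = δ²≡1 , ℤ.∣i∣≡0⇒i≡0 k≡0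
    where
    G : ℤ
    G = δ * δ + + 4 * (+ m * (κ * κ))
    k : ℕ
    k = ∣ κ ∣
    δG : ∣ δ ∣ ℕ.* ∣ G ∣ ≡ 1
    δG = ℕ.m*n≡1⇒n≡1 ∣ d ∣ (∣ δ ∣ ℕ.* ∣ G ∣) (trans (cong (∣ d ∣ ℕ.*_) (sym (ℤ.abs-* δ G))) (trans (sym (ℤ.abs-* d (δ * G))) (cong ∣_∣ e)))
    δ²≡1 : δ * δ ≡ 1ℤ
    δ²≡1 = abs-unit-square δ (ℕ.m*n≡1⇒m≡1 ∣ δ ∣ ∣ G ∣ δG)
    G≡ : G ≡ + (1 ℕ.+ 4 ℕ.* (m ℕ.* (k ℕ.* k)))
    G≡ = cong₂ _+_ δ²≡1 (trans (cong (λ t → + 4 * t) (trans (cong (+ m *_) (square-abs κ)) (sym (ℤ.pos-* m (k ℕ.* k))))) (sym (ℤ.pos-* 4 (m ℕ.* (k ℕ.* k)))))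
    4mk²≡0 : 4 ℕ.* (m ℕ.* (k ℕ.* k)) ≡ 0
    4mk²≡0 = ℕ.suc-injective (trans (sym (cong ∣_∣ G≡)) (ℕ.m*n≡1⇒n≡1 ∣ δ ∣ ∣ G ∣ δG))
    k≡0 : k ≡ 0
    k≡0 with ℕ.m*n≡0⇒m≡0∨n≡0 m (ℕ.m+n≡0⇒m≡0 (m ℕ.* (k ℕ.* k)) 4mk²≡0)
    ... | inj₁ m≡0 = ⊥-elim (ℕ.<⇒≢ 0<m (sym m≡0))
    ... | inj₂ k²≡0 with ℕ.m*n≡0⇒m≡0∨n≡0 k k²≡0
    ...   | inj₁ q = q
    ...   | inj₂ q = q

  unit-volume : ∀ m δ κ → δ * δ ≡ 1ℤ → κ ≡ 0ℤ → ∀ V → V ≡ δ * (δ * δ + + 4 * (+ m * (κ * κ))) → V * V ≡ 1ℤ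
  unit-volume m δ κ δ²≡1 κ≡0 V V≡ = trans (cong₂ _*_ V≡δ V≡δ) δ²≡1
    where
    eq : ∀ d M → d * (1ℤ + + 4 * (M * (0ℤ * 0ℤ))) ≡ d
    eq = solve-∀
    V≡δ : V ≡ δ
    V≡δ = trans V≡ (trans (cong₂ (λ s k → δ * (s + + 4 * (+ m * (k * k)))) δ²≡1 κ≡0) (eq δ (+ m)))

  generator⇒IndexOne : ∀ m γ → 0 < m → PowerIntegralBasisGen m γ → IndexOne m γ
  generator⇒IndexOne m γ 0<m (gen , _) = proj₁ factors , ℤ.i-j≡0⇒i≡j (c2 γ * c2 γ) (c1 γ * c3 γ) (proj₂ factors)
    where
    δ κ : ℤ
    δ = quadraticFactor m γ
    κ = coplanarity m γ
    unit : ∃ λ d → d * volume (powE m γ 1) (powE m γ 2) (powE m γ 3) ≡ 1ℤ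
    unit = unimodular (powE m γ 1) (powE m γ 2) (powE m γ 3) gen
    factors : δ * δ ≡ 1ℤ × κ ≡ 0ℤ
    factors = unit-factors m δ κ (proj₁ unit) 0<m (trans (cong (proj₁ unit *_) (sym (powers-volume m γ))) (proj₂ unit))

  IndexOne⇒generator : ∀ m γ → IndexOne m γ → PowerIntegralBasisGen m γ
  IndexOne⇒generator m γ (δ²≡1 , y²≡xz) =
    generates (powE m γ 1) (powE m γ 2) (powE m γ 3) volume²≡1 , independent (powE m γ 1) (powE m γ 2) (powE m γ 3) volume²≡1
    where
    V : ℤ
    V = volume (powE m γ 1) (powE m γ 2) (powE m γ 3)
    volume²≡1 : V * V ≡ 1ℤ
    volume²≡1 = unit-volume m (quadraticFactor m γ) (coplanarity m γ) δ²≡1 (ℤ.i≡j⇒i-j≡0 y²≡xz) V (powers-volume m γ)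

  ∈-if : ∀ m {k} {t : ℤ × ℤ × ℤ} {ts} → t ∈ (if ⌊ m ℕ.≟ k ⌋ then ts else []) → m ≡ k × t ∈ ts
  ∈-if m {k} t∈ with m ℕ.≟ k
  ... | yes m≡k = m≡k , t∈
  ∈-if m {k} () | no _

  ∈-if-++ : ∀ m k ts {us} {t : ℤ × ℤ × ℤ} → t ∈ (if ⌊ m ℕ.≟ k ⌋ then ts else []) ++ us → (m ≡ k × t ∈ ts) ⊎ t ∈ us
  ∈-if-++ m k ts t∈ with m ℕ.≟ k
  ... | no _ = inj₂ t∈
  ... | yes m≡k with ∈-++⁻ ts t∈
  ...   | inj₁ t∈ts = inj₁ (m≡k , t∈ts)
  ...   | inj₂ t∈us = inj₂ t∈us

  ±y : ℕ → ℕ → ℕ → List (ℤ × ℤ × ℤ)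
  ±y x y z = (+ x , + y , + z) ∷ (+ x , - (+ y) , + z) ∷ []

  in-pair : ∀ k x y z {t} → IndexOne k (theta (+ x , + y , + z)) → IndexOne k (theta (+ x , - (+ y) , + z)) → t ∈ ±y x y z → IndexOne k (theta t)
  in-pair k x y z p q (here refl) = p
  in-pair k x y z p q (there (here refl)) = q

  solution-IndexOne : ∀ m t → t ∈ solutions m → IndexOne m (theta t)
  solution-IndexOne m t (here refl) = trans (cong (λ n → n * n) (eq (+ m))) refl , refl
    where
    eq : ∀ M → 1ℤ * 1ℤ + - (M * (0ℤ * 0ℤ)) ≡ 1ℤ
    eq = solve-∀
  solution-IndexOne m t (there t∈₁) = case ∈-if-++ m 2 (±y 1 1 1) t∈₁ of λ
    { (inj₁ (refl , t∈)) → in-pair 2 1 1 1 (refl , refl) (refl , refl) t∈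
    ; (inj₂ t∈₂) → case ∈-if-++ m 15 (±y 4 2 1) t∈₂ of λ
    { (inj₁ (refl , t∈)) → in-pair 15 4 2 1 (refl , refl) (refl , refl) t∈
    ; (inj₂ t∈₃) → case ∈-if-++ m 39 (±y 25 10 4) t∈₃ of λ
    { (inj₁ (refl , t∈)) → in-pair 39 25 10 4 (refl , refl) (refl , refl) t∈
    ; (inj₂ t∈₄) → case ∈-if-++ m 82 (±y 9 3 1) t∈₄ of λ
    { (inj₁ (refl , t∈)) → in-pair 82 9 3 1 (refl , refl) (refl , refl) t∈
    ; (inj₂ t∈₅) → case ∈-if-++ m 255 (±y 16 4 1) t∈₅ of λ
    { (inj₁ (refl , t∈)) → in-pair 255 16 4 1 (refl , refl) (refl , refl) t∈
    ; (inj₂ t∈₆) → case ∈-if-++ m 915 (±y 121 22 4) t∈₆ of λ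
    { (inj₁ (refl , t∈)) → in-pair 915 121 22 4 (refl , refl) (refl , refl) t∈
    ; (inj₂ t∈₇) → case ∈-if m {1295} {ts = ±y 36 6 1} t∈₇ of λ { (refl , t∈) → in-pair 1295 36 6 1 (refl , refl) (refl , refl) t∈ } } } } } } }

  found : ∀ {m a b} → (m , a , b) ∈ plusSolutions ⊎ (m , a , b) ∈ minusSolutions → ∀ y → ∣ y ∣ ≡ a ℕ.* b →
    (+ (a ℕ.* a) , y , + (b ℕ.* b)) ∈ solutions m
  found {m} {a} {b} s (+ n) refl = positive s
    where
    positive : (m , a , b) ∈ plusSolutions ⊎ (m , a , b) ∈ minusSolutions → (+ (a ℕ.* a) , + (a ℕ.* b) , + (b ℕ.* b)) ∈ solutions m
    positive (inj₁ (here refl)) = there (here refl)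
    positive (inj₁ (there (here refl))) = there (here refl)
    positive (inj₁ (there (there (here refl)))) = there (here refl)
    positive (inj₁ (there (there (there (here refl))))) = there (here refl)
    positive (inj₁ (there (there (there (there (here refl)))))) = there (here refl)
    positive (inj₂ (here refl)) = there (here refl)
    positive (inj₂ (there (here refl))) = there (here refl)
  found {m} {a} {b} s y@(-[1+ n ]) e = subst (λ y → (+ (a ℕ.* a) , y , + (b ℕ.* b)) ∈ solutions m) (sym (cong (λ k → - (+ k)) e)) (negative s)
    where
    negative : (m , a , b) ∈ plusSolutions ⊎ (m , a , b) ∈ minusSolutions → (+ (a ℕ.* a) , - (+ (a ℕ.* b)) , + (b ℕ.* b)) ∈ solutions m
    negative (inj₁ (here refl)) = there (there (here refl))
    negative (inj₁ (there (here refl))) = there (there (here refl))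
    negative (inj₁ (there (there (here refl)))) = there (there (here refl))
    negative (inj₁ (there (there (there (here refl))))) = there (there (here refl))
    negative (inj₁ (there (there (there (there (here refl)))))) = there (there (here refl))
    negative (inj₂ (here refl)) = there (there (here refl))
    negative (inj₂ (there (here refl))) = there (there (here refl))

  opposite : ∀ a x → a + x ≡ 0ℤ → a ≡ - x
  opposite a x e = trans (eq a x) (trans (cong (_+ - x) e) (ℤ.+-identityˡ (- x)))
    where
    eq : ∀ a b → a ≡ a + b + - b
    eq = solve-∀

  -- The conditions are quadratic in `c1`, `c2`, `c3` and free of `c0`, hence unchanged by a sign
  -- and by adding an integer.
  Equivalent⇒IndexOne : ∀ m γ t → Equivalent γ (theta t) → IndexOne m (theta t) → IndexOne m γ
  Equivalent⇒IndexOne m ⟨ w , a , b , c ⟩ (x , y , z) (inj₂ (e₁ , e₂ , e₃)) index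
    rewrite ℤ.i-j≡0⇒i≡j a x e₁ | ℤ.i-j≡0⇒i≡j b y e₂ | ℤ.i-j≡0⇒i≡j c z e₃ = index
  Equivalent⇒IndexOne m ⟨ w , a , b , c ⟩ (x , y , z) (inj₁ (e₁ , e₂ , e₃)) (δ²≡1 , y²≡xz)
    rewrite opposite a x e₁ | opposite b y e₂ | opposite c z e₃ =
      trans (cong₂ (λ u v → (u + - (+ m * v)) * (u + - (+ m * v))) (neg-* x x) (neg-* z z)) δ²≡1 ,
      trans (neg-* y y) (trans y²≡xz (sym (neg-* x z)))
    where
    neg-* : ∀ a b → - a * - b ≡ a * b
    neg-* = solve-∀

  PellEquation : ℕ → ℕ → ℕ → Set
  PellEquation m α c = α ℕ.* α ≡ m ℕ.* (c ℕ.* c) ℕ.+ 1 ⊎ α ℕ.* α ℕ.+ 1 ≡ m ℕ.* (c ℕ.* c)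

  pell-equation : ∀ m x z → (x * x + - (+ m * (z * z))) * (x * x + - (+ m * (z * z))) ≡ 1ℤ → PellEquation m (∣ x ∣) (∣ z ∣)
  pell-equation m x z δ²≡1 = sign-cases δ refl (ℕ.m*n≡1⇒m≡1 ∣ δ ∣ ∣ δ ∣ (trans (sym (ℤ.abs-* δ δ)) (cong ∣_∣ δ²≡1)))
    where
    δ : ℤ
    δ = x * x + - (+ m * (z * z))
    mz² : + m * (z * z) ≡ + (m ℕ.* (∣ z ∣ ℕ.* ∣ z ∣))
    mz² = trans (cong (+ m *_) (square-abs z)) (sym (ℤ.pos-* m _))
    split : ∀ a b → a ≡ a + - b + b
    split = solve-∀
    split′ : ∀ a b → a + - (a + - b) ≡ b
    split′ = solve-∀
    sign-cases : ∀ d → δ ≡ d → ∣ d ∣ ≡ 1 → PellEquation m (∣ x ∣) (∣ z ∣)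
    sign-cases (+ 1) e refl = inj₁ (ℤ.+-injective (trans (sym (square-abs x)) (trans (split (x * x) (+ m * (z * z)))
      (trans (cong₂ _+_ e mz²) (ℤ.+-comm 1ℤ (+ (m ℕ.* (∣ z ∣ ℕ.* ∣ z ∣))))))))
    sign-cases -[1+ 0 ] e refl = inj₂ (ℤ.+-injective (trans (cong (_+ 1ℤ) (sym (square-abs x)))
      (trans (cong (λ d → x * x + - d) (sym e)) (trans (split′ (x * x) (+ m * (z * z))) mz²))))

  data Classified (m α η c : ℕ) : Set where
    rational : c ≡ 0 → α ≡ 1 → η ≡ 0 → Classified m α η c
    nontrivial : ∀ a b → α ≡ a ℕ.* a → c ≡ b ℕ.* b → η ≡ a ℕ.* b → (m , a , b) ∈ plusSolutions ⊎ (m , a , b) ∈ minusSolutions → Classified m α η c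

  module _ (m : ℕ) (1<m : 1 < m) (m<2000 : m < 2000) (sqf : SquareFree m) (m%4 : m % 4 ≡ 2 ⊎ m % 4 ≡ 3) (m-odd : 400 < m → m % 2 ≡ 1) where

    private
      m≢0 : m ≢ 0
      m≢0 refl = ℕ.<⇒≱ 1<m ℕ.z≤n

      coprime : ∀ α c → PellEquation m α c → Coprime α c
      coprime α c (inj₁ e) {d} (d∣α , d∣c) = ∣1⇒≡1 (∣m+n∣m⇒∣n (subst (d ℕ.∣_) e (∣m⇒∣m*n α d∣α)) (∣n⇒∣m*n m (∣m⇒∣m*n c d∣c)))
      coprime α c (inj₂ e) {d} (d∣α , d∣c) = ∣1⇒≡1 (∣m+n∣m⇒∣n (subst (d ℕ.∣_) (sym e) (∣n⇒∣m*n m (∣m⇒∣m*n c d∣c))) (∣m⇒∣m*n α d∣α))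

      classify-squares : ∀ η a b → η ≡ a ℕ.* b → PellEquation m (a ℕ.* a) (b ℕ.* b) → Classified m (a ℕ.* a) η (b ℕ.* b)
      classify-squares η a b η≡ (inj₂ e) = nontrivial a b refl refl η≡ (inj₂ (minus-solutions m m≢0 (4∤ m%4) (controlled-by-hypotheses 1<m m<2000 sqf m%4 m-odd) a b e))
      classify-squares η a b η≡ (inj₁ e) = cases (plus-solutions m m≢0 (4∤ m%4) (controlled-by-hypotheses 1<m m<2000 sqf m%4 m-odd) a b (<-wellFounded b) e)
        where
        cases : b ≡ 0 ⊎ (m , a , b) ∈ plusSolutions → Classified m (a ℕ.* a) η (b ℕ.* b)
        cases (inj₂ s) = nontrivial a b refl refl η≡ (inj₁ s)
        cases (inj₁ b≡0) = rational (cong (λ n → n ℕ.* n) b≡0)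
          (ℕ.m*n≡1⇒m≡1 (a ℕ.* a) (a ℕ.* a) (trans e (trans (cong (λ n → m ℕ.* n ⁴ ℕ.+ 1) b≡0) (cong (ℕ._+ 1) (ℕ.*-zeroʳ m)))))
          (trans η≡ (trans (cong (a ℕ.*_) b≡0) (ℕ.*-zeroʳ a)))

      -- The Pell equation makes `α` and `c` coprime, so both are squares as soon as their product
      -- is one.
      classify : ∀ α η c → η ℕ.* η ≡ α ℕ.* c → PellEquation m α c → Classified m α η c
      classify α η c η²≡ e = from-squares (coprime-square α c η (coprime α c e) (sym η²≡))
        (coprime-square c α η (coprime-sym (coprime α c e)) (trans (ℕ.*-comm c α) (sym η²≡)))
        where
        interchange : ∀ a b → a ℕ.* a ℕ.* (b ℕ.* b) ≡ a ℕ.* b ℕ.* (a ℕ.* b)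
        interchange = ℕ.solve-∀
        from-squares : (∃ λ a → α ≡ a ℕ.* a) → (∃ λ b → c ≡ b ℕ.* b) → Classified m α η c
        from-squares (a , α≡) (b , c≡) = subst₂ (λ α c → Classified m α η c) (sym α≡) (sym c≡)
          (classify-squares η a b (square-injective (trans η²≡ (trans (cong₂ ℕ._*_ α≡ c≡) (interchange a b)))) (subst₂ (PellEquation m) α≡ c≡ e))

      solution : ∀ {α y c} → Classified m α ∣ y ∣ c → (+ α , y , + c) ∈ solutions m
      solution {y = y} (rational refl refl η≡0) = here (cong (λ y → (+ 1 , y , + 0)) (ℤ.∣i∣≡0⇒i≡0 η≡0))
      solution {y = y} (nontrivial a b refl refl η≡ s) = found s y η≡

    -- Since `x z = y²`, `x` and `z` do not have opposite signs. If they are nonnegative, `γ - ϑ`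
    -- lies in ℤ; otherwise all three coordinates are negated and `γ + ϑ` does.
    IndexOne⇒solution : ∀ γ → IndexOne m γ → Σ (ℤ × ℤ × ℤ) λ t → (t ∈ solutions m) × Equivalent γ (theta t)
    IndexOne⇒solution ⟨ w , x , y , z ⟩ (δ²≡1 , y²≡xz) = by-sign (same-sign x z (trans (sym y²≡xz) (square-abs y)))
      where
      classified : Classified m (∣ x ∣) (∣ y ∣) (∣ z ∣)
      classified = classify (∣ x ∣) (∣ y ∣) (∣ z ∣) (trans (sym (ℤ.abs-* y y)) (trans (cong ∣_∣ y²≡xz) (ℤ.abs-* x z))) (pell-equation m x z δ²≡1)
      by-sign : SameSign x z → Σ (ℤ × ℤ × ℤ) λ t → (t ∈ solutions m) × Equivalent ⟨ w , x , y , z ⟩ (theta t)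
      by-sign (inj₁ (α , c , refl , refl)) = (+ α , y , + c) , solution classified ,
        inj₂ (ℤ.+-inverseʳ (+ α) , ℤ.+-inverseʳ y , ℤ.+-inverseʳ (+ c))
      by-sign (inj₂ (α , c , refl , refl)) = (+ α , - y , + c) ,
        solution (subst₂ (λ α c → Classified m α ∣ - y ∣ c) (ℤ.∣-i∣≡∣i∣ (+ α)) (ℤ.∣-i∣≡∣i∣ (+ c)) (subst (λ η → Classified m _ η _) (sym (ℤ.∣-i∣≡∣i∣ y)) classified)) ,
        inj₁ (ℤ.+-inverseˡ (+ α) , ℤ.+-inverseʳ y , ℤ.+-inverseˡ (+ c))

    generator⇒solution : ∀ γ → PowerIntegralBasisGen m γ → Σ (ℤ × ℤ × ℤ) λ t → (t ∈ solutions m) × Equivalent γ (theta t)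
    generator⇒solution γ generator = IndexOne⇒solution γ (generator⇒IndexOne m γ (ℕ.<-trans (ℕ.s≤s ℕ.z≤n) 1<m) generator)

open IndexForm

theorem4 : (m : ℕ) → 1 < m → m < 2000 → SquareFree m
    → (m % 4 ≡ 2 ⊎ m % 4 ≡ 3)
    → (400 < m → m % 2 ≡ 1)
    → (γ : Elt)
    → (PowerIntegralBasisGen m γ
    → Σ (ℤ × ℤ × ℤ) λ t → (t ∈ solutions m) × Equivalent γ (theta t))
    × (∀ (t : ℤ × ℤ × ℤ) → t ∈ solutions m → Equivalent γ (theta t)
    → PowerIntegralBasisGen m γ)
theorem4 m 1<m m<2000 sqf m%4 m-odd γ =
  generator⇒solution m 1<m m<2000 sqf m%4 m-odd γ ,
  λ t t∈ γ~t → IndexOne⇒generator m γ (Equivalent⇒IndexOne m γ t γ~t (solution-IndexOne m t t∈))
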